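{- For each $2 \leqslant s \leqslant t$, there exists a constant $C = C(s,t)$ such that the following holds for all sufficiently large $n, k \in \mathbb{N}$ with $k \leqslant n^{(s-1)/s(st-1)}/(\log n)^{1/(s-1)}$. There exists a collection $\mathcal{G}_{s,t}(k)$ of at most $\exp\big( C k^{ -(s-1)} n^{2-1/s} \log k \big)$ graphs on vertex set $[n]$ such that $e(G) \leqslant k n^{2-1/s}$ for every $G \in \mathcal{G}_{s,t}(k)$, and every $K_{s,t}$-free graph on vertex set $[n]$ is a subgraph of some $G \in \mathcal{G}_{s,t}(k)$.
   Context: $K_{s,t}$ is the complete bipartite graph with part sizes $s$ and $t$; $e(G)$ is the number of edges of $G$. -}

module Defs where

open import Data.Nat using (ℕ; zero; suc; _+_; _*_; _∸_; _^_; _≤_; _<_)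
open import Data.Fin using (Fin; toℕ)
open import Data.Bool using (Bool; true; false; if_then_else_; _∧_)
open import Data.List using (List; map; allFin)
open import Data.Nat.ListAction using (sum)
open import Data.Product using (Σ; ∃; _×_; _,_)
open import Relation.Binary.PropositionalEquality using (_≡_; _≢_)
open import Relation.Nullary using (¬_)
open import Relation.Nullary.Decidable using (⌊_⌋)
open import Function.Definitions using (Injective)
open import Data.Integer using (+_)
import Data.Nat as N
import Data.Rational as Q
open Q using (ℚ)

record Graph (n : ℕ) : Set where
  field
    adj   : Fin n → Fin n → Bool
    sym   : ∀ i j → adj i j ≡ adj j i
    irref : ∀ i → adj i i ≡ false
open Graph public

e : ∀ {n} → Graph n → ℕ
e {n} G = sum (map (λ i → sum (map (λ j →
  if ⌊ toℕ i N.<? toℕ j ⌋ ∧ adj G i j then 1 else 0) (allFin n))) (allFin n))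

_⊆G_ : ∀ {n} → Graph n → Graph n → Set
H ⊆G G = ∀ i j → adj H i j ≡ true → adj G i j ≡ true

ContainsK : ℕ → ℕ → ∀ {n} → Graph n → Set
ContainsK s t {n} G =
  Σ (Fin s → Fin n) λ a → Σ (Fin t → Fin n) λ b →
    Injective _≡_ _≡_ a × Injective _≡_ _≡_ b ×
    (∀ i j → a i ≢ b j) × (∀ i j → adj G (a i) (b j) ≡ true)

KFree : ℕ → ℕ → ∀ {n} → Graph n → Set
KFree s t G = ¬ ContainsK s t G

ℕtoℚ : ℕ → ℚ
ℕtoℚ m = (+ m) Q./ 1

powQ : ℚ → ℕ → ℚ
powQ q zero = Q.1ℚ
powQ q (suc m) = q Q.* powQ q m

expTerm : ℚ → ℕ → ℚ
expTerm r zero = Q.1ℚ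
expTerm r (suc i) = (expTerm r i Q.* r) Q.* ((+ 1) Q./ suc i)

expPartial : ℚ → ℕ → ℚ
expPartial r zero = expTerm r zero
expPartial r (suc N) = expPartial r N Q.+ expTerm r (suc N)

-- exp r ≤ m  (for r ≥ 0), i.e. r ≤ log m: all partial sums are ≤ m.
ExpLe : ℚ → ℕ → Set
ExpLe r m = ∀ N → expPartial r N Q.≤ ℕtoℚ m

-- r < log m  (natural logarithm), for m ≥ 1:
-- there is a rational r' ≥ 0 with r < r' and exp r' ≤ m.
LtLog : ℚ → ℕ → Set
LtLog r m = Σ ℚ λ r' → (r Q.< r') × (Q.0ℚ Q.≤ r') × ExpLe r' m

-- The range condition  k ≤ n^{(s-1)/(s(st-1))} / (log n)^{1/(s-1)},
-- equivalently (k^{s-1} · log n)^{s(st-1)} ≤ n^{(s-1)^2}, expressed as: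
-- for every rational 0 ≤ r < log n, (k^{s-1} · r)^{s(st-1)} ≤ n^{(s-1)^2}.
KRange : ℕ → ℕ → ℕ → ℕ → Set
KRange s t n k = ∀ (r : ℚ) → Q.0ℚ Q.≤ r → LtLog r n →
  powQ (ℕtoℚ (k ^ (s ∸ 1)) Q.* r) (s * (s * t ∸ 1)) Q.≤ ℕtoℚ (n ^ ((s ∸ 1) * (s ∸ 1)))

-- ⌈n^{2-1/s}⌉-type quantity: N is at least n^{2-1/s}  ⇔  N^s ≥ n^{2s-1}.
AtLeastPow : ℕ → ℕ → ℕ → Set
AtLeastPow s n N = n ^ (2 * s ∸ 1) ≤ N ^ s

-- e(G) ≤ k n^{2-1/s}  ⇔  e(G)^s ≤ k^s n^{2s-1}
EdgeBound : ℕ → ℕ → ℕ → ℕ → Set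
EdgeBound s n k m = m ^ s ≤ k ^ s * n ^ (2 * s ∸ 1)

{-# OPTIONS --safe #-}
-- The containers are built by repeatedly shrinking a relation D ⊇ E(H) on [n], starting from the full one.
-- If D has m ≥ K N pairs, N ≈ n^(2-1/s), then for some d the rows with at least sd entries carry many s-stars;
-- trimming these rows to sd entries makes D regular, and cutting the common neighbourhoods of s-tuples into blocks
-- of size tℓ yields a family of copies of K_{s,t} that is spread over the pairs at density 1/b, where
-- b ≈ K · min (K , K∞)^(s-1) and K∞ ≈ n^((s-1)/(s(st-1))).
-- The hypergraph container algorithm then loses a constant proportion of the trimmed pairs at the price of a
-- factor 2^O(log b / b) per lost pair. Summing over K = k, 2k, 4k, ... the price decays like K^-(s-1) up to K∞;
-- beyond K∞ there are O(log n) further scales, and the hypothesis on k pays for them.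
-- All of K, d, ℓ, b are powers of two, so that the exponents are linear.

module Submission where

-- A dyadic pigeonhole for d would lose a logarithm. Weighting the degree levels by x^2 loses only a
-- constant, since the sum of 1/x^2 converges, and for s ≥ 2 it still yields as many s-stars as a
-- regular relation has, up to a constant. A pattern meeting u columns and v rows of a copy fixes at
-- most uv pairs and extends in at most d^(s-u) ℓ^(t-v) ways. The spread condition is therefore
-- bilinear in (u , v) and reduces to its extremes: b ≤ d, b ≤ ℓ and, up to constants, b^(st-1) ≤
-- d^(s-1) ℓ^(t-1). With ℓ ≈ K^s and d at least of order K n^(1-1/s), the second says b ≤ K^s and
-- the third b ≤ K K∞^(s-1), which is the origin of K∞. The containers are counted by a recurrence
-- with two branches whose exact solution is (b/(b-1))^a b^q, so no binomial coefficients occur.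
-- Constants are used directly as exponents through C < 2^C.

open import Defs hiding (sym)

-- The exponential series and the range condition in natural numbers

module ExpLog where

  open import Data.Nat as ℕ using (ℕ; zero; suc; z≤n; s≤s)
  import Data.Nat.Properties as ℕ
  import Data.Integer as ℤ
  import Data.Integer.Properties as ℤ
  open import Data.Rational
  open import Data.Rational.Properties
  open import Data.Rational.Solver using (module +-*-Solver)
  open import Data.Rational.Unnormalised as ℚᵘ using (mkℚᵘ; *≡*; *≤*)
  import Data.Rational.Unnormalised.Properties as ℚᵘ
  open import Data.Product using (Σ; _×_; _,_)
  open import Relation.Binary.PropositionalEquality
  open +-*-Solver using (solve; _:+_; _:*_; _:=_)

  toℚᵘ-ℕtoℚ : ∀ m → toℚᵘ (ℕtoℚ m) ℚᵘ.≃ mkℚᵘ (ℤ.+ m) 0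
  toℚᵘ-ℕtoℚ m = toℚᵘ-fromℚᵘ (mkℚᵘ (ℤ.+ m) 0)

  ℕtoℚ-+ : ∀ a b → ℕtoℚ (a ℕ.+ b) ≡ ℕtoℚ a + ℕtoℚ b
  ℕtoℚ-+ a b = toℚᵘ-injective (ℚᵘ.≃-trans (toℚᵘ-ℕtoℚ (a ℕ.+ b)) (ℚᵘ.≃-sym
    (ℚᵘ.≃-trans (toℚᵘ-homo-+ (ℕtoℚ a) (ℕtoℚ b)) (ℚᵘ.≃-trans (ℚᵘ.+-cong (toℚᵘ-ℕtoℚ a) (toℚᵘ-ℕtoℚ b))
      (*≡* (cong (ℤ._* ℤ.+ 1) (cong₂ ℤ._+_ (ℤ.*-identityʳ (ℤ.+ a)) (ℤ.*-identityʳ (ℤ.+ b)))))))))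

  ℕtoℚ-* : ∀ a b → ℕtoℚ (a ℕ.* b) ≡ ℕtoℚ a * ℕtoℚ b
  ℕtoℚ-* a b = toℚᵘ-injective (ℚᵘ.≃-trans (toℚᵘ-ℕtoℚ (a ℕ.* b)) (ℚᵘ.≃-sym
    (ℚᵘ.≃-trans (toℚᵘ-homo-* (ℕtoℚ a) (ℕtoℚ b)) (ℚᵘ.≃-trans (ℚᵘ.*-cong (toℚᵘ-ℕtoℚ a) (toℚᵘ-ℕtoℚ b))
      (*≡* (cong (ℤ._* ℤ.+ 1) (sym (ℤ.pos-* a b))))))))

  ℕtoℚ-cancel-≤ : ∀ {a b} → ℕtoℚ a ≤ ℕtoℚ b → a ℕ.≤ b
  ℕtoℚ-cancel-≤ {a} {b} h with ℚᵘ.≤-respʳ-≃ (toℚᵘ-ℕtoℚ b) (ℚᵘ.≤-respˡ-≃ (toℚᵘ-ℕtoℚ a) (toℚᵘ-mono-≤ h))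
  ... | *≤* p = ℤ.drop‿+≤+ (subst₂ ℤ._≤_ (ℤ.*-identityʳ (ℤ.+ a)) (ℤ.*-identityʳ (ℤ.+ b)) p)

  ℕtoℚ-mono-≤ : ∀ {a b} → a ℕ.≤ b → ℕtoℚ a ≤ ℕtoℚ b
  ℕtoℚ-mono-≤ {a} {b} h = toℚᵘ-cancel-≤ (ℚᵘ.≤-respʳ-≃ (ℚᵘ.≃-sym (toℚᵘ-ℕtoℚ b)) (ℚᵘ.≤-respˡ-≃ (ℚᵘ.≃-sym (toℚᵘ-ℕtoℚ a))
    (*≤* (subst₂ ℤ._≤_ (sym (ℤ.*-identityʳ (ℤ.+ a))) (sym (ℤ.*-identityʳ (ℤ.+ b))) (ℤ.+≤+ h)))))

  powQ-ℕtoℚ : ∀ a m → powQ (ℕtoℚ a) m ≡ ℕtoℚ (a ℕ.^ m)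
  powQ-ℕtoℚ a zero    = refl
  powQ-ℕtoℚ a (suc m) = trans (cong (ℕtoℚ a *_) (powQ-ℕtoℚ a m)) (sym (ℕtoℚ-* a (a ℕ.^ m)))

  private
    u : ℕ → ℚ
    u i = (ℤ.+ 1) / suc i

    u-nonNeg : ∀ i → NonNegative (u i)
    u-nonNeg i = normalize-nonNeg 1 (suc i)

  u-inverse : ∀ i → ℕtoℚ (suc i) * ((ℤ.+ 1) / suc i) ≡ 1ℚ
  u-inverse i = toℚᵘ-injective (ℚᵘ.≃-trans (toℚᵘ-homo-* (ℕtoℚ (suc i)) (u i))
    (ℚᵘ.≃-trans (ℚᵘ.*-cong (toℚᵘ-ℕtoℚ (suc i)) (toℚᵘ-fromℚᵘ (mkℚᵘ (ℤ.+ 1) i)))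
      (*≡* (trans (ℤ.*-identityʳ _) (trans (ℤ.*-comm (ℤ.+ suc i) (ℤ.+ 1)) (cong (λ z → ℤ.+ 1 ℤ.* (ℤ.+ z)) (sym (ℕ.*-identityˡ (suc i)))))))))

  expTerm-nonNeg : ∀ x .{{_ : NonNegative x}} i → NonNegative (expTerm x i)
  expTerm-nonNeg x zero    = _
  expTerm-nonNeg x (suc i) = nonNeg*nonNeg⇒nonNeg (expTerm x i * x)
    {{nonNeg*nonNeg⇒nonNeg (expTerm x i) {{expTerm-nonNeg x i}} x}} (u i) {{u-nonNeg i}}

  expTerm-recurrence : ∀ x i → ℕtoℚ (suc i) * expTerm x (suc i) ≡ expTerm x i * x
  expTerm-recurrence x i = begin
    ℕtoℚ (suc i) * (expTerm x i * x * u i)  ≡⟨ perm (ℕtoℚ (suc i)) (expTerm x i * x) (u i) ⟩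
    ℕtoℚ (suc i) * u i * (expTerm x i * x)  ≡⟨ cong (_* (expTerm x i * x)) (u-inverse i) ⟩
    1ℚ * (expTerm x i * x)  ≡⟨ *-identityˡ _ ⟩
    expTerm x i * x ∎
    where
    open ≡-Reasoning
    perm : ∀ a b c → a * (b * c) ≡ a * c * b
    perm = solve 3 (λ a b c → a :* (b :* c) := a :* c :* b) refl

  module _ (x h : ℚ) {{x≥0 : NonNegative x}} {{h≥0 : NonNegative h}} where

    private
      y : ℚ
      y = x + h

      instance
        y≥0 : NonNegative y
        y≥0 = nonNeg+nonNeg⇒nonNeg x h

    -- the mean value estimate y ^ (i + 1) - x ^ (i + 1) ≤ (i + 1) (y - x) y ^ i, divided by (i + 1)!
    expTerm-step : ∀ i → expTerm y (suc i) ≤ expTerm x (suc i) + h * expTerm y i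
    expTerm-step zero = ≤-reflexive (trans (eq x h 1ℚ) (cong (1ℚ * x * 1ℚ +_) (*-identityʳ (h * 1ℚ))))
      where
      eq : ∀ x h o → o * (x + h) * o ≡ o * x * o + h * o * o
      eq = solve 3 (λ x h o → o :* (x :+ h) :* o := o :* x :* o :+ h :* o :* o) refl
    expTerm-step (suc i) = begin
      T (suc i) * y * u (suc i)
        ≤⟨ *-monoʳ-≤-nonNeg (u (suc i)) {{u-nonNeg (suc i)}} bound ⟩
      (expTerm x (suc i) * x + h * (ℕtoℚ (suc (suc i)) * T (suc i))) * u (suc i)
        ≡⟨ perm₂ (expTerm x (suc i) * x) h (ℕtoℚ (suc (suc i))) (T (suc i)) (u (suc i)) ⟩
      expTerm x (suc i) * x * u (suc i) + h * (ℕtoℚ (suc (suc i)) * u (suc i) * T (suc i))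
        ≡⟨ cong (λ z → expTerm x (suc i) * x * u (suc i) + h * z)
             (trans (cong (_* T (suc i)) (u-inverse (suc i))) (*-identityˡ (T (suc i)))) ⟩
      expTerm x (suc (suc i)) + h * T (suc i) ∎
      where
      open ≤-Reasoning
      T : ℕ → ℚ
      T = expTerm y
      perm₁ : ∀ t x h → t * (x + h) ≡ t * x + h * t
      perm₁ = solve 3 (λ t x h → t :* (x :+ h) := t :* x :+ h :* t) refl
      perm₂ : ∀ a h n t u → (a + h * (n * t)) * u ≡ a * u + h * (n * u * t)
      perm₂ = solve 5 (λ a h n t u → (a :+ h :* (n :* t)) :* u := a :* u :+ h :* (n :* u :* t)) refl
      perm₃ : ∀ e x h t s → (e + h * t) * x + h * s ≡ e * x + h * (t * x + s)
      perm₃ = solve 5 (λ e x h t s → (e :+ h :* t) :* x :+ h :* s := e :* x :+ h :* (t :* x :+ s)) refl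
      perm₄ : ∀ n s o → n * s + o * s ≡ (o + n) * s
      perm₄ = solve 3 (λ n s o → n :* s :+ o :* s := (o :+ n) :* s) refl
      x≤y : x ≤ y
      x≤y = ≤-trans (≤-reflexive (sym (+-identityʳ x))) (+-monoʳ-≤ x (nonNegative⁻¹ h))
      bound : T (suc i) * y ≤ expTerm x (suc i) * x + h * (ℕtoℚ (suc (suc i)) * T (suc i))
      bound = begin
        T (suc i) * (x + h)
          ≡⟨ perm₁ (T (suc i)) x h ⟩
        T (suc i) * x + h * T (suc i)
          ≤⟨ +-monoˡ-≤ (h * T (suc i)) (*-monoʳ-≤-nonNeg x (expTerm-step i)) ⟩
        (expTerm x (suc i) + h * T i) * x + h * T (suc i)
          ≡⟨ perm₃ (expTerm x (suc i)) x h (T i) (T (suc i)) ⟩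
        expTerm x (suc i) * x + h * (T i * x + T (suc i))
          ≤⟨ +-monoʳ-≤ (expTerm x (suc i) * x) (*-monoˡ-≤-nonNeg h (+-monoˡ-≤ (T (suc i))
               (*-monoˡ-≤-nonNeg (T i) {{expTerm-nonNeg y i}} x≤y))) ⟩
        expTerm x (suc i) * x + h * (T i * y + T (suc i))
          ≡⟨ cong (λ z → expTerm x (suc i) * x + h * (z + T (suc i))) (sym (expTerm-recurrence y i)) ⟩
        expTerm x (suc i) * x + h * (ℕtoℚ (suc i) * T (suc i) + T (suc i))
          ≡⟨ cong (λ z → expTerm x (suc i) * x + h * z) (trans
               (cong (ℕtoℚ (suc i) * T (suc i) +_) (sym (*-identityˡ (T (suc i)))))
               (trans (perm₄ (ℕtoℚ (suc i)) (T (suc i)) 1ℚ) (cong (_* T (suc i)) (sym (ℕtoℚ-+ 1 (suc i)))))) ⟩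
        expTerm x (suc i) * x + h * (ℕtoℚ (suc (suc i)) * T (suc i)) ∎

    expPartial-nonNeg : ∀ N → NonNegative (expPartial y N)
    expPartial-nonNeg zero    = _
    expPartial-nonNeg (suc N) = nonNeg+nonNeg⇒nonNeg (expPartial y N) {{expPartial-nonNeg N}}
      (expTerm y (suc N)) {{expTerm-nonNeg y (suc N)}}

    expPartial-step : ∀ N → expPartial y (suc N) ≤ expPartial x (suc N) + h * expPartial y N
    expPartial-step zero = ≤-trans (+-monoʳ-≤ 1ℚ (expTerm-step zero)) (≤-reflexive (sym (+-assoc 1ℚ (expTerm x 1) (h * 1ℚ))))
    expPartial-step (suc N) = begin
      expPartial y (suc N) + expTerm y (suc (suc N))
        ≤⟨ +-mono-≤ (expPartial-step N) (expTerm-step (suc N)) ⟩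
      (expPartial x (suc N) + h * expPartial y N) + (expTerm x (suc (suc N)) + h * expTerm y (suc N))
        ≡⟨ perm (expPartial x (suc N)) h (expPartial y N) (expTerm x (suc (suc N))) (expTerm y (suc N)) ⟩
      expPartial x (suc N) + expTerm x (suc (suc N)) + h * (expPartial y N + expTerm y (suc N)) ∎
      where
      open ≤-Reasoning
      perm : ∀ a h b c d → (a + h * b) + (c + h * d) ≡ a + c + h * (b + d)
      perm = solve 5 (λ a h b c d → (a :+ h :* b) :+ (c :+ h :* d) := a :+ c :+ h :* (b :+ d)) refl

    -- This is `(1 - h) * exp y ≤ exp x` without a division. Both sides are cut at the same `N`, so
    -- the inequality can be solved for `expPartial y N`.
    expPartial-≤ : ∀ N → expPartial y N ≤ expPartial x N + h * expPartial y N
    expPartial-≤ zero    = ≤-trans (≤-reflexive (sym (+-identityʳ 1ℚ))) (+-monoʳ-≤ 1ℚ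
      (nonNegative⁻¹ (h * 1ℚ) {{nonNeg*nonNeg⇒nonNeg h 1ℚ}}))
    expPartial-≤ (suc N) = ≤-trans (expPartial-step N) (+-monoʳ-≤ (expPartial x (suc N)) (*-monoˡ-≤-nonNeg h
      (≤-trans (≤-reflexive (sym (+-identityʳ (expPartial y N)))) (+-monoʳ-≤ (expPartial y N)
        (nonNegative⁻¹ (expTerm y (suc N)) {{expTerm-nonNeg y (suc N)}})))))

  halves : ℕ → ℚ
  halves zero    = 0ℚ
  halves (suc j) = halves j + ½

  halves-nonNeg : ∀ j → NonNegative (halves j)
  halves-nonNeg zero    = _
  halves-nonNeg (suc j) = nonNeg+nonNeg⇒nonNeg (halves j) {{halves-nonNeg j}} ½

  -- exp (1/2) ≤ 2, since exp h ≤ 1 / (1 - h).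
  exp-halves : ∀ j → ExpLe (halves j) (2 ℕ.^ j)
  exp-halves zero    zero    = ≤-refl
  exp-halves zero    (suc N) = ≤-trans (≤-reflexive (trans (cong (expPartial 0ℚ N +_) (vanish N)) (+-identityʳ _))) (exp-halves zero N)
    where
    vanish : ∀ i → expTerm 0ℚ (suc i) ≡ 0ℚ
    vanish i = trans (cong (_* u i) (*-zeroʳ (expTerm 0ℚ i))) (*-zeroˡ (u i))
  exp-halves (suc j) N = ≤-trans double (≤-trans (*-monoˡ-≤-nonNeg (ℕtoℚ 2) (exp-halves j N))
    (≤-reflexive (sym (ℕtoℚ-* 2 (2 ℕ.^ j)))))
    where
    open ≤-Reasoning
    x p q : ℚ
    x = halves j
    p = expPartial (x + ½) N
    q = expPartial x N
    twice : p + p ≤ ℕtoℚ 2 * q + p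
    twice = begin
      p + p  ≡⟨ sym (trans (*-distribʳ-+ p 1ℚ 1ℚ) (cong₂ _+_ (*-identityˡ p) (*-identityˡ p))) ⟩
      ℕtoℚ 2 * p  ≤⟨ *-monoˡ-≤-nonNeg (ℕtoℚ 2) (expPartial-≤ x ½ {{halves-nonNeg j}} N) ⟩
      ℕtoℚ 2 * (q + ½ * p)  ≡⟨ *-distribˡ-+ (ℕtoℚ 2) q (½ * p) ⟩
      ℕtoℚ 2 * q + ℕtoℚ 2 * (½ * p)  ≡⟨ cong (ℕtoℚ 2 * q +_) (trans (sym (*-assoc (ℕtoℚ 2) ½ p)) (*-identityˡ p)) ⟩
      ℕtoℚ 2 * q + p ∎
    double : p ≤ ℕtoℚ 2 * q
    double = +-cancelʳ-≤′ twice
      where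
      undo : ∀ a b → a + b + - b ≡ a
      undo a b = trans (+-assoc a b (- b)) (trans (cong (a +_) (+-inverseʳ b)) (+-identityʳ a))
      +-cancelʳ-≤′ : p + p ≤ ℕtoℚ 2 * q + p → p ≤ ℕtoℚ 2 * q
      +-cancelʳ-≤′ h = subst₂ _≤_ (undo p p) (undo (ℕtoℚ 2 * q) p) (+-monoˡ-≤ (- p) h)

  halves-double : ∀ l → halves (l ℕ.+ l) ≡ ℕtoℚ l
  halves-double zero    = refl
  halves-double (suc l) = begin
    halves (l ℕ.+ suc l) + ½  ≡⟨ cong (λ z → halves z + ½) (ℕ.+-suc l l) ⟩
    halves (l ℕ.+ l) + ½ + ½  ≡⟨ +-assoc (halves (l ℕ.+ l)) ½ ½ ⟩
    halves (l ℕ.+ l) + 1ℚ  ≡⟨ cong (_+ 1ℚ) (halves-double l) ⟩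
    ℕtoℚ l + ℕtoℚ 1  ≡⟨ sym (ℕtoℚ-+ l 1) ⟩
    ℕtoℚ (l ℕ.+ 1)  ≡⟨ cong ℕtoℚ (ℕ.+-comm l 1) ⟩
    ℕtoℚ (suc l) ∎
    where open ≡-Reasoning

  -- The witness strictly above `l` is `l + ½`, which is `2 l + 1` halves; each half costs a factor
  -- 2 in the bound for the exponential.
  <log : ∀ {l n} → 2 ℕ.^ suc (l ℕ.+ l) ℕ.≤ n → LtLog (ℕtoℚ l) n
  <log {l} {n} h = halves (suc (l ℕ.+ l)) ,
    subst (_< halves (l ℕ.+ l) + ½) (trans (+-identityʳ _) (halves-double l)) (+-monoʳ-< (halves (l ℕ.+ l)) (positive⁻¹ ½)) ,
    nonNegative⁻¹ (halves (suc (l ℕ.+ l))) {{halves-nonNeg (suc (l ℕ.+ l))}} ,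
    λ N → ≤-trans (exp-halves (suc (l ℕ.+ l)) N) (ℕtoℚ-mono-≤ h)

  -- The range condition enters the proof only here, at a natural number `l` that will be comparable
  -- to `log n`.
  range-ℕ : ∀ {s t n k} l → 2 ℕ.^ suc (l ℕ.+ l) ℕ.≤ n → KRange s t n k →
    (k ℕ.^ (s ℕ.∸ 1) ℕ.* l) ℕ.^ (s ℕ.* (s ℕ.* t ℕ.∸ 1)) ℕ.≤ n ℕ.^ ((s ℕ.∸ 1) ℕ.* (s ℕ.∸ 1))
  range-ℕ {s} {t} {n} {k} l h range = ℕtoℚ-cancel-≤ (subst (_≤ ℕtoℚ (n ℕ.^ ((s ℕ.∸ 1) ℕ.* (s ℕ.∸ 1))))
    (trans (cong (λ z → powQ z (s ℕ.* (s ℕ.* t ℕ.∸ 1))) (sym (ℕtoℚ-* (k ℕ.^ (s ℕ.∸ 1)) l)))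
      (powQ-ℕtoℚ (k ℕ.^ (s ℕ.∸ 1) ℕ.* l) (s ℕ.* (s ℕ.* t ℕ.∸ 1))))
    (range (ℕtoℚ l) (nonNegative⁻¹ (ℕtoℚ l) {{normalize-nonNeg l 1}}) (<log {l} h)))

open ExpLog using (range-ℕ)

open import Data.Nat
open import Data.Nat.Properties
open import Data.Nat.DivMod using (_/_; m/n*n≤m; m%n<n; m≡m%n+[m/n]*n)
open import Data.Nat.ListAction using (sum)
open import Data.Nat.Tactic.RingSolver using (solve-∀)
open import Data.Bool using (Bool; true; false; if_then_else_; _∧_; not)
import Data.Bool.Properties as Bool
open import Data.Fin using (Fin; zero; suc; toℕ)
import Data.Fin.Properties as Fin
open import Data.List using (List; []; _∷_; _++_; map; concatMap; filter; length; take; drop; allFin)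
open import Data.List.Properties
  using (length-map; length-++; length-take; length-drop; length-tabulate; length-filter; take++drop≡id; drop-drop)
open import Data.List.Membership.Propositional using (_∈_; _∉_; find; lose)
open import Data.List.Membership.Propositional.Properties
  using (∈-++⁺ˡ; ∈-++⁺ʳ; ∈-++⁻; ∈-map⁺; ∈-map⁻; ∈-filter⁻; ∈-concatMap⁺; ∈-concatMap⁻; ∈-allFin)
import Data.List.Membership.DecPropositional as DecMembership
open import Data.List.Relation.Unary.Any as Any using (Any; here; there; any?)
import Data.List.Relation.Unary.Any.Properties as Any
open import Data.List.Relation.Unary.All as All using (All; []; _∷_)
import Data.List.Relation.Unary.All.Properties as All
open import Data.List.Relation.Unary.AllPairs using ([]; _∷_)
open import Data.List.Relation.Unary.Unique.Propositional using (Unique)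
import Data.List.Relation.Unary.Unique.Propositional.Properties as Unique
open import Data.Maybe using (Maybe; just; nothing; _<∣>_)
open import Data.Vec as Vec using (Vec; []; _∷_; head; tail; lookup)
import Data.Vec.Properties as Vec
open import Data.Vec.Relation.Unary.All as Allᵛ using () renaming (All to Allᵛ; [] to []ᵛ; _∷_ to _∷ᵛ_)
import Data.Vec.Relation.Unary.All.Properties as Allᵛ
open import Data.Product using (Σ; _×_; _,_; proj₁; proj₂)
open import Data.Product.Properties using (≡-dec)
open import Data.Sum using (_⊎_; inj₁; inj₂)
open import Data.Unit using (⊤; tt)
open import Data.Empty using (⊥; ⊥-elim)
open import Function using (_∘_; id)
open import Function.Definitions using (Injective)
open import Relation.Nullary using (¬_; Dec; yes; no; does; contradiction)
open import Relation.Nullary.Decidable using (_×-dec_; ¬?; ⌊_⌋)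
open import Relation.Unary using (Decidable)
open import Relation.Binary using (DecidableEquality)
open import Relation.Binary.PropositionalEquality

-- Finite sums over lists and counting by indicators

module Sums where

  private variable
    A B : Set

  ∑ : List A → (A → ℕ) → ℕ
  ∑ []       f = 0
  ∑ (x ∷ xs) f = f x + ∑ xs f

  ∑-mono-∈ : ∀ (xs : List A) {f g : A → ℕ} → (∀ {x} → x ∈ xs → f x ≤ g x) → ∑ xs f ≤ ∑ xs g
  ∑-mono-∈ []       h = z≤n
  ∑-mono-∈ (x ∷ xs) h = +-mono-≤ (h (here refl)) (∑-mono-∈ xs (h ∘ there))

  ∑-mono : ∀ (xs : List A) {f g : A → ℕ} → (∀ x → f x ≤ g x) → ∑ xs f ≤ ∑ xs g
  ∑-mono xs h = ∑-mono-∈ xs (λ {x} _ → h x)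

  ∑-cong : ∀ (xs : List A) {f g : A → ℕ} → (∀ x → f x ≡ g x) → ∑ xs f ≡ ∑ xs g
  ∑-cong []       h = refl
  ∑-cong (x ∷ xs) h = cong₂ _+_ (h x) (∑-cong xs h)

  +-interchange : ∀ a b c d → (a + b) + (c + d) ≡ (a + c) + (b + d)
  +-interchange = solve-∀

  ∑-+ : ∀ (xs : List A) (f g : A → ℕ) → ∑ xs (λ x → f x + g x) ≡ ∑ xs f + ∑ xs g
  ∑-+ []       f g = refl
  ∑-+ (x ∷ xs) f g = trans (cong (f x + g x +_) (∑-+ xs f g)) (+-interchange (f x) (g x) _ _)

  ∑-*ˡ : ∀ (xs : List A) c (f : A → ℕ) → ∑ xs (λ x → c * f x) ≡ c * ∑ xs f
  ∑-*ˡ []       c f = sym (*-zeroʳ c)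
  ∑-*ˡ (x ∷ xs) c f = trans (cong (c * f x +_) (∑-*ˡ xs c f)) (sym (*-distribˡ-+ c (f x) _))

  ∑-*ʳ : ∀ (xs : List A) c (f : A → ℕ) → ∑ xs (λ x → f x * c) ≡ ∑ xs f * c
  ∑-*ʳ []       c f = refl
  ∑-*ʳ (x ∷ xs) c f = trans (cong (f x * c +_) (∑-*ʳ xs c f)) (sym (*-distribʳ-+ c (f x) _))

  ∑-const : ∀ (xs : List A) c → ∑ xs (λ _ → c) ≡ length xs * c
  ∑-const []       c = refl
  ∑-const (x ∷ xs) c = cong (c +_) (∑-const xs c)

  length-∑ : ∀ (xs : List A) → length xs ≡ ∑ xs (λ _ → 1)
  length-∑ xs = sym (trans (∑-const xs 1) (*-identityʳ _))

  ∑-≤-const : ∀ (xs : List A) c {f : A → ℕ} → (∀ {x} → x ∈ xs → f x ≤ c) → ∑ xs f ≤ length xs * c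
  ∑-≤-const xs c h = ≤-trans (∑-mono-∈ xs h) (≤-reflexive (∑-const xs c))

  ∑-zero : ∀ (xs : List A) → ∑ xs (λ _ → 0) ≡ 0
  ∑-zero xs = trans (∑-const xs 0) (*-zeroʳ (length xs))

  ∑-++ : ∀ (xs ys : List A) f → ∑ (xs ++ ys) f ≡ ∑ xs f + ∑ ys f
  ∑-++ []       ys f = refl
  ∑-++ (x ∷ xs) ys f = trans (cong (f x +_) (∑-++ xs ys f)) (sym (+-assoc (f x) _ _))

  ∑-map : ∀ (g : A → B) xs f → ∑ (map g xs) f ≡ ∑ xs (f ∘ g)
  ∑-map g []       f = refl
  ∑-map g (x ∷ xs) f = cong (f (g x) +_) (∑-map g xs f)

  ∑-concatMap : ∀ (g : A → List B) xs f → ∑ (concatMap g xs) f ≡ ∑ xs (λ x → ∑ (g x) f)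
  ∑-concatMap g []       f = refl
  ∑-concatMap g (x ∷ xs) f = trans (∑-++ (g x) _ f) (cong (∑ (g x) f +_) (∑-concatMap g xs f))

  ∑-swap : ∀ (xs : List A) (ys : List B) (f : A → B → ℕ) →
    ∑ xs (λ x → ∑ ys (f x)) ≡ ∑ ys (λ y → ∑ xs (λ x → f x y))
  ∑-swap []       ys f = sym (∑-zero ys)
  ∑-swap (x ∷ xs) ys f = trans (cong (∑ ys (f x) +_) (∑-swap xs ys f))
    (sym (∑-+ ys (f x) (λ y → ∑ xs (λ x → f x y))))

  -- The Iverson bracket. Double counting below means writing a cardinality as a double sum of
  -- brackets and applying `∑-swap`.
  ⟦_⟧ : {P : Set} → Dec P → ℕ
  ⟦ p ⟧ = if does p then 1 else 0

  ⟦⟧-yes : ∀ {P : Set} (p? : Dec P) → P → ⟦ p? ⟧ ≡ 1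
  ⟦⟧-yes (yes _) p = refl
  ⟦⟧-yes (no ¬p) p = contradiction p ¬p

  ⟦⟧-no : ∀ {P : Set} (p? : Dec P) → ¬ P → ⟦ p? ⟧ ≡ 0
  ⟦⟧-no (yes p) ¬p = contradiction p ¬p
  ⟦⟧-no (no _)  ¬p = refl

  ⟦⟧≤1 : ∀ {P : Set} (p? : Dec P) → ⟦ p? ⟧ ≤ 1
  ⟦⟧≤1 (yes _) = ≤-refl
  ⟦⟧≤1 (no _)  = z≤n

  ⟦⟧-mono : ∀ {P Q : Set} (p? : Dec P) (q? : Dec Q) → (P → Q) → ⟦ p? ⟧ ≤ ⟦ q? ⟧
  ⟦⟧-mono (yes p) q? h = ≤-reflexive (sym (⟦⟧-yes q? (h p)))
  ⟦⟧-mono (no _)  q? h = z≤n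

  ⟦⟧-cong : ∀ {P Q : Set} (p? : Dec P) (q? : Dec Q) → (P → Q) → (Q → P) → ⟦ p? ⟧ ≡ ⟦ q? ⟧
  ⟦⟧-cong p? q? f g = ≤-antisym (⟦⟧-mono p? q? f) (⟦⟧-mono q? p? g)

  ⟦⟧-× : ∀ {P Q : Set} (p? : Dec P) (q? : Dec Q) → ⟦ p? ×-dec q? ⟧ ≡ ⟦ p? ⟧ * ⟦ q? ⟧
  ⟦⟧-× (yes p) q? = sym (+-identityʳ _)
  ⟦⟧-× (no _)  q? = refl

  ⟦⟧≤ : ∀ {P : Set} (p? : Dec P) {m} → (P → 1 ≤ m) → ⟦ p? ⟧ ≤ m
  ⟦⟧≤ (yes p) h = h p
  ⟦⟧≤ (no _)  h = z≤n

  ⟦⟧-*≤ : ∀ {P : Set} (p? : Dec P) {x y} → (P → x ≤ y) → ⟦ p? ⟧ * x ≤ y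
  ⟦⟧-*≤ (yes p) h = ≤-trans (≤-reflexive (+-identityʳ _)) (h p)
  ⟦⟧-*≤ (no _)  h = z≤n

  ⟦⟧-witness : ∀ {P : Set} (p? : Dec P) → 1 ≤ ⟦ p? ⟧ → P
  ⟦⟧-witness (yes p) _ = p

  ⟦⟧-any : ∀ {P : A → Set} (P? : Decidable P) (xs : List A) → ⟦ any? P? xs ⟧ ≤ ∑ xs (λ x → ⟦ P? x ⟧)
  ⟦⟧-any P? xs = ⟦⟧≤ (any? P? xs) (go xs)
    where
    go : ∀ xs → Any _ xs → 1 ≤ ∑ xs (λ x → ⟦ P? x ⟧)
    go (x ∷ xs) (here p)  = ≤-trans (≤-reflexive (sym (⟦⟧-yes (P? x) p))) (m≤m+n _ _)
    go (x ∷ xs) (there p) = ≤-trans (go xs p) (m≤n+m _ _)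

  ∑-filter : ∀ {P : A → Set} (P? : Decidable P) (xs : List A) (f : A → ℕ) →
    ∑ (filter P? xs) f ≡ ∑ xs (λ x → ⟦ P? x ⟧ * f x)
  ∑-filter P? []       f = refl
  ∑-filter P? (x ∷ xs) f with P? x
  ... | yes _ = cong₂ _+_ (sym (+-identityʳ (f x))) (∑-filter P? xs f)
  ... | no _  = ∑-filter P? xs f

  length-filter-∑ : ∀ {P : A → Set} (P? : Decidable P) (xs : List A) →
    length (filter P? xs) ≡ ∑ xs (λ x → ⟦ P? x ⟧)
  length-filter-∑ P? xs = trans (length-∑ (filter P? xs))
    (trans (∑-filter P? xs (λ _ → 1)) (∑-cong xs (λ x → *-identityʳ _)))

  term≤∑ : ∀ {xs : List A} {x} (f : A → ℕ) → x ∈ xs → f x ≤ ∑ xs f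
  term≤∑ f (here refl) = m≤m+n _ _
  term≤∑ f (there p)   = ≤-trans (term≤∑ f p) (m≤n+m _ _)

  ∑-positive : ∀ (xs : List A) (f : A → ℕ) → 1 ≤ ∑ xs f → Σ A λ x → x ∈ xs × 1 ≤ f x
  ∑-positive (x ∷ xs) f p with f x in eq
  ... | suc _ = x , here refl , subst (1 ≤_) (sym eq) (s≤s z≤n)
  ... | zero with ∑-positive xs f p
  ...   | y , y∈ , q = y , there y∈ , q

  module _ (_≟ᴬ_ : DecidableEquality A) where

    ∑-≟-∈ : ∀ (xs : List A) {y} → y ∈ xs → 1 ≤ ∑ xs (λ x → ⟦ x ≟ᴬ y ⟧)
    ∑-≟-∈ (x ∷ xs) {y} (here refl) = ≤-trans (≤-reflexive (sym (⟦⟧-yes (x ≟ᴬ x) refl))) (m≤m+n _ _)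
    ∑-≟-∈ (x ∷ xs) {y} (there p)   = ≤-trans (∑-≟-∈ xs p) (m≤n+m _ _)

    ∑-≟-∉ : ∀ (xs : List A) {y} → y ∉ xs → ∑ xs (λ x → ⟦ x ≟ᴬ y ⟧) ≡ 0
    ∑-≟-∉ []       h = refl
    ∑-≟-∉ (x ∷ xs) {y} h =
      cong₂ _+_ (⟦⟧-no (x ≟ᴬ y) (λ e → h (here (sym e)))) (∑-≟-∉ xs (h ∘ there))

    ∑-≟-unique : ∀ (xs : List A) {y} → Unique xs → ∑ xs (λ x → ⟦ x ≟ᴬ y ⟧) ≤ 1
    ∑-≟-unique []       u = z≤n
    ∑-≟-unique (x ∷ xs) {y} (x∉ ∷ u) with x ≟ᴬ y
    ... | yes refl = ≤-reflexive (cong suc (∑-≟-∉ xs (λ p → All.lookup x∉ p refl)))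
    ... | no _     = ∑-≟-unique xs u

  -- If `2 * f x < g` held throughout, summation would give
  -- `2 * ∑ xs f + length xs ≤ length xs * g`, a contradiction for nonempty `xs`; for empty `xs` the
  -- contradiction is with `1 ≤ M * g`.
  ∑-pigeonhole : ∀ (xs : List A) {M g} (f : A → ℕ) → length xs ≤ M → 1 ≤ M → 1 ≤ g →
    M * g ≤ 2 * ∑ xs f → Σ A λ x → x ∈ xs × g ≤ 2 * f x
  ∑-pigeonhole {A} xs {M} {g} f len 1≤M 1≤g h with any? (λ x → g ≤? 2 * f x) xs
  ... | yes p = find p
  ... | no ¬p = ⊥-elim (absurd (length xs) refl)
    where
    low : ∀ (xs : List A) → ¬ Any (λ x → g ≤ 2 * f x) xs → 2 * ∑ xs f + length xs ≤ length xs * g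
    low []       _  = z≤n
    low (x ∷ xs) ¬p = begin
      2 * (f x + ∑ xs f) + suc (length xs)  ≡⟨ lemma (f x) (∑ xs f) (length xs) ⟩
      suc (2 * f x) + (2 * ∑ xs f + length xs) ≤⟨ +-mono-≤ (≰⇒> (¬p ∘ here)) (low xs (¬p ∘ there)) ⟩
      g + length xs * g ∎
      where
      open ≤-Reasoning
      lemma : ∀ a b c → 2 * (a + b) + suc c ≡ suc (2 * a) + (2 * b + c)
      lemma = solve-∀
    open ≤-Reasoning
    absurd : ∀ l → length xs ≡ l → ⊥
    absurd zero eq = n≮0 (begin-strict
      0 <⟨ *-mono-≤ 1≤M 1≤g ⟩
      M * g ≤⟨ h ⟩
      2 * ∑ xs f ≤⟨ m≤m+n _ _ ⟩
      2 * ∑ xs f + length xs ≤⟨ low xs ¬p ⟩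
      length xs * g ≡⟨ cong (_* g) eq ⟩
      0 ∎)
    absurd (suc l) eq = <-irrefl refl (begin-strict
      2 * ∑ xs f <⟨ m<m+n _ (subst (0 <_) (sym eq) z<s) ⟩
      2 * ∑ xs f + length xs ≤⟨ low xs ¬p ⟩
      length xs * g ≤⟨ *-monoˡ-≤ g len ⟩
      M * g ≤⟨ h ⟩
      2 * ∑ xs f ∎)

open Sums

-- A container algorithm for uniform hypergraphs of ordered tuples

module Containers where

  private variable
    j : ℕ

  weight : Vec Bool j → ℕ
  weight []          = 0
  weight (true ∷ P)  = suc (weight P)
  weight (false ∷ P) = weight P

  masks : ∀ j → List (Vec Bool j)
  masks zero    = [] ∷ []
  masks (suc j) = map (true ∷_) (masks j) ++ map (false ∷_) (masks j)

  length-masks : ∀ j → length (masks j) ≡ 2 ^ j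
  length-masks zero    = refl
  length-masks (suc j) = begin
    length (map (true ∷_) (masks j) ++ map (false ∷_) (masks j))
      ≡⟨ length-++ (map (true ∷_) (masks j)) ⟩
    length (map (true ∷_) (masks j)) + length (map (false ∷_) (masks j))
      ≡⟨ cong₂ _+_ (length-map _ (masks j)) (length-map _ (masks j)) ⟩
    length (masks j) + length (masks j)
      ≡⟨ cong₂ _+_ (length-masks j) (trans (length-masks j) (sym (+-identityʳ _))) ⟩
    2 ^ suc j ∎
    where open ≡-Reasoning

  ∈-masks : (P : Vec Bool j) → P ∈ masks j
  ∈-masks []          = here refl
  ∈-masks (true ∷ P)  = ∈-++⁺ˡ (∈-map⁺ _ (∈-masks P))
  ∈-masks (false ∷ P) = ∈-++⁺ʳ _ (∈-map⁺ _ (∈-masks P))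

  module Patterns {E : Set} (_≟_ : DecidableEquality E) where

    -- Degrees of vertex sets are replaced by degrees of positions: the mask selects coordinates and
    -- the entries of the tuple outside it are ignored. With ordered tuples and lists with
    -- multiplicity no quotient by permutations is needed.
    Agree : Vec Bool j → Vec E j → Vec E j → Set
    Agree []          []      []      = ⊤
    Agree (true ∷ P)  (x ∷ A) (y ∷ B) = x ≡ y × Agree P A B
    Agree (false ∷ P) (x ∷ A) (y ∷ B) = Agree P A B

    agree? : (P : Vec Bool j) (A B : Vec E j) → Dec (Agree P A B)
    agree? []          []      []      = yes tt
    agree? (true ∷ P)  (x ∷ A) (y ∷ B) = (x ≟ y) ×-dec agree? P A B
    agree? (false ∷ P) (x ∷ A) (y ∷ B) = agree? P A B

    agree-sym : (P : Vec Bool j) (A B : Vec E j) → Agree P A B → Agree P B A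
    agree-sym []          []      []      _       = tt
    agree-sym (true ∷ P)  (x ∷ A) (y ∷ B) (p , q) = sym p , agree-sym P A B q
    agree-sym (false ∷ P) (x ∷ A) (y ∷ B) q       = agree-sym P A B q

    agree-trans : (P : Vec Bool j) (A B C : Vec E j) → Agree P A B → Agree P B C → Agree P A C
    agree-trans []          []      []      []      _       _        = tt
    agree-trans (true ∷ P)  (x ∷ A) (y ∷ B) (z ∷ C) (p , q) (p′ , q′) = trans p p′ , agree-trans P A B C q q′
    agree-trans (false ∷ P) (x ∷ A) (y ∷ B) (z ∷ C) q       q′       = agree-trans P A B C q q′

    agree-empty : ∀ j (A B : Vec E j) → Agree (Vec.replicate j false) A B
    agree-empty zero    []      []      = tt
    agree-empty (suc j) (x ∷ A) (y ∷ B) = agree-empty j A B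

    deg : List (Vec E j) → Vec Bool j → Vec E j → ℕ
    deg 𝓗 P A = ∑ 𝓗 (λ B → ⟦ agree? P A B ⟧)

    deg-++ : ∀ (𝓗 𝓕 : List (Vec E j)) P A → deg (𝓗 ++ 𝓕) P A ≡ deg 𝓗 P A + deg 𝓕 P A
    deg-++ 𝓗 𝓕 P A = ∑-++ 𝓗 𝓕 _

    deg-cong : ∀ (𝓗 : List (Vec E j)) P A B → Agree P A B → deg 𝓗 P A ≡ deg 𝓗 P B
    deg-cong 𝓗 P A B h = ∑-cong 𝓗 λ C → ⟦⟧-cong (agree? P A C) (agree? P B C)
      (agree-trans P B A C (agree-sym P A B h)) (agree-trans P A B C h)

    -- With b = 1 / τ this is the container condition Δ_ℓ ≤ const · τ^(ℓ-1) · (average degree).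
    Spread : ℕ → ℕ → List (Vec E j) → Set
    Spread {j} b Δ 𝓗 = ∀ P A → 1 ≤ weight P → deg 𝓗 P A * b ^ weight P ≤ Δ * b ^ j

    Independent : (E → Bool) → List (Vec E j) → Set
    Independent I 𝓗 = ∀ A → A ∈ 𝓗 → ¬ Allᵛ (λ e → I e ≡ true) A

    Avoids : (E → Bool) → List E → Set
    Avoids I X = All (λ e → I e ≡ false) X

  opaque
    -- Four times the number of masks of length `j`: a union bound over the masks then leaves at
    -- most a quarter of the tuples with a saturated tail.
    sat : ℕ → ℕ
    sat j = 2 ^ (2 + j)

    sat-def : ∀ j → sat j ≡ 2 * (2 * 2 ^ j)
    sat-def j = refl

  -- The total factor by which `Δ` increases while tuples of length `suc j` are reduced to length 1.
  -- One reduction from length `2 + j` replaces `Δ` by `sat (suc j) * Δ + Δ`.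
  growth : ℕ → ℕ
  growth zero    = 1
  growth (suc j) = growth j * suc (sat (suc j))

  1≤growth : ∀ j → 1 ≤ growth j
  1≤growth zero    = ≤-refl
  1≤growth (suc j) = *-mono-≤ (1≤growth j) (s≤s z≤n)

  private
    rearrange₁ : ∀ l c p → l * (c * p) ≡ c * (l * p)
    rearrange₁ = solve-∀
    rearrange₂ : ∀ l m c p → (l + m) * (c * p) ≡ c * (l * p) + m * (c * p)
    rearrange₂ = solve-∀
    rearrange₃ : ∀ c p → c * p + p ≡ suc c * p
    rearrange₃ = solve-∀
    rearrange₄ : ∀ s t d p → s * t * (d * p) ≡ s * (t * d * p)
    rearrange₄ = solve-∀
    rearrange₅ : ∀ l d b p → l * (d * (b * p)) ≡ l * b * (d * p)
    rearrange₅ = solve-∀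
    rearrange₆ : ∀ s p → 4 * s * p ≡ s * (2 * (2 * p))
    rearrange₆ = solve-∀
    rearrange₇ : ∀ a d p → 4 * (a * (d * p)) ≡ 4 * (d * a) * p
    rearrange₇ = solve-∀
    rearrange₈ : ∀ m g p → m * g * p ≡ m * (p * g)
    rearrange₈ = solve-∀
    rearrange₉ : ∀ n → 2 * n + 2 * n ≡ 4 * n
    rearrange₉ = solve-∀
    rearrange₁₀ : ∀ g x y → 4 * (g + (x + y)) ≡ 2 * (2 * g) + (4 * x + 4 * y)
    rearrange₁₀ = solve-∀
    rearrange₁₁ : ∀ m p g b → m * (p * g) * b ≡ m * (b * p * g)
    rearrange₁₁ = solve-∀
    rearrange₁₂ : ∀ l y g → 2 * l + (g + y * g) ≡ g + (2 * l + y * g)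
    rearrange₁₂ = solve-∀
    rearrange₁₃ : ∀ l m r → 2 * m + (2 * l + r) ≡ 2 * (m + l) + r
    rearrange₁₃ = solve-∀
    rearrange₁₄ : ∀ m p g → 2 * (m * (p * g)) ≡ 2 * m * (p * g)
    rearrange₁₄ = solve-∀
    rearrange₁₅ : ∀ s b p g → s * b * (p * g) ≡ s * (b * p * g)
    rearrange₁₅ = solve-∀
    rearrange₁₆ : ∀ g p d → g * suc p * d ≡ g * (p * d + d)
    rearrange₁₆ = solve-∀

  -- A container is found by querying elements of the independent set one by one; only the "yes" answers
  -- are remembered, and they cost a factor b each in the number of outcomes.
  module Container {E : Set} (_≟_ : DecidableEquality E) (e₀ : E)
    (b c M G a₀ S : ℕ) (b≡1+c : b ≡ suc c) (1≤M : 1 ≤ M) (1≤G : 1 ≤ G) (2M≤Sb : 2 * M ≤ S * b)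
    (E′ : List E) (length-E′ : length E′ ≤ M)
    where

    open Patterns _≟_
    open DecMembership _≟_ using (_∈?_)

    instance
      b-nonZero : NonZero b
      b-nonZero = subst NonZero (sym b≡1+c) _

    -- Here `a` elements remain to be excluded and `q` answers "yes" are allowed. The bound says
    -- `length 𝒴 ≤ F a q` for `F a q = (b / c) ^ a * b ^ q`, and `F a q = F (a - 1) q + F a (q - 1)`
    -- holds exactly because `b = c + 1`.
    Covers : ℕ → ℕ → List E → ((E → Bool) → Set) → Set
    Covers a q X Hyp = Σ (List (List E)) λ 𝒴 →
      (length 𝒴 * c ^ a ≤ b ^ (a + q)) ×
      All (λ Y → length Y ≡ length X + a × Unique Y × All (_∈ E′) Y) 𝒴 ×
      (∀ I → Hyp I → Avoids I X → Any (Avoids I) 𝒴)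

    1≤b^ : ∀ q → 1 ≤ b ^ q
    1≤b^ q = ^-monoʳ-≤ b {0} {q} z≤n

    covers-done : ∀ {q X Hyp} → Unique X → All (_∈ E′) X → Covers 0 q X Hyp
    covers-done {q} {X} u X⊆ = X ∷ [] , 1≤b^ q , (sym (+-identityʳ _) , u , X⊆) ∷ [] ,
      λ I _ av → here av

    covers-weaken : ∀ {a q q′ X} {Hyp Hyp′ : (E → Bool) → Set} → q ≤ q′ → (∀ I → Hyp′ I → Hyp I) →
      Covers a q X Hyp → Covers a q′ X Hyp′
    covers-weaken {a} q≤q′ h (𝒴 , len , 𝒴-ok , cov) =
      𝒴 , ≤-trans len (^-monoʳ-≤ b (+-monoʳ-≤ a q≤q′)) , 𝒴-ok , λ I hyp → cov I (h I hyp)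

    -- A forced "no": the list of outcomes stays the same and its bound loosens because `c ≤ b`.
    covers-no : ∀ {a q e X} {Hyp : (E → Bool) → Set} → (∀ I → Hyp I → I e ≡ false) →
      Covers a q (e ∷ X) Hyp → Covers (suc a) q X Hyp
    covers-no {a} {q} {e} {X} h (𝒴 , len , 𝒴-ok , cov) =
      𝒴 , bound , All.map (λ { (l , r) → trans l (sym (+-suc (length X) a)) , r }) 𝒴-ok ,
      λ I hyp av → cov I hyp (h I hyp ∷ av)
      where
      open ≤-Reasoning
      bound : length 𝒴 * c ^ suc a ≤ b ^ (suc a + q)
      bound = begin
        length 𝒴 * (c * c ^ a) ≡⟨ rearrange₁ (length 𝒴) c (c ^ a) ⟩
        c * (length 𝒴 * c ^ a) ≤⟨ *-mono-≤ (subst (c ≤_) (sym b≡1+c) (n≤1+n c)) len ⟩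
        b * b ^ (a + q) ∎

    -- A "no" moves `e` into `X`; a "yes" spends one unit of `q` and leaves `X` alone. The two
    -- lengths add up by `c * b ^ m + b ^ m = b ^ (m + 1)`.
    covers-query : ∀ {a q X} {Hyp Hyp′ : (E → Bool) → Set} e → (∀ I → Hyp I → I e ≡ true → Hyp′ I) →
      Covers a (suc q) (e ∷ X) Hyp → Covers (suc a) q X Hyp′ → Covers (suc a) (suc q) X Hyp
    covers-query {a} {q} {X} {Hyp} {Hyp′} e h (𝒴 , len , 𝒴-ok , cov) (𝒵 , len′ , 𝒵-ok , cov′) =
      𝒴 ++ 𝒵 , bound ,
      All.++⁺ (All.map (λ { (l , r) → trans l (sym (+-suc (length X) a)) , r }) 𝒴-ok) 𝒵-ok , cover
      where
      open ≤-Reasoning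
      bound : length (𝒴 ++ 𝒵) * c ^ suc a ≤ b ^ (suc a + suc q)
      bound = begin
        length (𝒴 ++ 𝒵) * (c * c ^ a) ≡⟨ cong (_* (c * c ^ a)) (length-++ 𝒴) ⟩
        (length 𝒴 + length 𝒵) * (c * c ^ a) ≡⟨ rearrange₂ (length 𝒴) (length 𝒵) c (c ^ a) ⟩
        c * (length 𝒴 * c ^ a) + length 𝒵 * (c * c ^ a) ≤⟨ +-mono-≤ (*-monoʳ-≤ c len) len′ ⟩
        c * b ^ (a + suc q) + b ^ (suc a + q) ≡⟨ cong (λ z → c * b ^ (a + suc q) + b ^ z) (sym (+-suc a q)) ⟩
        c * b ^ (a + suc q) + b ^ (a + suc q) ≡⟨ rearrange₃ c (b ^ (a + suc q)) ⟩
        suc c * b ^ (a + suc q) ≡⟨ cong (_* b ^ (a + suc q)) (sym b≡1+c) ⟩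
        b * b ^ (a + suc q) ∎
      cover : ∀ I → Hyp I → Avoids I X → Any (Avoids I) (𝒴 ++ 𝒵)
      cover I hyp av with I e in eq
      ... | false = Any.++⁺ˡ (cov I hyp (eq ∷ av))
      ... | true  = Any.++⁺ʳ 𝒴 (cov′ I (h I hyp eq) av)

    -- The pattern already has degree at least `Θ * b ^ j / b ^ weight P` in `𝓕`, so one more link
    -- could push it beyond the bound with `Θ + Δ`.
    Saturated : ℕ → List (Vec E j) → Vec E j → Vec Bool j → Set
    Saturated {j} Θ 𝓕 A P = 1 ≤ weight P × Θ * b ^ j ≤ deg 𝓕 P A * b ^ weight P

    saturated? : ∀ Θ (𝓕 : List (Vec E j)) A → Decidable (Saturated Θ 𝓕 A)
    saturated? Θ 𝓕 A P = (1 ≤? weight P) ×-dec (_ ≤? _)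

    Good : ℕ → List E → List (Vec E j) → Vec E (suc j) → Set
    Good {j} Θ X 𝓕 (e ∷ A) = e ∉ X × ¬ Any (Saturated Θ 𝓕 A) (masks j)

    good? : ∀ Θ X (𝓕 : List (Vec E j)) → Decidable (Good Θ X 𝓕)
    good? {j} Θ X 𝓕 (e ∷ A) = ¬? (e ∈? X) ×-dec ¬? (any? (saturated? Θ 𝓕 A) (masks j))

    link? : ∀ Θ X (𝓕 : List (Vec E j)) e → Decidable (λ A → Good Θ X 𝓕 A × head A ≡ e)
    link? Θ X 𝓕 e A = good? Θ X 𝓕 A ×-dec (head A ≟ e)

    link : ∀ Θ X (𝓕 : List (Vec E j)) e → List (Vec E (suc j)) → List (Vec E j)
    link Θ X 𝓕 e 𝓗 = map tail (filter (link? Θ X 𝓕 e) 𝓗)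

    link-length : ∀ Θ X (𝓕 : List (Vec E j)) e 𝓗 →
      length (link Θ X 𝓕 e 𝓗) ≡ ∑ 𝓗 (λ A → ⟦ link? Θ X 𝓕 e A ⟧)
    link-length Θ X 𝓕 e 𝓗 = trans (length-map tail (filter (link? Θ X 𝓕 e) 𝓗)) (length-filter-∑ (link? Θ X 𝓕 e) 𝓗)

    -- A saturated pattern receives no new tuple, and an unsaturated one has room for a whole link.
    link-spread : ∀ {Δ Θ X e} (𝓗 : List (Vec E (suc j))) (𝓕 : List (Vec E j)) →
      Spread b Δ 𝓗 → Spread b (Θ + Δ) 𝓕 → Spread b (Θ + Δ) (link Θ X 𝓕 e 𝓗 ++ 𝓕)
    link-spread {j} {Δ} {Θ} {X} {e} 𝓗 𝓕 sp𝓗 sp𝓕 P A 1≤P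
      with saturated? Θ 𝓕 A P
    ... | yes sat = begin
      deg (link Θ X 𝓕 e 𝓗 ++ 𝓕) P A * b ^ weight P
        ≡⟨ cong (_* b ^ weight P) (trans (deg-++ (link Θ X 𝓕 e 𝓗) 𝓕 P A) (cong (_+ deg 𝓕 P A) zero-new)) ⟩
      deg 𝓕 P A * b ^ weight P
        ≤⟨ sp𝓕 P A 1≤P ⟩
      (Θ + Δ) * b ^ j ∎
      where
      open ≤-Reasoning
      pointwise : ∀ B → ⟦ link? Θ X 𝓕 e B ⟧ * ⟦ agree? P A (tail B) ⟧ ≤ 0
      pointwise (x ∷ B) with agree? P A B
      ... | no _  = ≤-reflexive (*-zeroʳ ⟦ link? Θ X 𝓕 e (x ∷ B) ⟧)
      ... | yes ag = ≤-reflexive (cong (_* 1) (⟦⟧-no (link? Θ X 𝓕 e (x ∷ B)) λ { ((_ , ¬sat) , _) →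
            ¬sat (Any.map (λ { refl → 1≤P , subst (λ z → Θ * b ^ j ≤ z * b ^ weight P) (deg-cong 𝓕 P A B ag) (proj₂ sat) })
                          (∈-masks P)) }))
      zero-new : deg (link Θ X 𝓕 e 𝓗) P A ≡ 0
      zero-new = n≤0⇒n≡0 (begin
        deg (link Θ X 𝓕 e 𝓗) P A
          ≡⟨ ∑-map tail (filter (link? Θ X 𝓕 e) 𝓗) _ ⟩
        ∑ (filter (link? Θ X 𝓕 e) 𝓗) (λ B → ⟦ agree? P A (tail B) ⟧)
          ≡⟨ ∑-filter (link? Θ X 𝓕 e) 𝓗 _ ⟩
        ∑ 𝓗 (λ B → ⟦ link? Θ X 𝓕 e B ⟧ * ⟦ agree? P A (tail B) ⟧)
          ≤⟨ ∑-mono 𝓗 pointwise ⟩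
        ∑ 𝓗 (λ _ → 0)
          ≡⟨ ∑-zero 𝓗 ⟩
        0 ∎)
    ... | no ¬sat = begin
      deg (link Θ X 𝓕 e 𝓗 ++ 𝓕) P A * b ^ weight P
        ≡⟨ cong (_* b ^ weight P) (deg-++ (link Θ X 𝓕 e 𝓗) 𝓕 P A) ⟩
      (deg (link Θ X 𝓕 e 𝓗) P A + deg 𝓕 P A) * b ^ weight P
        ≡⟨ *-distribʳ-+ (b ^ weight P) (deg (link Θ X 𝓕 e 𝓗) P A) _ ⟩
      deg (link Θ X 𝓕 e 𝓗) P A * b ^ weight P + deg 𝓕 P A * b ^ weight P
        ≤⟨ +-mono-≤ new (<⇒≤ (≰⇒> (λ h → ¬sat (1≤P , h)))) ⟩
      Δ * b ^ j + Θ * b ^ j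
        ≡⟨ trans (+-comm (Δ * b ^ j) _) (sym (*-distribʳ-+ (b ^ j) Θ Δ)) ⟩
      (Θ + Δ) * b ^ j ∎
      where
      open ≤-Reasoning
      pointwise : ∀ B → ⟦ link? Θ X 𝓕 e B ⟧ * ⟦ agree? P A (tail B) ⟧ ≤ ⟦ agree? (true ∷ P) (e ∷ A) B ⟧
      pointwise (x ∷ B) = ≤-trans (≤-reflexive (sym (⟦⟧-× (link? Θ X 𝓕 e (x ∷ B)) (agree? P A B))))
        (⟦⟧-mono (link? Θ X 𝓕 e (x ∷ B) ×-dec agree? P A B) (agree? (true ∷ P) (e ∷ A) (x ∷ B))
          λ { ((_ , x≡e) , ag) → sym x≡e , ag })
      new : deg (link Θ X 𝓕 e 𝓗) P A * b ^ weight P ≤ Δ * b ^ j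
      new = *-cancelʳ-≤ _ _ b (begin
        deg (link Θ X 𝓕 e 𝓗) P A * b ^ weight P * b
          ≡⟨ trans (*-assoc (deg (link Θ X 𝓕 e 𝓗) P A) (b ^ weight P) b) (cong (deg (link Θ X 𝓕 e 𝓗) P A *_) (*-comm (b ^ weight P) b)) ⟩
        deg (link Θ X 𝓕 e 𝓗) P A * b ^ suc (weight P)
          ≡⟨ cong (_* b ^ suc (weight P)) (trans (∑-map tail (filter (link? Θ X 𝓕 e) 𝓗) _) (∑-filter (link? Θ X 𝓕 e) 𝓗 _)) ⟩
        ∑ 𝓗 (λ B → ⟦ link? Θ X 𝓕 e B ⟧ * ⟦ agree? P A (tail B) ⟧) * b ^ suc (weight P)
          ≤⟨ *-monoˡ-≤ (b ^ suc (weight P)) (∑-mono 𝓗 pointwise) ⟩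
        deg 𝓗 (true ∷ P) (e ∷ A) * b ^ suc (weight P)
          ≤⟨ sp𝓗 (true ∷ P) (e ∷ A) (s≤s z≤n) ⟩
        Δ * b ^ suc j
          ≡⟨ trans (cong (Δ *_) (*-comm b (b ^ j))) (sym (*-assoc Δ (b ^ j) b)) ⟩
        Δ * b ^ j * b ∎)

    module _ {j Δ} (1≤Δ : 1 ≤ Δ) (𝓗 : List (Vec E (suc j))) (𝓕 : List (Vec E j))
      (X : List E) (sp : Spread b Δ 𝓗)
      where

      -- `N` is the size required of `𝓗`. The requirement one uniformity lower is smaller by a
      -- factor `b`, so `length 𝓕 * b ≤ N` says that `𝓕` does not yet exceed what the next level
      -- asks for.
      Θ N : ℕ
      Θ = sat j * Δ
      N = M * (b ^ j * G)

      -- Double counting of the pairs from `𝓗` and `𝓕` whose entries agree on `P`: a saturated tail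
      -- has many partners in `𝓕`, while `sp` allows each member of `𝓕` only few partners in `𝓗`.
      count-saturated : length 𝓕 * b ≤ N → ∀ P →
        ∑ 𝓗 (λ A → ⟦ saturated? Θ 𝓕 (tail A) P ⟧) * sat j ≤ N
      count-saturated len P = *-cancelʳ-≤ (∑ 𝓗 (λ A → ⟦ saturated? Θ 𝓕 (tail A) P ⟧) * sat j) N (Δ * b ^ j) {{>-nonZero (*-mono-≤ 1≤Δ (1≤b^ j))}} (begin
        ∑ 𝓗 (λ A → ⟦ saturated? Θ 𝓕 (tail A) P ⟧) * sat j * (Δ * b ^ j)
          ≡⟨ rearrange₄ (∑ 𝓗 _) (sat j) Δ (b ^ j) ⟩
        ∑ 𝓗 (λ A → ⟦ saturated? Θ 𝓕 (tail A) P ⟧) * (Θ * b ^ j)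
          ≡⟨ sym (∑-*ʳ 𝓗 (Θ * b ^ j) _) ⟩
        ∑ 𝓗 (λ A → ⟦ saturated? Θ 𝓕 (tail A) P ⟧ * (Θ * b ^ j))
          ≤⟨ ∑-mono 𝓗 pointwise ⟩
        ∑ 𝓗 (λ A → ∑ 𝓕 (λ B → ⟦ 1 ≤? weight P ⟧ * (⟦ agree? P (tail A) B ⟧ * b ^ weight P)))
          ≡⟨ ∑-swap 𝓗 𝓕 _ ⟩
        ∑ 𝓕 (λ B → ∑ 𝓗 (λ A → ⟦ 1 ≤? weight P ⟧ * (⟦ agree? P (tail A) B ⟧ * b ^ weight P)))
          ≤⟨ ∑-≤-const 𝓕 (Δ * b ^ suc j) (λ {B} _ → rowwise B) ⟩
        length 𝓕 * (Δ * b ^ suc j)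
          ≡⟨ rearrange₅ (length 𝓕) Δ b (b ^ j) ⟩
        length 𝓕 * b * (Δ * b ^ j)
          ≤⟨ *-monoˡ-≤ (Δ * b ^ j) len ⟩
        N * (Δ * b ^ j) ∎)
        where
        open ≤-Reasoning
        pointwise : ∀ A → ⟦ saturated? Θ 𝓕 (tail A) P ⟧ * (Θ * b ^ j) ≤
          ∑ 𝓕 (λ B → ⟦ 1 ≤? weight P ⟧ * (⟦ agree? P (tail A) B ⟧ * b ^ weight P))
        pointwise (x ∷ A) = ⟦⟧-*≤ (saturated? Θ 𝓕 A P) λ { (1≤P , sat) → begin
          Θ * b ^ j ≤⟨ sat ⟩
          deg 𝓕 P A * b ^ weight P ≡⟨ sym (∑-*ʳ 𝓕 _ _) ⟩
          ∑ 𝓕 (λ B → ⟦ agree? P A B ⟧ * b ^ weight P)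
            ≡⟨ ∑-cong 𝓕 (λ B → sym (trans (cong (_* (⟦ agree? P A B ⟧ * b ^ weight P)) (⟦⟧-yes (1 ≤? weight P) 1≤P)) (+-identityʳ _))) ⟩
          ∑ 𝓕 (λ B → ⟦ 1 ≤? weight P ⟧ * (⟦ agree? P A B ⟧ * b ^ weight P)) ∎ }
        rowwise : ∀ B → ∑ 𝓗 (λ A → ⟦ 1 ≤? weight P ⟧ * (⟦ agree? P (tail A) B ⟧ * b ^ weight P)) ≤ Δ * b ^ suc j
        rowwise B = ≤-trans (≤-reflexive (∑-*ˡ 𝓗 ⟦ 1 ≤? weight P ⟧ _)) (⟦⟧-*≤ (1 ≤? weight P) λ 1≤P → begin
          ∑ 𝓗 (λ A → ⟦ agree? P (tail A) B ⟧ * b ^ weight P)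
            ≤⟨ ∑-mono 𝓗 (λ { (x ∷ A) → *-monoˡ-≤ (b ^ weight P)
                 (⟦⟧-mono (agree? P A B) (agree? P B A) (agree-sym P A B)) }) ⟩
          -- The head position is not in the mask, so `e₀` is only a placeholder.
          ∑ 𝓗 (λ A → ⟦ agree? (false ∷ P) (e₀ ∷ B) A ⟧ * b ^ weight P)
            ≡⟨ ∑-*ʳ 𝓗 _ _ ⟩
          deg 𝓗 (false ∷ P) (e₀ ∷ B) * b ^ weight P
            ≤⟨ sp (false ∷ P) (e₀ ∷ B) 1≤P ⟩
          Δ * b ^ suc j ∎)

      -- A union bound over the `2 ^ j` masks, paid for by the choice of `sat j`.
      count-bad : length 𝓕 * b ≤ N → 4 * ∑ 𝓗 (λ A → ⟦ any? (saturated? Θ 𝓕 (tail A)) (masks j) ⟧) ≤ N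
      count-bad len = *-cancelʳ-≤ (4 * ∑ 𝓗 (λ A → ⟦ any? (saturated? Θ 𝓕 (tail A)) (masks j) ⟧)) N (2 ^ j) {{m^n≢0 2 j}} (begin
        4 * ∑ 𝓗 (λ A → ⟦ any? (saturated? Θ 𝓕 (tail A)) (masks j) ⟧) * 2 ^ j
          ≤⟨ *-monoˡ-≤ (2 ^ j) (*-monoʳ-≤ 4 (∑-mono 𝓗 (λ A → ⟦⟧-any (saturated? Θ 𝓕 (tail A)) (masks j)))) ⟩
        4 * ∑ 𝓗 (λ A → ∑ (masks j) (λ P → ⟦ saturated? Θ 𝓕 (tail A) P ⟧)) * 2 ^ j
          ≡⟨ cong (λ z → 4 * z * 2 ^ j) (∑-swap 𝓗 (masks j) _) ⟩
        4 * ∑ (masks j) (λ P → ∑ 𝓗 (λ A → ⟦ saturated? Θ 𝓕 (tail A) P ⟧)) * 2 ^ j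
          ≡⟨ trans (rearrange₆ (∑ (masks j) _) (2 ^ j)) (cong (∑ (masks j) (λ P → ∑ 𝓗 (λ A → ⟦ saturated? Θ 𝓕 (tail A) P ⟧)) *_) (sym (sat-def j))) ⟩
        ∑ (masks j) (λ P → ∑ 𝓗 (λ A → ⟦ saturated? Θ 𝓕 (tail A) P ⟧)) * sat j
          ≡⟨ sym (∑-*ʳ (masks j) (sat j) _) ⟩
        ∑ (masks j) (λ P → ∑ 𝓗 (λ A → ⟦ saturated? Θ 𝓕 (tail A) P ⟧) * sat j)
          ≤⟨ ∑-≤-const (masks j) N (λ {P} _ → count-saturated len P) ⟩
        length (masks j) * N
          ≡⟨ trans (cong (_* N) (length-masks j)) (*-comm (2 ^ j) N) ⟩
        N * 2 ^ j ∎)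
        where
        open ≤-Reasoning

      -- `Spread` for the mask consisting of the head alone gives each vertex at most `Δ * b ^ j`
      -- tuples, so at most `a₀` excluded vertices spoil few tuples.
      count-heads : length X ≤ a₀ → 4 * (Δ * a₀) ≤ M * G → 4 * ∑ 𝓗 (λ A → ⟦ head A ∈? X ⟧) ≤ N
      count-heads lenX small = begin
        4 * ∑ 𝓗 (λ A → ⟦ head A ∈? X ⟧)
          ≤⟨ *-monoʳ-≤ 4 (∑-mono 𝓗 (λ A → ⟦⟧≤ (head A ∈? X) (∈⇒1≤ A))) ⟩
        4 * ∑ 𝓗 (λ A → ∑ X (λ x → ⟦ x ≟ head A ⟧))
          ≡⟨ cong (4 *_) (∑-swap 𝓗 X _) ⟩
        4 * ∑ X (λ x → ∑ 𝓗 (λ A → ⟦ x ≟ head A ⟧))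
          ≤⟨ *-monoʳ-≤ 4 (∑-≤-const X (Δ * b ^ j) (λ {x} _ → star x)) ⟩
        4 * (length X * (Δ * b ^ j))
          ≤⟨ *-monoʳ-≤ 4 (*-monoˡ-≤ (Δ * b ^ j) lenX) ⟩
        4 * (a₀ * (Δ * b ^ j))
          ≡⟨ rearrange₇ a₀ Δ (b ^ j) ⟩
        4 * (Δ * a₀) * b ^ j
          ≤⟨ *-monoˡ-≤ (b ^ j) small ⟩
        M * G * b ^ j
          ≡⟨ rearrange₈ M G (b ^ j) ⟩
        N ∎
        where
        open ≤-Reasoning
        ∈⇒1≤ : ∀ A → head A ∈ X → 1 ≤ ∑ X (λ x → ⟦ x ≟ head A ⟧)
        ∈⇒1≤ A p = ∑-≟-∈ _≟_ X p
        star : ∀ x → ∑ 𝓗 (λ A → ⟦ x ≟ head A ⟧) ≤ Δ * b ^ j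
        star x = *-cancelʳ-≤ _ _ b (begin
          ∑ 𝓗 (λ A → ⟦ x ≟ head A ⟧) * b
            ≤⟨ *-monoˡ-≤ b (∑-mono 𝓗 (λ { (y ∷ A) → ⟦⟧-mono (x ≟ y)
                (agree? P₀ (x ∷ Vec.replicate j x) (y ∷ A)) (λ e → e , agree-empty j _ A) })) ⟩
          deg 𝓗 P₀ (x ∷ Vec.replicate j x) * b
            ≡⟨ cong (deg 𝓗 P₀ (x ∷ Vec.replicate j x) *_) (sym (trans (cong (b ^_) w₀) (*-identityʳ b))) ⟩
          deg 𝓗 P₀ (x ∷ Vec.replicate j x) * b ^ weight P₀
            ≤⟨ sp P₀ (x ∷ Vec.replicate j x) (s≤s z≤n) ⟩
          Δ * b ^ suc j
            ≡⟨ trans (cong (Δ *_) (*-comm b (b ^ j))) (sym (*-assoc Δ (b ^ j) b)) ⟩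
          Δ * b ^ j * b ∎)
          where
          P₀ : Vec Bool (suc j)
          P₀ = true ∷ Vec.replicate j false
          weight-empty : ∀ j → weight (Vec.replicate j false) ≡ 0
          weight-empty zero    = refl
          weight-empty (suc j) = weight-empty j
          w₀ : weight P₀ ≡ 1
          w₀ = cong suc (weight-empty j)

      good-majority : N ≤ length 𝓗 → length 𝓕 * b ≤ N → length X ≤ a₀ → 4 * (Δ * a₀) ≤ M * G →
        N ≤ 2 * ∑ 𝓗 (λ A → ⟦ good? Θ X 𝓕 A ⟧)
      good-majority N≤ len lenX small = *-cancelˡ-≤ 2 (+-cancelʳ-≤ (2 * N) (2 * N) _ (begin
        2 * N + 2 * N
          ≡⟨ rearrange₉ N ⟩
        4 * N
          ≤⟨ *-monoʳ-≤ 4 (begin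
            N ≤⟨ N≤ ⟩
            length 𝓗 ≡⟨ length-∑ 𝓗 ⟩
            ∑ 𝓗 (λ _ → 1) ≤⟨ ∑-mono 𝓗 pointwise ⟩
            ∑ 𝓗 (λ A → g A + (x A + y A)) ≡⟨ ∑-+ 𝓗 g _ ⟩
            ∑ 𝓗 g + ∑ 𝓗 (λ A → x A + y A) ≡⟨ cong (∑ 𝓗 g +_) (∑-+ 𝓗 x y) ⟩
            ∑ 𝓗 g + (∑ 𝓗 x + ∑ 𝓗 y) ∎) ⟩
        4 * (∑ 𝓗 g + (∑ 𝓗 x + ∑ 𝓗 y))
          ≡⟨ rearrange₁₀ (∑ 𝓗 g) (∑ 𝓗 x) (∑ 𝓗 y) ⟩
        2 * (2 * ∑ 𝓗 g) + (4 * ∑ 𝓗 x + 4 * ∑ 𝓗 y)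
          ≤⟨ +-monoʳ-≤ (2 * (2 * ∑ 𝓗 g)) (+-mono-≤ (count-heads lenX small) (count-bad len)) ⟩
        2 * (2 * ∑ 𝓗 g) + (N + N)
          ≡⟨ cong (2 * (2 * ∑ 𝓗 g) +_) (cong (N +_) (sym (+-identityʳ N))) ⟩
        2 * (2 * ∑ 𝓗 g) + 2 * N ∎))
        where
        open ≤-Reasoning
        g x y : Vec E (suc j) → ℕ
        g A = ⟦ good? Θ X 𝓕 A ⟧
        x A = ⟦ head A ∈? X ⟧
        y A = ⟦ any? (saturated? Θ 𝓕 (tail A)) (masks j) ⟧
        pointwise : ∀ A → 1 ≤ g A + (x A + y A)
        pointwise (e ∷ A) = split (e ∈? X) (any? (saturated? Θ 𝓕 A) (masks j))
          where
          split : ∀ {P Q : Set} (p? : Dec P) (q? : Dec Q) → 1 ≤ ⟦ ¬? p? ×-dec ¬? q? ⟧ + (⟦ p? ⟧ + ⟦ q? ⟧)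
          split (yes _) _       = s≤s z≤n
          split (no _)  (yes _) = s≤s z≤n
          split (no _)  (no _)  = s≤s z≤n

      -- At least `N / 2` good tuples share at most `M` heads. Freshness of `e` is automatic: its
      -- link is nonempty, and good tuples have their heads outside `X`.
      popular-head : N ≤ length 𝓗 → length 𝓕 * b ≤ N → length X ≤ a₀ → 4 * (Δ * a₀) ≤ M * G →
        (∀ {A} → A ∈ 𝓗 → head A ∈ E′) →
        Σ E λ e → e ∈ E′ × e ∉ X × b ^ j * G ≤ 2 * length (link Θ X 𝓕 e 𝓗)
      popular-head N≤ len lenX small heads = finish (∑-pigeonhole E′ gain length-E′ 1≤M 1≤g (begin
          N
            ≤⟨ good-majority N≤ len lenX small ⟩
          2 * ∑ 𝓗 (λ A → ⟦ good? Θ X 𝓕 A ⟧)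
            ≤⟨ *-monoʳ-≤ 2 (∑-mono-∈ 𝓗 (λ {A} A∈ → ≤-trans
                (⟦⟧-mono (good? Θ X 𝓕 A) (link? Θ X 𝓕 (head A) A) (λ p → p , refl))
                (term≤∑ (λ e → ⟦ link? Θ X 𝓕 e A ⟧) (heads A∈)))) ⟩
          2 * ∑ 𝓗 (λ A → ∑ E′ (λ e → ⟦ link? Θ X 𝓕 e A ⟧))
            ≡⟨ cong (2 *_) (∑-swap 𝓗 E′ (λ A e → ⟦ link? Θ X 𝓕 e A ⟧)) ⟩
          2 * ∑ E′ gain ∎))
        where
        open ≤-Reasoning
        gain : E → ℕ
        gain e = ∑ 𝓗 (λ A → ⟦ link? Θ X 𝓕 e A ⟧)
        1≤g : 1 ≤ b ^ j * G
        1≤g = *-mono-≤ (1≤b^ j) 1≤G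
        positive : ∀ {x} → 1 ≤ 2 * x → 1 ≤ x
        positive {suc x} _ = s≤s z≤n
        fresh : ∀ {e} A → Good Θ X 𝓕 A × head A ≡ e → e ∉ X
        fresh (x ∷ A) ((x∉ , _) , refl) = x∉
        finish : (Σ E λ e → e ∈ E′ × b ^ j * G ≤ 2 * gain e) → _
        finish (e , e∈ , h) with ∑-positive 𝓗 (λ A → ⟦ link? Θ X 𝓕 e A ⟧) (positive (≤-trans 1≤g h))
        ... | A , _ , p = e , e∈ , fresh A (⟦⟧-witness (link? Θ X 𝓕 e A) p) ,
          subst (λ z → b ^ j * G ≤ 2 * z) (sym (link-length Θ X 𝓕 e 𝓗)) h

    Entries : List (Vec E j) → Set
    Entries 𝓗 = ∀ A → A ∈ 𝓗 → Allᵛ (_∈ E′) A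

    head-∈ : {A : Vec E (suc j)} → Allᵛ (_∈ E′) A → head A ∈ E′
    head-∈ (p ∷ᵛ _) = p

    link-entries : ∀ {Θ X e} (𝓗 : List (Vec E (suc j))) (𝓕 : List (Vec E j)) →
      Entries 𝓗 → Entries 𝓕 → Entries (link Θ X 𝓕 e 𝓗 ++ 𝓕)
    link-entries {Θ = Θ} {X} {e} 𝓗 𝓕 h f A A∈ with ∈-++⁻ (link Θ X 𝓕 e 𝓗) A∈
    ... | inj₂ A∈𝓕 = f A A∈𝓕
    ... | inj₁ A∈l with ∈-map⁻ tail A∈l
    ...   | (x ∷ B) , B∈ , refl with h (x ∷ B) (proj₁ (∈-filter⁻ (link? Θ X 𝓕 e) {xs = 𝓗} B∈))
    ...     | _ ∷ᵛ q = q

    link-independent : ∀ {Θ X e I} (𝓗 : List (Vec E (suc j))) (𝓕 : List (Vec E j)) →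
      I e ≡ true → Independent I 𝓗 → Independent I 𝓕 → Independent I (link Θ X 𝓕 e 𝓗 ++ 𝓕)
    link-independent {Θ = Θ} {X} {e} 𝓗 𝓕 Ie h f A A∈ all with ∈-++⁻ (link Θ X 𝓕 e 𝓗) A∈
    ... | inj₂ A∈𝓕 = f A A∈𝓕 all
    ... | inj₁ A∈l with ∈-map⁻ tail A∈l
    ...   | (x ∷ B) , B∈ , refl with ∈-filter⁻ (link? Θ X 𝓕 e) {xs = 𝓗} B∈
    ...     | B∈𝓗 , _ , refl = h (x ∷ B) B∈𝓗 (Ie ∷ᵛ all)

    -- Independence in a family of 1-tuples forbids each of its entries, so every popular head is a
    -- forced "no" and the budget `q = 0` suffices.
    covers-last : ∀ (𝓗 : List (Vec E 1)) Δ → 1 ≤ Δ → Spread b Δ 𝓗 → M * (b ^ 0 * G) ≤ length 𝓗 →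
      4 * (Δ * a₀) ≤ M * G → Entries 𝓗 →
      ∀ a X → length X + a ≡ a₀ → Unique X → All (_∈ E′) X →
      Covers a 0 X (λ I → Independent I 𝓗)
    covers-last 𝓗 Δ 1≤Δ sp N≤ small ent zero    X lenX u X⊆ = covers-done {q = 0} u X⊆
    covers-last 𝓗 Δ 1≤Δ sp N≤ small ent (suc a) X lenX u X⊆ = extend
      (popular-head 1≤Δ 𝓗 [] X sp N≤ z≤n (subst (length X ≤_) lenX (m≤m+n _ _)) small
        (λ {A} A∈ → head-∈ (ent A A∈)))
      (λ e e∈ e∉ → covers-last 𝓗 Δ 1≤Δ sp N≤ small ent a (e ∷ X) (trans (sym (+-suc _ a)) lenX)
        (All.¬Any⇒All¬ X e∉ ∷ u) (e∈ ∷ X⊆))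
      where
      positive : ∀ {x} → 1 ≤ 2 * x → 1 ≤ x
      positive {suc x} _ = s≤s z≤n
      nonempty : ∀ {Θ X e} → 1 ≤ length (link Θ X [] e 𝓗) → e ∷ [] ∈ 𝓗
      nonempty {Θ} {X} {e} h with ∑-positive 𝓗 _ (subst (1 ≤_) (link-length Θ X [] e 𝓗) h)
      ... | (x ∷ []) , A∈ , q = subst (λ z → z ∷ [] ∈ 𝓗) (proj₂ (⟦⟧-witness (link? Θ X [] e (x ∷ [])) q)) A∈
      extend : ∀ {Θ} → (Σ E λ e → e ∈ E′ × e ∉ X × b ^ 0 * G ≤ 2 * length (link Θ X [] e 𝓗)) →
        (∀ e → e ∈ E′ → e ∉ X → Covers a 0 (e ∷ X) (λ I → Independent I 𝓗)) →
        Covers (suc a) 0 X (λ I → Independent I 𝓗)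
      extend {Θ} (e , e∈ , e∉ , gain) next = covers-no refuse (next e e∈ e∉)
        where
        e∈𝓗 : e ∷ [] ∈ 𝓗
        e∈𝓗 = nonempty {Θ} {X} (positive (≤-trans (*-mono-≤ (1≤b^ 0) 1≤G) gain))
        refuse : ∀ I → Independent I 𝓗 → I e ≡ false
        refuse I ind with I e in eq
        ... | false = refl
        ... | true  = ⊥-elim (ind (e ∷ []) e∈𝓗 (eq ∷ᵛ []ᵛ))

    CoversAll : ℕ → ℕ → Set
    CoversAll j Δ = ∀ (𝓗 : List (Vec E (suc j))) → Spread b Δ 𝓗 → M * (b ^ j * G) ≤ length 𝓗 → Entries 𝓗 →
      ∀ a X → length X + a ≡ a₀ → Unique X → All (_∈ E′) X → Covers a (j * S) X (λ I → Independent I 𝓗)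

    -- `y` answers "yes" are left at this level. Each adds a link of length at least half of
    -- `b ^ suc j * G`, so the last inequality is an invariant, and at `y = 0` it makes `𝓕` large
    -- enough to take over the role of `𝓗`. The exclusions collected in `X` are kept.
    covers-level : ∀ {j Δ} → 1 ≤ Δ → 4 * (Δ * a₀) ≤ M * G → CoversAll j (sat (suc j) * Δ + Δ) →
      (𝓗 : List (Vec E (2 + j))) → Spread b Δ 𝓗 → M * (b ^ suc j * G) ≤ length 𝓗 → Entries 𝓗 →
      ∀ a y X (𝓕 : List (Vec E (suc j))) → length X + a ≡ a₀ → Unique X → All (_∈ E′) X →
      Spread b (sat (suc j) * Δ + Δ) 𝓕 → Entries 𝓕 →
      2 * (M * (b ^ j * G)) ≤ 2 * length 𝓕 + y * (b ^ suc j * G) →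
      Covers a (y + j * S) X (λ I → Independent I 𝓗 × Independent I 𝓕)
    covers-level {j} 1≤Δ small next 𝓗 sp N≤ ent zero    y    X 𝓕 lenX u X⊆ sp𝓕 ent𝓕 progress =
      covers-done {q = y + j * S} u X⊆
    covers-level {j} 1≤Δ small next 𝓗 sp N≤ ent (suc a) zero X 𝓕 lenX u X⊆ sp𝓕 ent𝓕 progress =
      covers-weaken ≤-refl (λ I → proj₂) (next 𝓕 sp𝓕 full ent𝓕 (suc a) X lenX u X⊆)
      where
      full : M * (b ^ j * G) ≤ length 𝓕
      full = *-cancelˡ-≤ 2 (subst (2 * (M * (b ^ j * G)) ≤_) (+-identityʳ _) progress)
    covers-level {j} {Δ} 1≤Δ small next 𝓗 sp N≤ ent (suc a) (suc y) X 𝓕 lenX u X⊆ sp𝓕 ent𝓕 progress =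
      decide (M * (b ^ j * G) ≤? length 𝓕)
        (λ e e∈ e∉ → covers-level {j} {Δ} 1≤Δ small next 𝓗 sp N≤ ent a (suc y) (e ∷ X) 𝓕
          (trans (sym (+-suc _ a)) lenX) (All.¬Any⇒All¬ X e∉ ∷ u) (e∈ ∷ X⊆) sp𝓕 ent𝓕 progress)
        (λ e gain → covers-level {j} {Δ} 1≤Δ small next 𝓗 sp N≤ ent (suc a) y X (link Θ′ X 𝓕 e 𝓗 ++ 𝓕) lenX u X⊆
          (link-spread {Δ = Δ} {Θ = Θ′} {X = X} {e = e} 𝓗 𝓕 sp sp𝓕) (link-entries {Θ = Θ′} {X} {e} 𝓗 𝓕 ent ent𝓕) (progress′ e gain))
      where
      open ≤-Reasoning
      Θ′ : ℕ
      Θ′ = sat (suc j) * Δ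
      Hyp : List (Vec E (suc j)) → (E → Bool) → Set
      Hyp 𝓕 I = Independent I 𝓗 × Independent I 𝓕
      progress′ : ∀ e → b ^ suc j * G ≤ 2 * length (link Θ′ X 𝓕 e 𝓗) →
        2 * (M * (b ^ j * G)) ≤ 2 * length (link Θ′ X 𝓕 e 𝓗 ++ 𝓕) + y * (b ^ suc j * G)
      progress′ e gain = begin
        2 * (M * (b ^ j * G)) ≤⟨ progress ⟩
        2 * length 𝓕 + suc y * (b ^ suc j * G) ≡⟨ rearrange₁₂ (length 𝓕) y (b ^ suc j * G) ⟩
        b ^ suc j * G + (2 * length 𝓕 + y * (b ^ suc j * G)) ≤⟨ +-monoˡ-≤ _ gain ⟩
        2 * length (link Θ′ X 𝓕 e 𝓗) + (2 * length 𝓕 + y * (b ^ suc j * G))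
          ≡⟨ rearrange₁₃ (length 𝓕) (length (link Θ′ X 𝓕 e 𝓗)) (y * (b ^ suc j * G)) ⟩
        2 * (length (link Θ′ X 𝓕 e 𝓗) + length 𝓕) + y * (b ^ suc j * G)
          ≡⟨ cong (λ z → 2 * z + y * (b ^ suc j * G)) (sym (length-++ (link Θ′ X 𝓕 e 𝓗))) ⟩
        2 * length (link Θ′ X 𝓕 e 𝓗 ++ 𝓕) + y * (b ^ suc j * G) ∎
      decide : Dec (M * (b ^ j * G) ≤ length 𝓕) →
        (∀ e → e ∈ E′ → e ∉ X → Covers a (suc y + j * S) (e ∷ X) (Hyp 𝓕)) →
        (∀ e → b ^ suc j * G ≤ 2 * length (link Θ′ X 𝓕 e 𝓗) →
          Covers (suc a) (y + j * S) X (Hyp (link Θ′ X 𝓕 e 𝓗 ++ 𝓕))) →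
        Covers (suc a) (suc y + j * S) X (Hyp 𝓕)
      decide (yes full) no-branch yes-branch =
        covers-weaken (m≤n+m (j * S) (suc y)) (λ I → proj₂) (next 𝓕 sp𝓕 full ent𝓕 (suc a) X lenX u X⊆)
      decide (no ¬full) no-branch yes-branch = query
        (popular-head 1≤Δ 𝓗 𝓕 X sp N≤
          (≤-trans (*-monoˡ-≤ b (<⇒≤ (≰⇒> ¬full))) (≤-reflexive (rearrange₁₁ M (b ^ j) G b)))
          (subst (length X ≤_) lenX (m≤m+n (length X) (suc a))) small (λ {A} A∈ → head-∈ (ent A A∈)))
        where
        query : (Σ E λ e → e ∈ E′ × e ∉ X × b ^ suc j * G ≤ 2 * length (link Θ′ X 𝓕 e 𝓗)) →
          Covers (suc a) (suc y + j * S) X (Hyp 𝓕)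
        query (e , e∈ , e∉ , gain) = covers-query e
          (λ I ind Ie → proj₁ ind , link-independent {Θ = Θ′} {X} {e} {I} 𝓗 𝓕 Ie (proj₁ ind) (proj₂ ind))
          (no-branch e e∈ e∉) (yes-branch e gain)

    -- Induction on the uniformity, starting each level with an empty `𝓕`. The `S` answers granted
    -- per level suffice because `2 * M ≤ S * b`.
    covers : ∀ j Δ → 1 ≤ Δ → 4 * (growth j * Δ * a₀) ≤ M * G → CoversAll j Δ
    covers zero    Δ 1≤Δ small 𝓗 sp N≤ ent a X lenX u X⊆ =
      covers-last 𝓗 Δ 1≤Δ sp N≤ (subst (λ z → 4 * (z * a₀) ≤ M * G) (*-identityˡ Δ) small) ent a X lenX u X⊆
    covers (suc j) Δ 1≤Δ small 𝓗 sp N≤ ent a X lenX u X⊆ =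
      covers-weaken {q = suc j * S} ≤-refl (λ I ind → ind , λ _ ())
        (covers-level {j} {Δ} 1≤Δ small′ (covers j (sat (suc j) * Δ + Δ) (≤-trans 1≤Δ (m≤n+m Δ _)) (subst (λ z → 4 * (z * a₀) ≤ M * G)
            (rearrange₁₆ (growth j) (sat (suc j)) Δ) small))
          𝓗 sp N≤ ent a S X [] lenX u X⊆ (λ _ _ _ → z≤n) (λ _ ()) (begin
            2 * (M * (b ^ j * G)) ≡⟨ rearrange₁₄ M (b ^ j) G ⟩
            2 * M * (b ^ j * G) ≤⟨ *-monoˡ-≤ (b ^ j * G) 2M≤Sb ⟩
            S * b * (b ^ j * G) ≡⟨ rearrange₁₅ S b (b ^ j) G ⟩
            S * (b ^ suc j * G) ∎))
      where
      open ≤-Reasoning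
      small′ : 4 * (Δ * a₀) ≤ M * G
      small′ = ≤-trans (*-monoʳ-≤ 4 (*-monoˡ-≤ a₀ (≤-trans (≤-reflexive (sym (*-identityˡ Δ)))
        (*-monoˡ-≤ Δ (1≤growth (suc j)))))) small

open Containers

-- Tuples, products and chunks of lists

m+n≤o⇒n≤o∸m : ∀ m {n o} → m + n ≤ o → n ≤ o ∸ m
m+n≤o⇒n≤o∸m m {n} {o} h = ≤-trans (≤-reflexive (sym (m+n∸m≡n m n))) (∸-monoˡ-≤ m h)

module _ {A : Set} where

  -- Drawing the i-th vertex from the i-th chunk makes the vertices of a tuple distinct by
  -- construction, at the price of a constant factor in the number of tuples.
  chunks : ∀ (c : ℕ) → ℕ → List A → Vec (List A) c
  chunks zero    ℓ L = []
  chunks (suc c) ℓ L = take ℓ L ∷ chunks c ℓ (drop ℓ L)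

  blocks : ∀ (w t : ℕ) → ℕ → List A → List (Vec (List A) t)
  blocks zero    t ℓ L = []
  blocks (suc w) t ℓ L = chunks t ℓ L ∷ blocks w t ℓ (drop (t * ℓ) L)

  InProd : ∀ {c} → Vec (List A) c → Vec A c → Set
  InProd []       []      = ⊤
  InProd (L ∷ Ls) (x ∷ v) = x ∈ L × InProd Ls v

  prods : ∀ {c} → Vec (List A) c → List (Vec A c)
  prods []       = [] ∷ []
  prods (L ∷ Ls) = concatMap (λ x → map (x ∷_) (prods Ls)) L

  total : ∀ {c} → Vec (List A) c → (A → ℕ) → ℕ
  total []       f = 0
  total (L ∷ Ls) f = ∑ L f + total Ls f

  ∈-take : ∀ ℓ {L : List A} {x} → x ∈ take ℓ L → x ∈ L
  ∈-take (suc ℓ) {y ∷ L} (here p)  = here p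
  ∈-take (suc ℓ) {y ∷ L} (there p) = there (∈-take ℓ p)

  ∈-drop : ∀ ℓ {L : List A} {x} → x ∈ drop ℓ L → x ∈ L
  ∈-drop zero    p             = p
  ∈-drop (suc ℓ) {y ∷ L} p = there (∈-drop ℓ p)

  take-drop-disjoint : ∀ ℓ {L : List A} {x} → Unique L → x ∈ take ℓ L → x ∉ drop ℓ L
  take-drop-disjoint (suc ℓ) {y ∷ L} (y∉ ∷ u) (here refl) q = All.lookup y∉ (∈-drop ℓ q) refl
  take-drop-disjoint (suc ℓ) {y ∷ L} (y∉ ∷ u) (there p)   q = take-drop-disjoint ℓ u p q

  chunks-∈ : ∀ c ℓ {L} {v : Vec A c} → InProd (chunks c ℓ L) v → Allᵛ (_∈ L) v
  chunks-∈ zero    ℓ {v = []}    _       = []ᵛ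
  chunks-∈ (suc c) ℓ {v = x ∷ v} (p , q) = ∈-take ℓ p ∷ᵛ Allᵛ.map (∈-drop ℓ) (chunks-∈ c ℓ q)

  chunks-injective : ∀ c ℓ {L} {v : Vec A c} → Unique L → InProd (chunks c ℓ L) v →
    Injective _≡_ _≡_ (lookup v)
  chunks-injective (suc c) ℓ {L} {x ∷ v} u (p , q) {zero}  {zero}  _  = refl
  chunks-injective (suc c) ℓ {L} {x ∷ v} u (p , q) {zero}  {suc j} eq =
    ⊥-elim (take-drop-disjoint ℓ u p (subst (_∈ drop ℓ L) (sym eq) (Allᵛ.lookup⁺ (chunks-∈ c ℓ q) j)))
  chunks-injective (suc c) ℓ {L} {x ∷ v} u (p , q) {suc i} {zero}  eq =
    ⊥-elim (take-drop-disjoint ℓ u p (subst (_∈ drop ℓ L) eq (Allᵛ.lookup⁺ (chunks-∈ c ℓ q) i)))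
  chunks-injective (suc c) ℓ {L} {x ∷ v} u (p , q) {suc i} {suc j} eq =
    cong suc (chunks-injective c ℓ (Unique.drop⁺ ℓ u) q eq)

  chunks-length≤ : ∀ c ℓ L → Allᵛ (λ p → length p ≤ ℓ) (chunks c ℓ L)
  chunks-length≤ zero    ℓ L = []ᵛ
  chunks-length≤ (suc c) ℓ L =
    ≤-trans (≤-reflexive (length-take ℓ L)) (m⊓n≤m ℓ _) ∷ᵛ chunks-length≤ c ℓ (drop ℓ L)

  chunks-length : ∀ c ℓ L → c * ℓ ≤ length L → Allᵛ (λ p → length p ≡ ℓ) (chunks c ℓ L)
  chunks-length zero    ℓ L h = []ᵛ
  chunks-length (suc c) ℓ L h =
    trans (length-take ℓ L) (m≤n⇒m⊓n≡m (≤-trans (m≤m+n ℓ _) h)) ∷ᵛ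
    chunks-length c ℓ (drop ℓ L) (≤-trans (m+n≤o⇒n≤o∸m ℓ h) (≤-reflexive (sym (length-drop ℓ L))))

  chunks-unique : ∀ c ℓ {L} → Unique L → Allᵛ Unique (chunks c ℓ L)
  chunks-unique zero    ℓ u = []ᵛ
  chunks-unique (suc c) ℓ u = Unique.take⁺ ℓ u ∷ᵛ chunks-unique c ℓ (Unique.drop⁺ ℓ u)

  chunks-total : ∀ c ℓ L f → total (chunks c ℓ L) f + ∑ (drop (c * ℓ) L) f ≡ ∑ L f
  chunks-total zero    ℓ L f = refl
  chunks-total (suc c) ℓ L f = begin
    ∑ (take ℓ L) f + total (chunks c ℓ (drop ℓ L)) f + ∑ (drop (ℓ + c * ℓ) L) f
      ≡⟨ cong (λ z → ∑ (take ℓ L) f + total (chunks c ℓ (drop ℓ L)) f + ∑ z f) (sym (drop-drop ℓ (c * ℓ) L)) ⟩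
    ∑ (take ℓ L) f + total (chunks c ℓ (drop ℓ L)) f + ∑ (drop (c * ℓ) (drop ℓ L)) f
      ≡⟨ +-assoc (∑ (take ℓ L) f) _ _ ⟩
    ∑ (take ℓ L) f + (total (chunks c ℓ (drop ℓ L)) f + ∑ (drop (c * ℓ) (drop ℓ L)) f)
      ≡⟨ cong (∑ (take ℓ L) f +_) (chunks-total c ℓ (drop ℓ L) f) ⟩
    ∑ (take ℓ L) f + ∑ (drop ℓ L) f
      ≡⟨ sym (∑-++ (take ℓ L) (drop ℓ L) f) ⟩
    ∑ (take ℓ L ++ drop ℓ L) f
      ≡⟨ cong (λ z → ∑ z f) (take++drop≡id ℓ L) ⟩
    ∑ L f ∎
    where open ≡-Reasoning

  -- Blocks are disjoint parts of `L`. For `f` the indicator of a vertex and `L` without repetition,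
  -- this allows at most one block through that vertex.
  blocks-total : ∀ w t ℓ L f → ∑ (blocks w t ℓ L) (λ β → total β f) ≤ ∑ L f
  blocks-total zero    t ℓ L f = z≤n
  blocks-total (suc w) t ℓ L f = ≤-trans (+-monoʳ-≤ (total (chunks t ℓ L) f) (blocks-total w t ℓ (drop (t * ℓ) L) f))
    (≤-reflexive (chunks-total t ℓ L f))

  length-blocks : ∀ w t ℓ L → length (blocks w t ℓ L) ≡ w
  length-blocks zero    t ℓ L = refl
  length-blocks (suc w) t ℓ L = cong suc (length-blocks w t ℓ (drop (t * ℓ) L))

  ∈-blocks : ∀ w t ℓ L {β} → w * (t * ℓ) ≤ length L → β ∈ blocks w t ℓ L →
    Σ ℕ λ m → t * ℓ ≤ length (drop m L) × β ≡ chunks t ℓ (drop m L)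
  ∈-blocks (suc w) t ℓ L h (here refl) = 0 , ≤-trans (m≤m+n (t * ℓ) _) h , refl
  ∈-blocks (suc w) t ℓ L h (there p) with ∈-blocks w t ℓ (drop (t * ℓ) L)
    (≤-trans (m+n≤o⇒n≤o∸m (t * ℓ) h) (≤-reflexive (sym (length-drop (t * ℓ) L)))) p
  ... | m , len , eq = t * ℓ + m , subst (λ z → t * ℓ ≤ length z) (drop-drop (t * ℓ) m L) len ,
        trans eq (cong (chunks t ℓ) (drop-drop (t * ℓ) m L))

  ∈-prods : ∀ {c} (Ls : Vec (List A) c) {v} → v ∈ prods Ls → InProd Ls v
  ∈-prods []       {[]} _ = tt
  ∈-prods (L ∷ Ls) v∈ with find (∈-concatMap⁻ (λ x → map (x ∷_) (prods Ls)) {xs = L} v∈)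
  ... | x , x∈ , v∈′ with ∈-map⁻ (x ∷_) v∈′
  ...   | w , w∈ , refl = x∈ , ∈-prods Ls w∈

  ∑-prods : ∀ {c} L (Ls : Vec (List A) c) f →
    ∑ (prods (L ∷ Ls)) f ≡ ∑ L (λ x → ∑ (prods Ls) (λ v → f (x ∷ v)))
  ∑-prods L Ls f = trans (∑-concatMap (λ x → map (x ∷_) (prods Ls)) L f)
    (∑-cong L (λ x → ∑-map (x ∷_) (prods Ls) f))

  length-prods : ∀ {c ℓ} (Ls : Vec (List A) c) → Allᵛ (λ p → length p ≡ ℓ) Ls → length (prods Ls) ≡ ℓ ^ c
  length-prods []       _ = refl
  length-prods {suc c} {ℓ} (L ∷ Ls) (p ∷ᵛ ps) = begin
    length (prods (L ∷ Ls))  ≡⟨ length-∑ (prods (L ∷ Ls)) ⟩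
    ∑ (prods (L ∷ Ls)) (λ _ → 1)  ≡⟨ ∑-prods L Ls (λ _ → 1) ⟩
    ∑ L (λ _ → ∑ (prods Ls) (λ _ → 1))  ≡⟨ ∑-const L _ ⟩
    length L * ∑ (prods Ls) (λ _ → 1)  ≡⟨ cong₂ _*_ p (trans (sym (length-∑ (prods Ls))) (length-prods Ls ps)) ⟩
    ℓ * ℓ ^ c ∎
    where open ≡-Reasoning

  ∑-prods-* : ∀ {c} L (Ls : Vec (List A) c) (f : A → ℕ) (g : Vec A c → ℕ) →
    ∑ (prods (L ∷ Ls)) (λ v → f (head v) * g (tail v)) ≡ ∑ L f * ∑ (prods Ls) g
  ∑-prods-* L Ls f g = trans (∑-prods L Ls _) (trans (∑-cong L (λ x → ∑-*ˡ (prods Ls) (f x) g)) (∑-*ʳ L _ f))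

module Patternsᵛ {V : Set} (_≟ⱽ_ : DecidableEquality V) where

  open DecMembership _≟ⱽ_ using (_∈?_)

  inProd? : ∀ {c} (Ls : Vec (List V) c) v → Dec (InProd Ls v)
  inProd? []       []      = yes tt
  inProd? (L ∷ Ls) (x ∷ v) = (x ∈? L) ×-dec inProd? Ls v

  Match : ∀ {c} → Vec (Maybe V) c → Vec V c → Set
  Match []            []      = ⊤
  Match (just y ∷ p)  (x ∷ v) = y ≡ x × Match p v
  Match (nothing ∷ p) (x ∷ v) = Match p v

  match? : ∀ {c} (p : Vec (Maybe V) c) v → Dec (Match p v)
  match? []            []      = yes tt
  match? (just y ∷ p)  (x ∷ v) = (y ≟ⱽ x) ×-dec match? p v
  match? (nothing ∷ p) (x ∷ v) = match? p v

  used free : ∀ {c} → Vec (Maybe V) c → ℕ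
  used []            = 0
  used (just _ ∷ p)  = suc (used p)
  used (nothing ∷ p) = used p
  free []            = 0
  free (just _ ∷ p)  = free p
  free (nothing ∷ p) = suc (free p)

  used+free : ∀ {c} (p : Vec (Maybe V) c) → used p + free p ≡ c
  used+free []            = refl
  used+free (just _ ∷ p)  = cong suc (used+free p)
  used+free (nothing ∷ p) = trans (+-suc (used p) (free p)) (cong suc (used+free p))

  -- On a conflict the left entry wins; losing the right one only weakens the condition, which is
  -- harmless for upper bounds.
  merge : ∀ {c} → Vec (Maybe V) c → Vec (Maybe V) c → Vec (Maybe V) c
  merge = Vec.zipWith _<∣>_

  match-merge : ∀ {c} (p q : Vec (Maybe V) c) v → Match p v → Match q v → Match (merge p q) v
  match-merge []            []            []      _       _       = tt
  match-merge (just y ∷ p)  (just z ∷ q)  (x ∷ v) (h , i) (_ , k) = h , match-merge p q v i k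
  match-merge (just y ∷ p)  (nothing ∷ q) (x ∷ v) (h , i) k       = h , match-merge p q v i k
  match-merge (nothing ∷ p) (just z ∷ q)  (x ∷ v) i       (h , k) = h , match-merge p q v i k
  match-merge (nothing ∷ p) (nothing ∷ q) (x ∷ v) i       k       = match-merge p q v i k

  used-mergeˡ : ∀ {c} (p q : Vec (Maybe V) c) → used p ≤ used (merge p q)
  used-mergeˡ []            []            = z≤n
  used-mergeˡ (just y ∷ p)  (z ∷ q)       = s≤s (used-mergeˡ p q)
  used-mergeˡ (nothing ∷ p) (just z ∷ q)  = m≤n⇒m≤1+n (used-mergeˡ p q)
  used-mergeˡ (nothing ∷ p) (nothing ∷ q) = used-mergeˡ p q

  used-mergeʳ : ∀ {c} (p q : Vec (Maybe V) c) → used q ≤ used (merge p q)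
  used-mergeʳ []            []            = z≤n
  used-mergeʳ (just y ∷ p)  (just z ∷ q)  = s≤s (used-mergeʳ p q)
  used-mergeʳ (just y ∷ p)  (nothing ∷ q) = m≤n⇒m≤1+n (used-mergeʳ p q)
  used-mergeʳ (nothing ∷ p) (just z ∷ q)  = s≤s (used-mergeʳ p q)
  used-mergeʳ (nothing ∷ p) (nothing ∷ q) = used-mergeʳ p q

module Occurrences {n : ℕ} where

  open Patternsᵛ (Fin._≟_ {n}) public
  open DecMembership (Fin._≟_ {n}) using (_∈?_) public

  count-∈≥ : (L : List (Fin n)) → Unique L → length L ≤ ∑ (allFin n) (λ x → ⟦ x ∈? L ⟧)
  count-∈≥ L u = begin
    length L  ≡⟨ length-∑ L ⟩
    ∑ L (λ _ → 1)  ≤⟨ ∑-mono L (λ y → ∑-≟-∈ Fin._≟_ (allFin n) (∈-allFin y)) ⟩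
    ∑ L (λ y → ∑ (allFin n) (λ x → ⟦ x Fin.≟ y ⟧))  ≡⟨ ∑-swap L (allFin n) _ ⟩
    ∑ (allFin n) (λ x → ∑ L (λ y → ⟦ x Fin.≟ y ⟧))  ≤⟨ ∑-mono (allFin n) pointwise ⟩
    ∑ (allFin n) (λ x → ⟦ x ∈? L ⟧) ∎
    where
    open ≤-Reasoning
    pointwise : ∀ x → ∑ L (λ y → ⟦ x Fin.≟ y ⟧) ≤ ⟦ x ∈? L ⟧
    pointwise x with x ∈? L
    ... | yes _ = ≤-trans (∑-mono L (λ y → ⟦⟧-mono (x Fin.≟ y) (y Fin.≟ x) sym)) (∑-≟-unique Fin._≟_ L u)
    ... | no x∉ = ≤-trans (∑-mono L (λ y → ⟦⟧-mono (x Fin.≟ y) (y Fin.≟ x) sym)) (≤-reflexive (∑-≟-∉ Fin._≟_ L x∉))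

  count-∈≤ : (L : List (Fin n)) → ∑ (allFin n) (λ x → ⟦ x ∈? L ⟧) ≤ length L
  count-∈≤ L = begin
    ∑ (allFin n) (λ x → ⟦ x ∈? L ⟧)  ≤⟨ ∑-mono (allFin n) (λ x → ⟦⟧≤ (x ∈? L) (∑-≟-∈ Fin._≟_ L)) ⟩
    ∑ (allFin n) (λ x → ∑ L (λ y → ⟦ y Fin.≟ x ⟧))  ≡⟨ ∑-swap (allFin n) L _ ⟩
    ∑ L (λ y → ∑ (allFin n) (λ x → ⟦ y Fin.≟ x ⟧))  ≤⟨ ∑-mono L (λ y → ≤-trans
                                                            (∑-mono (allFin n) (λ x → ⟦⟧-mono (y Fin.≟ x) (x Fin.≟ y) sym))
                                                            (∑-≟-unique Fin._≟_ (allFin n) (Unique.allFin⁺ n))) ⟩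
    ∑ L (λ _ → 1)  ≡⟨ sym (length-∑ L) ⟩
    length L ∎
    where open ≤-Reasoning

  tuples : ∀ c → List (Vec (Fin n) c)
  tuples c = prods (Vec.replicate c (allFin n))

  length-tuples : ∀ c → length (tuples c) ≡ n ^ c
  length-tuples c = length-prods (Vec.replicate c (allFin n)) (all c)
    where
    all : ∀ c → Allᵛ (λ p → length p ≡ n) (Vec.replicate c (allFin n))
    all zero    = []ᵛ
    all (suc c) = length-tabulate id ∷ᵛ all c

  count-inProd : ∀ {c d} (Ls : Vec (List (Fin n)) c) → Allᵛ Unique Ls → Allᵛ (λ p → length p ≡ d) Ls →
    d ^ c ≤ ∑ (tuples c) (λ v → ⟦ inProd? Ls v ⟧)
  count-inProd []       _        _        = ≤-refl
  count-inProd {suc c} {d} (L ∷ Ls) (u ∷ᵛ us) (p ∷ᵛ ps) = begin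
    d * d ^ c
      ≤⟨ *-mono-≤ (≤-trans (≤-reflexive (sym p)) (count-∈≥ L u)) (count-inProd Ls us ps) ⟩
    ∑ (allFin n) (λ x → ⟦ x ∈? L ⟧) * ∑ (tuples c) (λ v → ⟦ inProd? Ls v ⟧)
      ≡⟨ sym (∑-prods-* (allFin n) (Vec.replicate c (allFin n)) (λ x → ⟦ x ∈? L ⟧) (λ v → ⟦ inProd? Ls v ⟧)) ⟩
    ∑ (tuples (suc c)) (λ v → ⟦ head v ∈? L ⟧ * ⟦ inProd? Ls (tail v) ⟧)
      ≤⟨ ∑-mono (tuples (suc c)) (λ { (x ∷ v) → ≤-reflexive (sym (⟦⟧-× (x ∈? L) (inProd? Ls v))) }) ⟩
    ∑ (tuples (suc c)) (λ v → ⟦ inProd? (L ∷ Ls) v ⟧) ∎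
    where open ≤-Reasoning

  -- A prescribed coordinate leaves at most one choice and a free one at most `d`.
  count-match : ∀ {c d} (Ls : Vec (List (Fin n)) c) → Allᵛ (λ p → length p ≤ d) Ls → ∀ p →
    ∑ (tuples c) (λ v → ⟦ match? p v ⟧ * ⟦ inProd? Ls v ⟧) ≤ d ^ free p
  count-match []       _        []            = ≤-refl
  count-match {suc c} {d} (L ∷ Ls) (h ∷ᵛ hs) (nothing ∷ p) = begin
    ∑ (tuples (suc c)) (λ v → ⟦ match? (nothing ∷ p) v ⟧ * ⟦ inProd? (L ∷ Ls) v ⟧)
      ≤⟨ ∑-mono (tuples (suc c)) (λ { (x ∷ v) → pointwise x v }) ⟩
    ∑ (tuples (suc c)) (λ v → ⟦ head v ∈? L ⟧ * (⟦ match? p (tail v) ⟧ * ⟦ inProd? Ls (tail v) ⟧))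
      ≡⟨ ∑-prods-* (allFin n) (Vec.replicate c (allFin n)) (λ x → ⟦ x ∈? L ⟧) _ ⟩
    ∑ (allFin n) (λ x → ⟦ x ∈? L ⟧) * ∑ (tuples c) (λ v → ⟦ match? p v ⟧ * ⟦ inProd? Ls v ⟧)
      ≤⟨ *-mono-≤ (≤-trans (count-∈≤ L) h) (count-match Ls hs p) ⟩
    d * d ^ free p ∎
    where
    open ≤-Reasoning
    pointwise : ∀ x v → ⟦ match? p v ⟧ * ⟦ (x ∈? L) ×-dec inProd? Ls v ⟧ ≤
      ⟦ x ∈? L ⟧ * (⟦ match? p v ⟧ * ⟦ inProd? Ls v ⟧)
    pointwise x v = ≤-reflexive (trans (cong (⟦ match? p v ⟧ *_) (⟦⟧-× (x ∈? L) (inProd? Ls v)))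
      (*-left-comm ⟦ match? p v ⟧ ⟦ x ∈? L ⟧ _))
      where
      *-left-comm : ∀ a b c → a * (b * c) ≡ b * (a * c)
      *-left-comm a b c = trans (sym (*-assoc a b c)) (trans (cong (_* c) (*-comm a b)) (*-assoc b a c))
  count-match {suc c} {d} (L ∷ Ls) (h ∷ᵛ hs) (just y ∷ p) = begin
    ∑ (tuples (suc c)) (λ v → ⟦ match? (just y ∷ p) v ⟧ * ⟦ inProd? (L ∷ Ls) v ⟧)
      ≤⟨ ∑-mono (tuples (suc c)) (λ { (x ∷ v) → pointwise x v }) ⟩
    ∑ (tuples (suc c)) (λ v → ⟦ head v Fin.≟ y ⟧ * (⟦ match? p (tail v) ⟧ * ⟦ inProd? Ls (tail v) ⟧))
      ≡⟨ ∑-prods-* (allFin n) (Vec.replicate c (allFin n)) (λ x → ⟦ x Fin.≟ y ⟧) _ ⟩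
    ∑ (allFin n) (λ x → ⟦ x Fin.≟ y ⟧) * ∑ (tuples c) (λ v → ⟦ match? p v ⟧ * ⟦ inProd? Ls v ⟧)
      ≤⟨ *-mono-≤ (∑-≟-unique Fin._≟_ (allFin n) (Unique.allFin⁺ n)) (count-match Ls hs p) ⟩
    1 * d ^ free p
      ≡⟨ *-identityˡ _ ⟩
    d ^ free p ∎
    where
    open ≤-Reasoning
    pointwise : ∀ x v → ⟦ (y Fin.≟ x) ×-dec match? p v ⟧ * ⟦ (x ∈? L) ×-dec inProd? Ls v ⟧ ≤
      ⟦ x Fin.≟ y ⟧ * (⟦ match? p v ⟧ * ⟦ inProd? Ls v ⟧)
    pointwise x v = begin
      ⟦ (y Fin.≟ x) ×-dec match? p v ⟧ * ⟦ (x ∈? L) ×-dec inProd? Ls v ⟧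
        ≤⟨ *-monoʳ-≤ ⟦ (y Fin.≟ x) ×-dec match? p v ⟧ (⟦⟧-mono ((x ∈? L) ×-dec inProd? Ls v) (inProd? Ls v) proj₂) ⟩
      ⟦ (y Fin.≟ x) ×-dec match? p v ⟧ * ⟦ inProd? Ls v ⟧
        ≡⟨ cong (_* ⟦ inProd? Ls v ⟧) (⟦⟧-× (y Fin.≟ x) (match? p v)) ⟩
      ⟦ y Fin.≟ x ⟧ * ⟦ match? p v ⟧ * ⟦ inProd? Ls v ⟧
        ≡⟨ *-assoc ⟦ y Fin.≟ x ⟧ _ _ ⟩
      ⟦ y Fin.≟ x ⟧ * (⟦ match? p v ⟧ * ⟦ inProd? Ls v ⟧)
        ≤⟨ *-monoˡ-≤ _ (⟦⟧-mono (y Fin.≟ x) (x Fin.≟ y) sym) ⟩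
      ⟦ x Fin.≟ y ⟧ * (⟦ match? p v ⟧ * ⟦ inProd? Ls v ⟧) ∎

-- Families of copies of K_{s,t} and their degrees

module CopyFamilies where

  private variable
    m n s : ℕ

  nonempty? : (P : Vec Bool s) → Dec (1 ≤ weight P)
  nonempty? P = 1 ≤? weight P

  -- A mask on the pairs of a copy is read as a grid with one row for each centre and one column for
  -- each entry of the common s-tuple.
  occupied vacant : Vec (Vec Bool s) m → ℕ
  occupied []       = 0
  occupied (P ∷ Ps) = ⟦ nonempty? P ⟧ + occupied Ps
  vacant []         = 0
  vacant (P ∷ Ps)   = ⟦ ¬? (nonempty? P) ⟧ + vacant Ps

  ⟦⟧+⟦¬⟧ : ∀ {P : Set} (p? : Dec P) → ⟦ p? ⟧ + ⟦ ¬? p? ⟧ ≡ 1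
  ⟦⟧+⟦¬⟧ (yes _) = refl
  ⟦⟧+⟦¬⟧ (no _)  = refl

  occupied+vacant : (Ps : Vec (Vec Bool s) m) → occupied Ps + vacant Ps ≡ m
  occupied+vacant []       = refl
  occupied+vacant (P ∷ Ps) = trans (+-interchange ⟦ nonempty? P ⟧ (occupied Ps) _ _)
    (cong₂ _+_ (⟦⟧+⟦¬⟧ (nonempty? P)) (occupied+vacant Ps))

  weight-++ : ∀ {m n} (P : Vec Bool m) (Q : Vec Bool n) → weight (P Vec.++ Q) ≡ weight P + weight Q
  weight-++ []          Q = refl
  weight-++ (true ∷ P)  Q = cong suc (weight-++ P Q)
  weight-++ (false ∷ P) Q = weight-++ P Q

  module Copies {n : ℕ} where

    V E : Set
    V = Fin n
    E = V × V

    _≟ᴱ_ : DecidableEquality E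
    _≟ᴱ_ = ≡-dec Fin._≟_ Fin._≟_

    open Occurrences {n} public
    open Patterns _≟ᴱ_ public

    star : V → Vec V s → Vec E s
    star b A = Vec.map (b ,_) A

    edges : Vec V s → Vec V m → Vec E (m * s)
    edges A bs = Vec.concat (Vec.map (λ b → star b A) bs)

    agree-++ : ∀ {k l} (P : Vec Bool k) {Q : Vec Bool l} Z {W} Y {X} →
      Agree (P Vec.++ Q) (Z Vec.++ W) (Y Vec.++ X) → Agree P Z Y × Agree Q W X
    agree-++ []          []      []      h       = tt , h
    agree-++ (true ∷ P)  (z ∷ Z) (y ∷ Y) (e , h) = (e , proj₁ (agree-++ P Z Y h)) , proj₂ (agree-++ P Z Y h)
    agree-++ (false ∷ P) (z ∷ Z) (y ∷ Y) h       = agree-++ P Z Y h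

    pattern-of : Vec Bool s → Vec E s → Vec (Maybe V) s
    pattern-of []          []            = []
    pattern-of (true ∷ P)  ((_ , x) ∷ Z) = just x ∷ pattern-of P Z
    pattern-of (false ∷ P) (_ ∷ Z)       = nothing ∷ pattern-of P Z

    used-pattern : (P : Vec Bool s) (Z : Vec E s) → used (pattern-of P Z) ≡ weight P
    used-pattern []          []      = refl
    used-pattern (true ∷ P)  (_ ∷ Z) = cong suc (used-pattern P Z)
    used-pattern (false ∷ P) (_ ∷ Z) = used-pattern P Z

    agree⇒match : ∀ (P : Vec Bool s) Z b A → Agree P Z (star b A) → Match (pattern-of P Z) A
    agree⇒match []          []            b []      _       = tt
    agree⇒match (true ∷ P)  ((_ , x) ∷ Z) b (a ∷ A) (e , h) = cong proj₂ e , agree⇒match P Z b A h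
    agree⇒match (false ∷ P) (_ ∷ Z)       b (a ∷ A) h       = agree⇒match P Z b A h

    agree⇒centre : ∀ (P : Vec Bool s) Z → 1 ≤ weight P → Σ V λ y → ∀ b A → Agree P Z (star b A) → b ≡ y
    agree⇒centre (true ∷ P)  ((y , _) ∷ Z) _ = y , λ { b (a ∷ A) (e , _) → sym (cong proj₁ e) }
    agree⇒centre (false ∷ P) (_ ∷ Z)       h with agree⇒centre P Z h
    ... | y , f = y , λ { b (a ∷ A) e → f b A e }

    -- The entries forced on the s-tuple by all rows together; `used` of it is the number of columns
    -- that the mask meets.
    mergeRows : Vec (Vec Bool s) m → Vec (Vec E s) m → Vec (Maybe V) s
    mergeRows []       []       = Vec.replicate _ nothing
    mergeRows (P ∷ Ps) (Z ∷ Zs) = merge (pattern-of P Z) (mergeRows Ps Zs)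

    -- A set of cells lies in the product of the rows and the columns that it meets.
    weight≤used*occupied : ∀ (Ps : Vec (Vec Bool s) m) Zs →
      weight (Vec.concat Ps) ≤ used (mergeRows Ps Zs) * occupied Ps
    weight≤used*occupied []       []       = z≤n
    weight≤used*occupied (P ∷ Ps) (Z ∷ Zs) = begin
      weight (P Vec.++ Vec.concat Ps)
        ≡⟨ weight-++ P (Vec.concat Ps) ⟩
      weight P + weight (Vec.concat Ps)
        ≤⟨ +-mono-≤ (row (nonempty? P)) (≤-trans (weight≤used*occupied Ps Zs)
             (*-monoˡ-≤ (occupied Ps) (used-mergeʳ (pattern-of P Z) (mergeRows Ps Zs)))) ⟩
      u * ⟦ nonempty? P ⟧ + u * occupied Ps
        ≡⟨ sym (*-distribˡ-+ u ⟦ nonempty? P ⟧ _) ⟩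
      u * occupied (P ∷ Ps) ∎
      where
      open ≤-Reasoning
      u : ℕ
      u = used (mergeRows (P ∷ Ps) (Z ∷ Zs))
      row : (p? : Dec (1 ≤ weight P)) → weight P ≤ u * ⟦ p? ⟧
      row (yes _) = ≤-trans (≤-reflexive (sym (used-pattern P Z)))
        (≤-trans (used-mergeˡ (pattern-of P Z) (mergeRows Ps Zs)) (≤-reflexive (sym (*-identityʳ u))))
      row (no h)  = ≤-trans (≤-pred (≰⇒> h)) z≤n

    rowCount : Vec Bool s → Vec E s → Vec V s → List V → ℕ
    rowCount P Z A L = ∑ L (λ b → ⟦ agree? P Z (star b A) ⟧)

    copyCount : Vec (Vec Bool s) m → Vec (Vec E s) m → Vec V s → Vec (List V) m → ℕ
    copyCount Ps Zs A β = ∑ (prods β) (λ bs → ⟦ agree? (Vec.concat Ps) (Vec.concat Zs) (edges A bs) ⟧)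

    copyCount-∷ : ∀ (P : Vec Bool s) Z A L (Ps : Vec (Vec Bool s) m) Zs β →
      copyCount (P ∷ Ps) (Z ∷ Zs) A (L ∷ β) ≤ rowCount P Z A L * copyCount Ps Zs A β
    copyCount-∷ P Z A L Ps Zs β = begin
      copyCount (P ∷ Ps) (Z ∷ Zs) A (L ∷ β)
        ≡⟨ ∑-prods L β _ ⟩
      ∑ L (λ b → ∑ (prods β) (λ bs → ⟦ agree? (P Vec.++ Vec.concat Ps) (Z Vec.++ Vec.concat Zs) (star b A Vec.++ edges A bs) ⟧))
        ≤⟨ ∑-mono L (λ b → ∑-mono (prods β) (λ bs → ≤-trans
             (⟦⟧-mono (agree? (P Vec.++ Vec.concat Ps) (Z Vec.++ Vec.concat Zs) (star b A Vec.++ edges A bs))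
               (agree? P Z (star b A) ×-dec agree? (Vec.concat Ps) (Vec.concat Zs) (edges A bs))
               (agree-++ P Z (star b A)))
             (≤-reflexive (⟦⟧-× (agree? P Z (star b A)) (agree? (Vec.concat Ps) (Vec.concat Zs) (edges A bs)))))) ⟩
      ∑ L (λ b → ∑ (prods β) (λ bs → ⟦ agree? P Z (star b A) ⟧ * ⟦ agree? (Vec.concat Ps) (Vec.concat Zs) (edges A bs) ⟧))
        ≡⟨ ∑-cong L (λ b → ∑-*ˡ (prods β) ⟦ agree? P Z (star b A) ⟧ _) ⟩
      ∑ L (λ b → ⟦ agree? P Z (star b A) ⟧ * copyCount Ps Zs A β)
        ≡⟨ ∑-*ʳ L (copyCount Ps Zs A β) _ ⟩
      rowCount P Z A L * copyCount Ps Zs A β ∎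
      where open ≤-Reasoning

    matched : Vec (Vec Bool s) m → Vec (Vec E s) m → Vec V s → ℕ
    matched Ps Zs A = ⟦ match? (mergeRows Ps Zs) A ⟧

    matched-∷ : ∀ (P : Vec Bool s) Z (Ps : Vec (Vec Bool s) m) Zs A →
      ⟦ match? (pattern-of P Z) A ⟧ * matched Ps Zs A ≤ matched (P ∷ Ps) (Z ∷ Zs) A
    matched-∷ P Z Ps Zs A = ≤-trans
      (≤-reflexive (sym (⟦⟧-× (match? (pattern-of P Z) A) (match? (mergeRows Ps Zs) A))))
      (⟦⟧-mono (match? (pattern-of P Z) A ×-dec match? (mergeRows Ps Zs) A) (match? (mergeRows (P ∷ Ps) (Z ∷ Zs)) A)
        (λ { (h , i) → match-merge (pattern-of P Z) (mergeRows Ps Zs) A h i }))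

    rowCount≤length : ∀ (P : Vec Bool s) Z A L {ℓ} → length L ≤ ℓ →
      rowCount P Z A L ≤ ℓ * ⟦ match? (pattern-of P Z) A ⟧
    rowCount≤length P Z A L {ℓ} len = ≤-trans (∑-≤-const L ⟦ match? (pattern-of P Z) A ⟧ (λ {b} _ →
        ⟦⟧-mono (agree? P Z (star b A)) (match? (pattern-of P Z) A) (agree⇒match P Z b A)))
      (*-monoˡ-≤ ⟦ match? (pattern-of P Z) A ⟧ len)

    rowCount-centre : ∀ (P : Vec Bool s) Z → 1 ≤ weight P → Σ V λ y → ∀ A L →
      rowCount P Z A L ≤ ⟦ match? (pattern-of P Z) A ⟧ * ∑ L (λ b → ⟦ b Fin.≟ y ⟧)
    rowCount-centre P Z h with agree⇒centre P Z h
    ... | y , centre = y , λ A L → ≤-trans (∑-mono L (λ b → ≤-trans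
        (⟦⟧-mono (agree? P Z (star b A)) (match? (pattern-of P Z) A ×-dec (b Fin.≟ y))
          (λ ag → agree⇒match P Z b A ag , centre b A ag))
        (≤-reflexive (⟦⟧-× (match? (pattern-of P Z) A) (b Fin.≟ y)))))
      (≤-reflexive (∑-*ˡ L ⟦ match? (pattern-of P Z) A ⟧ _))

    rowCount-bound : ∀ (P : Vec Bool s) Z A L {ℓ} → length L ≤ ℓ → Unique L →
      rowCount P Z A L ≤ ℓ ^ ⟦ ¬? (nonempty? P) ⟧ * ⟦ match? (pattern-of P Z) A ⟧
    rowCount-bound P Z A L {ℓ} len u = go (nonempty? P)
      where
      open ≤-Reasoning
      go : (p? : Dec (1 ≤ weight P)) → rowCount P Z A L ≤ ℓ ^ ⟦ ¬? p? ⟧ * ⟦ match? (pattern-of P Z) A ⟧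
      go (no _)  = ≤-trans (rowCount≤length P Z A L len)
        (≤-reflexive (cong (_* ⟦ match? (pattern-of P Z) A ⟧) (sym (*-identityʳ ℓ))))
      go (yes h) with rowCount-centre P Z h
      ... | y , bound = begin
        rowCount P Z A L ≤⟨ bound A L ⟩
        ⟦ match? (pattern-of P Z) A ⟧ * ∑ L (λ b → ⟦ b Fin.≟ y ⟧)
          ≤⟨ *-monoʳ-≤ ⟦ match? (pattern-of P Z) A ⟧ (∑-≟-unique Fin._≟_ L u) ⟩
        ⟦ match? (pattern-of P Z) A ⟧ * 1 ≡⟨ *-comm ⟦ match? (pattern-of P Z) A ⟧ 1 ⟩
        1 * ⟦ match? (pattern-of P Z) A ⟧ ∎

    Small : ℕ → Vec (List V) m → Set
    Small ℓ β = Allᵛ (λ L → length L ≤ ℓ × Unique L) β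

    -- Row by row: an occupied row forces its centre, and a vacant row leaves `ℓ` choices.
    copyCount-bound : ∀ (Ps : Vec (Vec Bool s) m) Zs A β {ℓ} → Small ℓ β →
      copyCount Ps Zs A β ≤ ℓ ^ vacant Ps * matched Ps Zs A
    copyCount-bound []       []       A []      {ℓ} _ = ≤-reflexive
      (sym (trans (+-identityʳ _) (⟦⟧-yes (match? (mergeRows [] []) A) (trivial A))))
      where
      trivial : ∀ {s} (A : Vec V s) → Match (Vec.replicate s nothing) A
      trivial []      = tt
      trivial (_ ∷ A) = trivial A
    copyCount-bound (P ∷ Ps) (Z ∷ Zs) A (L ∷ β) {ℓ} ((len , u) ∷ᵛ sm) = begin
      copyCount (P ∷ Ps) (Z ∷ Zs) A (L ∷ β)
        ≤⟨ copyCount-∷ P Z A L Ps Zs β ⟩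
      rowCount P Z A L * copyCount Ps Zs A β
        ≤⟨ *-mono-≤ (rowCount-bound P Z A L len u) (copyCount-bound Ps Zs A β sm) ⟩
      (ℓ ^ ⟦ ¬? (nonempty? P) ⟧ * ⟦ match? (pattern-of P Z) A ⟧) * (ℓ ^ vacant Ps * matched Ps Zs A)
        ≡⟨ *-interchange (ℓ ^ ⟦ ¬? (nonempty? P) ⟧) _ _ _ ⟩
      (ℓ ^ ⟦ ¬? (nonempty? P) ⟧ * ℓ ^ vacant Ps) * (⟦ match? (pattern-of P Z) A ⟧ * matched Ps Zs A)
        ≤⟨ *-mono-≤ (≤-reflexive (sym (^-distribˡ-+-* ℓ ⟦ ¬? (nonempty? P) ⟧ (vacant Ps)))) (matched-∷ P Z Ps Zs A) ⟩
      ℓ ^ vacant (P ∷ Ps) * matched (P ∷ Ps) (Z ∷ Zs) A ∎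
      where
      open ≤-Reasoning
      *-interchange : ∀ a b c d → (a * b) * (c * d) ≡ (a * c) * (b * d)
      *-interchange = solve-∀

    -- The indicator of one forced centre `y` is kept instead of being bounded by 1. Summed over all
    -- blocks of `A` it is still at most 1, whereas `copyCount-bound` would lose the number of
    -- blocks.
    copyCount-centre : ∀ (Ps : Vec (Vec Bool s) m) Zs → 1 ≤ weight (Vec.concat Ps) →
      Σ V λ y → ∀ A β {ℓ} → Small ℓ β →
        copyCount Ps Zs A β ≤ ℓ ^ vacant Ps * (matched Ps Zs A * total β (λ b → ⟦ b Fin.≟ y ⟧))
    copyCount-centre {s} {suc m} (P ∷ Ps) (Z ∷ Zs) h = go (nonempty? P)
      where
      open ≤-Reasoning
      *-perm₁ : ∀ m c v p → (m * c) * (v * p) ≡ v * ((m * p) * c)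
      *-perm₁ = solve-∀
      *-perm₂ : ∀ l m v p c → (l * m) * (v * (p * c)) ≡ (l * v) * ((m * p) * c)
      *-perm₂ = solve-∀
      go : (p? : Dec (1 ≤ weight P)) → Σ V λ y → ∀ A β {ℓ} → Small ℓ β →
        copyCount (P ∷ Ps) (Z ∷ Zs) A β ≤
          ℓ ^ (⟦ ¬? p? ⟧ + vacant Ps) * (matched (P ∷ Ps) (Z ∷ Zs) A * total β (λ b → ⟦ b Fin.≟ y ⟧))
      go (yes 1≤P) with rowCount-centre P Z 1≤P
      ... | y , bound = y , λ { A (L ∷ β) {ℓ} (_ ∷ᵛ sm) → begin
        copyCount (P ∷ Ps) (Z ∷ Zs) A (L ∷ β)
          ≤⟨ copyCount-∷ P Z A L Ps Zs β ⟩
        rowCount P Z A L * copyCount Ps Zs A β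
          ≤⟨ *-mono-≤ (bound A L) (copyCount-bound Ps Zs A β sm) ⟩
        (⟦ match? (pattern-of P Z) A ⟧ * ∑ L (λ b → ⟦ b Fin.≟ y ⟧)) * (ℓ ^ vacant Ps * matched Ps Zs A)
          ≡⟨ *-perm₁ ⟦ match? (pattern-of P Z) A ⟧ (∑ L (λ b → ⟦ b Fin.≟ y ⟧)) (ℓ ^ vacant Ps) (matched Ps Zs A) ⟩
        ℓ ^ vacant Ps * ((⟦ match? (pattern-of P Z) A ⟧ * matched Ps Zs A) * ∑ L (λ b → ⟦ b Fin.≟ y ⟧))
          ≤⟨ *-monoʳ-≤ (ℓ ^ vacant Ps) (*-mono-≤ (matched-∷ P Z Ps Zs A) (m≤m+n _ _)) ⟩
        ℓ ^ vacant Ps * (matched (P ∷ Ps) (Z ∷ Zs) A * total (L ∷ β) (λ b → ⟦ b Fin.≟ y ⟧)) ∎ }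
      go (no ¬1≤P) with copyCount-centre Ps Zs (subst (1 ≤_) (trans (weight-++ P (Vec.concat Ps))
                          (cong (_+ weight (Vec.concat Ps)) (n≤0⇒n≡0 (≤-pred (≰⇒> ¬1≤P))))) h)
      ... | y , bound = y , λ { A (L ∷ β) {ℓ} ((len , _) ∷ᵛ sm) → begin
        copyCount (P ∷ Ps) (Z ∷ Zs) A (L ∷ β)
          ≤⟨ copyCount-∷ P Z A L Ps Zs β ⟩
        rowCount P Z A L * copyCount Ps Zs A β
          ≤⟨ *-mono-≤ (rowCount≤length P Z A L len) (bound A β sm) ⟩
        (ℓ * ⟦ match? (pattern-of P Z) A ⟧) * (ℓ ^ vacant Ps * (matched Ps Zs A * total β (λ b → ⟦ b Fin.≟ y ⟧)))
          ≡⟨ *-perm₂ ℓ ⟦ match? (pattern-of P Z) A ⟧ (ℓ ^ vacant Ps) (matched Ps Zs A) (total β (λ b → ⟦ b Fin.≟ y ⟧)) ⟩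
        (ℓ ^ suc (vacant Ps)) * ((⟦ match? (pattern-of P Z) A ⟧ * matched Ps Zs A) * total β (λ b → ⟦ b Fin.≟ y ⟧))
          ≤⟨ *-monoʳ-≤ (ℓ ^ suc (vacant Ps)) (*-mono-≤ (matched-∷ P Z Ps Zs A) (m≤n+m _ _)) ⟩
        ℓ ^ suc (vacant Ps) * (matched (P ∷ Ps) (Z ∷ Zs) A * total (L ∷ β) (λ b → ⟦ b Fin.≟ y ⟧)) ∎ }

  module Family {n : ℕ} (s t d ℓ : ℕ) {{_ : NonZero (t * ℓ)}}
    (B : List (Fin n)) (B-unique : Unique B)
    (nb : Fin n → List (Fin n)) (nb-unique : ∀ b → Unique (nb b))
    (length-nb : ∀ {b} → b ∈ B → length (nb b) ≡ s * d)
    where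

    open Copies {n}

    pieces : V → Vec (List V) s
    pieces b = chunks s d (nb b)

    common : Vec V s → List V
    common A = filter (λ b → inProd? (pieces b) A) B

    common-unique : ∀ A → Unique (common A)
    common-unique A = Unique.filter⁺ (λ b → inProd? (pieces b) A) B-unique

    width : Vec V s → ℕ
    width A = length (common A) / (t * ℓ)

    blocksOf : Vec V s → List (Vec (List V) t)
    blocksOf A = blocks (width A) t ℓ (common A)

    family : List (Vec E (t * s))
    family = concatMap (λ A → concatMap (λ β → map (edges A) (prods β)) (blocksOf A)) (tuples s)

    ground : List E
    ground = concatMap (λ b → map (b ,_) (nb b)) B

    ∑-family : ∀ f → ∑ family f ≡ ∑ (tuples s) (λ A → ∑ (blocksOf A) (λ β → ∑ (prods β) (λ bs → f (edges A bs))))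
    ∑-family f = trans (∑-concatMap _ (tuples s) f) (∑-cong (tuples s) λ A →
      trans (∑-concatMap (λ β → map (edges A) (prods β)) (blocksOf A) f)
        (∑-cong (blocksOf A) λ β → ∑-map (edges A) (prods β) f))

    ∈-blocksOf : ∀ A {β} → β ∈ blocksOf A →
      Σ ℕ λ m → t * ℓ ≤ length (drop m (common A)) × β ≡ chunks t ℓ (drop m (common A))
    ∈-blocksOf A = ∈-blocks (width A) t ℓ (common A) (m/n*n≤m (length (common A)) (t * ℓ))

    blocksOf-small : ∀ A {β} → β ∈ blocksOf A → Small ℓ β
    blocksOf-small A β∈ with ∈-blocksOf A β∈
    ... | m , _ , refl = Allᵛ.zip (chunks-length≤ t ℓ _ , chunks-unique t ℓ (Unique.drop⁺ m (common-unique A)))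

    length-ground : length ground ≡ length B * (s * d)
    length-ground = begin
      length ground  ≡⟨ length-∑ ground ⟩
      ∑ ground (λ _ → 1)  ≡⟨ ∑-concatMap _ B _ ⟩
      ∑ B (λ b → ∑ (map (b ,_) (nb b)) (λ _ → 1)) ≡⟨ ∑-cong-∈ B (λ {b} b∈ → trans (sym (length-∑ (map (b ,_) (nb b))))
                                                      (trans (length-map _ (nb b)) (length-nb b∈))) ⟩
      ∑ B (λ _ → s * d)  ≡⟨ ∑-const B (s * d) ⟩
      length B * (s * d) ∎
      where
      open ≡-Reasoning
      ∑-cong-∈ : ∀ (xs : List V) {f g : V → ℕ} → (∀ {x} → x ∈ xs → f x ≡ g x) → ∑ xs f ≡ ∑ xs g
      ∑-cong-∈ xs h = ≤-antisym (∑-mono-∈ xs (≤-reflexive ∘ h)) (∑-mono-∈ xs (≤-reflexive ∘ sym ∘ h))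

    -- Double counting of stars: each centre in `B` is common to at least `d ^ s` tuples `A`. The
    -- second summand is the loss of at most `t * ℓ` centres for each of the `n ^ s` tuples when
    -- common neighbourhoods are rounded down to whole blocks.
    length-family : length B * d ^ s * ℓ ^ t ≤ length family * (t * ℓ) + n ^ s * (t * ℓ) * ℓ ^ t
    length-family = begin
      length B * d ^ s * ℓ ^ t
        ≡⟨ cong (_* ℓ ^ t) (sym (∑-const B (d ^ s))) ⟩
      ∑ B (λ _ → d ^ s) * ℓ ^ t
        ≤⟨ *-monoˡ-≤ (ℓ ^ t) (∑-mono-∈ B (λ {b} b∈ → count-inProd (pieces b) (chunks-unique s d (nb-unique b))
             (chunks-length s d (nb b) (≤-reflexive (sym (length-nb b∈)))))) ⟩
      ∑ B (λ b → ∑ (tuples s) (λ A → ⟦ inProd? (pieces b) A ⟧)) * ℓ ^ t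
        ≡⟨ cong (_* ℓ ^ t) (∑-swap B (tuples s) _) ⟩
      ∑ (tuples s) (λ A → ∑ B (λ b → ⟦ inProd? (pieces b) A ⟧)) * ℓ ^ t
        ≡⟨ cong (_* ℓ ^ t) (∑-cong (tuples s) (λ A → sym (length-filter-∑ (λ b → inProd? (pieces b) A) B))) ⟩
      ∑ (tuples s) (λ A → length (common A)) * ℓ ^ t
        ≤⟨ *-monoˡ-≤ (ℓ ^ t) (∑-mono (tuples s) (λ A → floor (length (common A)))) ⟩
      ∑ (tuples s) (λ A → width A * (t * ℓ) + t * ℓ) * ℓ ^ t
        ≡⟨ cong (_* ℓ ^ t) (trans (∑-+ (tuples s) _ _) (cong₂ _+_ (∑-*ʳ (tuples s) (t * ℓ) width)
             (trans (∑-const (tuples s) (t * ℓ)) (cong (_* (t * ℓ)) (length-tuples s))))) ⟩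
      (∑ (tuples s) width * (t * ℓ) + n ^ s * (t * ℓ)) * ℓ ^ t
        ≡⟨ rearrange (∑ (tuples s) width) (t * ℓ) (n ^ s) (ℓ ^ t) ⟩
      ∑ (tuples s) width * ℓ ^ t * (t * ℓ) + n ^ s * (t * ℓ) * ℓ ^ t
        ≡⟨ cong (λ z → z * (t * ℓ) + n ^ s * (t * ℓ) * ℓ ^ t) (sym count) ⟩
      length family * (t * ℓ) + n ^ s * (t * ℓ) * ℓ ^ t ∎
      where
      open ≤-Reasoning
      rearrange : ∀ w q m p → (w * q + m * q) * p ≡ w * p * q + m * q * p
      rearrange = solve-∀
      floor : ∀ c → c ≤ (c / (t * ℓ)) * (t * ℓ) + t * ℓ
      floor c = begin
        c ≡⟨ m≡m%n+[m/n]*n c (t * ℓ) ⟩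
        _ + (c / (t * ℓ)) * (t * ℓ) ≤⟨ +-monoˡ-≤ _ (<⇒≤ (m%n<n c (t * ℓ))) ⟩
        t * ℓ + (c / (t * ℓ)) * (t * ℓ) ≡⟨ +-comm (t * ℓ) _ ⟩
        (c / (t * ℓ)) * (t * ℓ) + t * ℓ ∎
      block-size : ∀ A {β} → β ∈ blocksOf A → ∑ (prods β) (λ _ → 1) ≡ ℓ ^ t
      block-size A {β} β∈ with ∈-blocksOf A β∈
      ... | m , len , refl = trans (sym (length-∑ (prods β))) (length-prods β (chunks-length t ℓ _ len))
      count : length family ≡ ∑ (tuples s) width * ℓ ^ t
      count = begin-equality
        length family
          ≡⟨ length-∑ family ⟩
        ∑ family (λ _ → 1)
          ≡⟨ ∑-family (λ _ → 1) ⟩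
        ∑ (tuples s) (λ A → ∑ (blocksOf A) (λ β → ∑ (prods β) (λ _ → 1)))
          ≡⟨ ∑-cong (tuples s) (λ A → ≤-antisym
               (∑-mono-∈ (blocksOf A) (λ β∈ → ≤-reflexive (block-size A β∈)))
               (∑-mono-∈ (blocksOf A) (λ β∈ → ≤-reflexive (sym (block-size A β∈))))) ⟩
        ∑ (tuples s) (λ A → ∑ (blocksOf A) (λ _ → ℓ ^ t))
          ≡⟨ ∑-cong (tuples s) (λ A → trans (∑-const (blocksOf A) (ℓ ^ t))
               (cong (_* ℓ ^ t) (length-blocks (width A) t ℓ (common A)))) ⟩
        ∑ (tuples s) (λ A → width A * ℓ ^ t)
          ≡⟨ ∑-*ʳ (tuples s) (ℓ ^ t) width ⟩
        ∑ (tuples s) width * ℓ ^ t ∎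

    -- Once a centre `y` is forced, `A` has to be drawn from the pieces of `y`, so a free column has
    -- `d` choices instead of `n`.
    family-rows : ∀ (Ps : Vec (Vec Bool s) t) Zs → 1 ≤ weight (Vec.concat Ps) →
      deg family (Vec.concat Ps) (Vec.concat Zs) ≤ ℓ ^ vacant Ps * d ^ free (mergeRows Ps Zs)
    family-rows Ps Zs h with copyCount-centre Ps Zs h
    ... | y , bound = begin
      deg family (Vec.concat Ps) (Vec.concat Zs)
        ≡⟨ ∑-family _ ⟩
      ∑ (tuples s) (λ A → ∑ (blocksOf A) (copyCount Ps Zs A))
        ≤⟨ ∑-mono (tuples s) (λ A → ∑-mono-∈ (blocksOf A) (λ {β} β∈ → bound A β (blocksOf-small A β∈))) ⟩
      ∑ (tuples s) (λ A → ∑ (blocksOf A) (λ β → ℓ ^ vacant Ps * (matched Ps Zs A * total β at-y)))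
        ≡⟨ ∑-cong (tuples s) (λ A → trans (∑-*ˡ (blocksOf A) (ℓ ^ vacant Ps) _)
             (cong (ℓ ^ vacant Ps *_) (∑-*ˡ (blocksOf A) (matched Ps Zs A) _))) ⟩
      ∑ (tuples s) (λ A → ℓ ^ vacant Ps * (matched Ps Zs A * ∑ (blocksOf A) (λ β → total β at-y)))
        ≡⟨ ∑-*ˡ (tuples s) (ℓ ^ vacant Ps) _ ⟩
      ℓ ^ vacant Ps * ∑ (tuples s) (λ A → matched Ps Zs A * ∑ (blocksOf A) (λ β → total β at-y))
        ≤⟨ *-monoʳ-≤ (ℓ ^ vacant Ps) (∑-mono (tuples s) (λ A → *-monoʳ-≤ (matched Ps Zs A) (at-y-blocks A))) ⟩
      ℓ ^ vacant Ps * ∑ (tuples s) (λ A → matched Ps Zs A * ⟦ inProd? (pieces y) A ⟧)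
        ≤⟨ *-monoʳ-≤ (ℓ ^ vacant Ps) (count-match (pieces y) (chunks-length≤ s d (nb y)) (mergeRows Ps Zs)) ⟩
      ℓ ^ vacant Ps * d ^ free (mergeRows Ps Zs) ∎
      where
      open ≤-Reasoning
      at-y : V → ℕ
      at-y b = ⟦ b Fin.≟ y ⟧
      at-y-blocks : ∀ A → ∑ (blocksOf A) (λ β → total β at-y) ≤ ⟦ inProd? (pieces y) A ⟧
      at-y-blocks A = begin
        ∑ (blocksOf A) (λ β → total β at-y)
          ≤⟨ blocks-total (width A) t ℓ (common A) at-y ⟩
        ∑ (common A) at-y
          ≡⟨ ∑-filter (λ b → inProd? (pieces b) A) B at-y ⟩
        ∑ B (λ b → ⟦ inProd? (pieces b) A ⟧ * at-y b)
          ≤⟨ ∑-mono B (λ b → ≤-trans (≤-reflexive (sym (⟦⟧-× (inProd? (pieces b) A) (b Fin.≟ y))))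
               (≤-trans (⟦⟧-mono (inProd? (pieces b) A ×-dec (b Fin.≟ y)) (inProd? (pieces y) A ×-dec (b Fin.≟ y))
                 (λ { (p , refl) → p , refl }))
               (≤-reflexive (⟦⟧-× (inProd? (pieces y) A) (b Fin.≟ y))))) ⟩
        ∑ B (λ b → ⟦ inProd? (pieces y) A ⟧ * at-y b)
          ≡⟨ ∑-*ˡ B ⟦ inProd? (pieces y) A ⟧ at-y ⟩
        ⟦ inProd? (pieces y) A ⟧ * ∑ B at-y
          ≤⟨ *-monoʳ-≤ ⟦ inProd? (pieces y) A ⟧ (∑-≟-unique Fin._≟_ B B-unique) ⟩
        ⟦ inProd? (pieces y) A ⟧ * 1
          ≡⟨ *-identityʳ _ ⟩
        ⟦ inProd? (pieces y) A ⟧ ∎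

    -- An arbitrary mask is reduced to four numbers: `u` columns and `j` rows met, `f` columns and
    -- `e` rows missed.
    family-degree : ∀ P Z → 1 ≤ weight P →
      Σ (ℕ × ℕ) λ (u , f) → Σ (ℕ × ℕ) λ (j , e) →
        u + f ≡ s × j + e ≡ t × weight P ≤ u * j × deg family P Z ≤ ℓ ^ e * d ^ f
    family-degree P Z h with Vec.group t s P | Vec.group t s Z
    ... | Ps , refl | Zs , refl =
      (used (mergeRows Ps Zs) , free (mergeRows Ps Zs)) , (occupied Ps , vacant Ps) ,
      used+free (mergeRows Ps Zs) , occupied+vacant Ps , weight≤used*occupied Ps Zs , family-rows Ps Zs h

    ∈-family : ∀ {C} → C ∈ family → Σ (Vec V s) λ A → Σ (Vec V t) λ bs →
      C ≡ edges A bs × Allᵛ (λ b → b ∈ B × InProd (pieces b) A) bs × Injective _≡_ _≡_ (lookup bs)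
    ∈-family {C} C∈ with find (∈-concatMap⁻ (λ A → concatMap (λ β → map (edges A) (prods β)) (blocksOf A)) {xs = tuples s} C∈)
    ... | A , _ , C∈A with find (∈-concatMap⁻ (λ β → map (edges A) (prods β)) {xs = blocksOf A} C∈A)
    ...   | β , β∈ , C∈β with ∈-map⁻ (edges A) C∈β | ∈-blocksOf A β∈
    ...     | bs , bs∈ , eq | m , _ , refl = A , bs , eq ,
              Allᵛ.map (λ b∈ → ∈-filter⁻ (λ b → inProd? (pieces b) A) (∈-drop m b∈)) (chunks-∈ t ℓ bs∈β) ,
              chunks-injective t ℓ (Unique.drop⁺ m (common-unique A)) bs∈β
              where
              bs∈β : InProd (chunks t ℓ (drop m (common A))) bs
              bs∈β = ∈-prods (chunks t ℓ (drop m (common A))) bs∈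

    family-entries : ∀ C → C ∈ family → Allᵛ (_∈ ground) C
    family-entries C C∈ with ∈-family C∈
    ... | A , bs , refl , inB , _ = go bs inB
      where
      row : ∀ {c b} (A : Vec V c) → b ∈ B → Allᵛ (_∈ nb b) A → Allᵛ (_∈ ground) (star b A)
      row []      b∈ []ᵛ       = []ᵛ
      row (a ∷ A) b∈ (p ∷ᵛ ps) = ∈-concatMap⁺ (λ b → map (b ,_) (nb b)) (lose b∈ (∈-map⁺ _ p)) ∷ᵛ row A b∈ ps
      go : ∀ {c} (bs : Vec V c) → Allᵛ (λ b → b ∈ B × InProd (pieces b) A) bs → Allᵛ (_∈ ground) (edges A bs)
      go []       []ᵛ              = []ᵛ
      go (b ∷ bs) ((b∈ , p) ∷ᵛ ps) = Allᵛ.++⁺ (row A b∈ (chunks-∈ s d p)) (go bs ps)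

    -- Distinctness within `A` is read off from the pieces of the first centre, and `1 ≤ t` provides
    -- that centre.
    family-copy : 1 ≤ t → ∀ C → C ∈ family → (I : E → Bool) → Allᵛ (λ e → I e ≡ true) C →
      Σ (Vec V s) λ A → Σ (Vec V t) λ bs → Injective _≡_ _≡_ (lookup A) × Injective _≡_ _≡_ (lookup bs) ×
        (∀ i j → I (lookup bs j , lookup A i) ≡ true)
    family-copy (s≤s z≤n) C C∈ I all with ∈-family C∈
    ... | A , bs@(_ ∷ _) , refl , (_ , p) ∷ᵛ _ , inj =
      A , bs , chunks-injective s d (nb-unique _) p , inj , λ i j → entry bs all j i
      where
      entry : ∀ {c} (bs : Vec V c) → Allᵛ (λ e → I e ≡ true) (edges A bs) →
        ∀ j i → I (lookup bs j , lookup A i) ≡ true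
      entry (b ∷ bs) all zero    i = subst (λ e → I e ≡ true) (Vec.lookup-map i (b ,_) A)
        (Allᵛ.lookup⁺ (proj₁ (Allᵛ.++⁻ (star b A) all)) i)
      entry (b ∷ bs) all (suc j) i = entry bs (proj₂ (Allᵛ.++⁻ (star b A) all)) j i

open CopyFamilies

-- Relations on [n] and their degrees

-- If atLeast x ≤ X / (2 x²) for all x > m, then above m ≤ X / (2 m), since ∑ 1/x² over x > m is at most 1/m.
module _ {A : Set} (xs : List A) (f : A → ℕ) where

  above : ℕ → ℕ
  above m = ∑ xs (λ x → f x ∸ m)

  atLeast : ℕ → ℕ
  atLeast m = ∑ xs (λ x → ⟦ m ≤? f x ⟧)

  above-suc : ∀ m → above m ≡ atLeast (suc m) + above (suc m)
  above-suc m = trans (∑-cong xs (λ x → pointwise (f x) (suc m ≤? f x))) (∑-+ xs _ _)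
    where
    pointwise : ∀ v (p? : Dec (suc m ≤ v)) → v ∸ m ≡ ⟦ p? ⟧ + (v ∸ suc m)
    pointwise v (yes p) = trans (∸-suc p) refl
      where
      ∸-suc : ∀ {v} → suc m ≤ v → v ∸ m ≡ suc (v ∸ suc m)
      ∸-suc {suc v} (s≤s q) = +-∸-assoc 1 q
    pointwise v (no ¬p) = trans (m≤n⇒m∸n≡0 (≤-pred (≰⇒> ¬p)))
      (sym (m≤n⇒m∸n≡0 (≤-trans (≤-pred (≰⇒> ¬p)) (n≤1+n m))))

  private
    telescope : ∀ m h a → suc m * (2 * (m * (h + a))) ≡ m * (2 * (suc m * a)) + m * (suc m * (2 * h))
    telescope = solve-∀
    absorb : ∀ m h → suc m * (suc m * (2 * h)) ≡ 2 * (h * (suc m * suc m))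
    absorb = solve-∀

  -- Induction downwards from `n`, where `above` vanishes, with `i = n - m`. The step rests on
  -- `1 / (m + 1) ^ 2 ≤ 1 / m - 1 / (m + 1)`.
  search-level : ∀ {n} X → (∀ x → f x ≤ n) → ∀ i m → m + i ≡ n →
    (Σ ℕ λ x → m < x × X < 2 * (atLeast x * (x * x))) ⊎ 2 * (m * above m) ≤ X
  search-level {n} X f≤n zero m eq = inj₂ (≤-trans (≤-reflexive (cong (2 *_)
    (trans (cong (m *_) empty) (*-zeroʳ m)))) z≤n)
    where
    empty : above m ≡ 0
    empty = trans (∑-cong xs (λ x → m≤n⇒m∸n≡0 (≤-trans (f≤n x) (≤-reflexive (trans (sym eq) (+-identityʳ m))))))
      (∑-zero xs)
  search-level {n} X f≤n (suc i) m eq with search-level X f≤n i (suc m) (trans (sym (+-suc m i)) eq)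
  ... | inj₁ (x , m<x , big) = inj₁ (x , ≤-trans (n≤1+n (suc m)) m<x , big)
  ... | inj₂ small with X <? 2 * (atLeast (suc m) * (suc m * suc m))
  ...   | yes big = inj₁ (suc m , ≤-refl , big)
  ...   | no ¬big = inj₂ (*-cancelˡ-≤ (suc m) (begin
    suc m * (2 * (m * above m))
      ≡⟨ cong (λ z → suc m * (2 * (m * z))) (above-suc m) ⟩
    suc m * (2 * (m * (atLeast (suc m) + above (suc m))))
      ≡⟨ telescope m (atLeast (suc m)) (above (suc m)) ⟩
    m * (2 * (suc m * above (suc m))) + m * (suc m * (2 * atLeast (suc m)))
      ≤⟨ +-mono-≤ (*-monoʳ-≤ m small) (≤-trans (*-monoˡ-≤ (suc m * (2 * atLeast (suc m))) (n≤1+n m))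
           (≤-trans (≤-reflexive (absorb m (atLeast (suc m)))) (≮⇒≥ ¬big))) ⟩
    m * X + X
      ≡⟨ +-comm (m * X) X ⟩
    suc m * X ∎))
    where open ≤-Reasoning

  private
    double : ∀ d t n → 2 * (d * (t + n * d)) ≡ 2 * (d * t) + d * (2 * n * d)
    double = solve-∀

  -- Values capped at `d₀` contribute at most `n * d₀`, hence at most half of the sum, so `above d₀`
  -- carries the other half. This excludes the second outcome of `search-level` for
  -- `X = d₀ * ∑ xs f - 1`.
  popular-level : ∀ {n d₀} → (∀ x → f x ≤ n) → length xs ≤ n → 1 ≤ d₀ → d₀ ≤ n → 1 ≤ ∑ xs f →
    2 * n * d₀ ≤ ∑ xs f → Σ ℕ λ x → d₀ < x × d₀ * ∑ xs f ≤ 2 * (atLeast x * (x * x))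
  popular-level {n} {d₀} f≤n len 1≤d₀ d₀≤n 1≤m few
    with search-level (pred (d₀ * ∑ xs f)) f≤n (n ∸ d₀) d₀ (m+[n∸m]≡n d₀≤n)
  ... | inj₁ (x , d₀<x , big) = x , d₀<x , ≤-trans (suc-pred≤ (d₀ * ∑ xs f)) big
    where
    suc-pred≤ : ∀ y → y ≤ suc (pred y)
    suc-pred≤ zero    = z≤n
    suc-pred≤ (suc y) = ≤-refl
  ... | inj₂ small = ⊥-elim (<-irrefl refl (begin-strict
    2 * (d₀ * m)
      ≤⟨ *-monoʳ-≤ 2 (*-monoʳ-≤ d₀ m≤) ⟩
    2 * (d₀ * (above d₀ + n * d₀))
      ≡⟨ double d₀ (above d₀) n ⟩
    2 * (d₀ * above d₀) + d₀ * (2 * n * d₀)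
      ≤⟨ +-mono-≤ small (*-monoʳ-≤ d₀ few) ⟩
    pred (d₀ * m) + d₀ * m
      <⟨ +-monoˡ-< (d₀ * m) (pred< (d₀ * m) (*-mono-≤ 1≤d₀ 1≤m)) ⟩
    d₀ * m + d₀ * m
      ≡⟨ cong (d₀ * m +_) (sym (+-identityʳ _)) ⟩
    2 * (d₀ * m) ∎))
    where
    open ≤-Reasoning
    m : ℕ
    m = ∑ xs f
    pred< : ∀ y → 1 ≤ y → pred y < y
    pred< (suc y) _ = ≤-refl
    m≤ : m ≤ above d₀ + n * d₀
    m≤ = begin
      ∑ xs f ≤⟨ ∑-mono xs (λ x → ≤-trans (m≤n+m∸n (f x) d₀) (≤-reflexive (+-comm d₀ _))) ⟩
      ∑ xs (λ x → (f x ∸ d₀) + d₀) ≡⟨ ∑-+ xs (λ x → f x ∸ d₀) (λ _ → d₀) ⟩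
      above d₀ + ∑ xs (λ _ → d₀) ≡⟨ cong (above d₀ +_) (∑-const xs d₀) ⟩
      above d₀ + length xs * d₀ ≤⟨ +-monoʳ-≤ (above d₀) (*-monoˡ-≤ d₀ len) ⟩
      above d₀ + n * d₀ ∎

-- A relation D is used as a container of ordered pairs; both orders of an edge are tracked independently.
module Digraphs {n : ℕ} where

  open Copies {n} public

  present? : (D : E → Bool) (x : E) → Dec (D x ≡ true)
  present? D x = D x Bool.≟ true

  nbrs : (E → Bool) → V → List V
  nbrs D b = filter (λ a → present? D (b , a)) (allFin n)

  size : (E → Bool) → ℕ
  size D = ∑ (allFin n) (λ b → length (nbrs D b))

  length-allFin : length (allFin n) ≡ n
  length-allFin = length-tabulate id

  degree≤n : ∀ D b → length (nbrs D b) ≤ n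
  degree≤n D b = ≤-trans (length-filter (λ a → present? D (b , a)) (allFin n)) (≤-reflexive length-allFin)

  size≤ : ∀ D → size D ≤ n * n
  size≤ D = ≤-trans (∑-≤-const (allFin n) n (λ {b} _ → degree≤n D b)) (≤-reflexive (cong (_* n) length-allFin))

  size-∑ : ∀ D → size D ≡ ∑ (allFin n) (λ b → ∑ (allFin n) (λ a → ⟦ present? D (b , a) ⟧))
  size-∑ D = ∑-cong (allFin n) (λ b → length-filter-∑ (λ a → present? D (b , a)) (allFin n))

  open DecMembership _≟ᴱ_ using () renaming (_∈?_ to _∈ᴱ?_)

  _∖_ : (E → Bool) → List E → E → Bool
  (D ∖ Y) x = D x ∧ not ⌊ x ∈ᴱ? Y ⌋

  size-∖ : ∀ D Y → Unique Y → All (λ x → D x ≡ true) Y → size (D ∖ Y) + length Y ≤ size D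
  size-∖ D Y u Y⊆D = begin
    size (D ∖ Y) + length Y
      ≤⟨ +-monoʳ-≤ (size (D ∖ Y)) length≤ ⟩
    size (D ∖ Y) + ∑ (allFin n) (λ b → ∑ (allFin n) (λ a → hits (b , a)))
      ≡⟨ cong (_+ ∑ (allFin n) (λ b → ∑ (allFin n) (λ a → hits (b , a)))) (size-∑ (D ∖ Y)) ⟩
    ∑ (allFin n) (λ b → ∑ (allFin n) (λ a → ⟦ present? (D ∖ Y) (b , a) ⟧)) +
    ∑ (allFin n) (λ b → ∑ (allFin n) (λ a → hits (b , a)))
      ≡⟨ sym (trans (∑-cong (allFin n) (λ b → ∑-+ (allFin n) _ _)) (∑-+ (allFin n) _ _)) ⟩
    ∑ (allFin n) (λ b → ∑ (allFin n) (λ a → ⟦ present? (D ∖ Y) (b , a) ⟧ + hits (b , a)))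
      ≤⟨ ∑-mono (allFin n) (λ b → ∑-mono (allFin n) (λ a → pointwise (b , a))) ⟩
    ∑ (allFin n) (λ b → ∑ (allFin n) (λ a → ⟦ present? D (b , a) ⟧))
      ≡⟨ sym (size-∑ D) ⟩
    size D ∎
    where
    open ≤-Reasoning
    hits : E → ℕ
    hits x = ∑ Y (λ y → ⟦ y ≟ᴱ x ⟧)
    length≤ : length Y ≤ ∑ (allFin n) (λ b → ∑ (allFin n) (λ a → hits (b , a)))
    length≤ = begin
      length Y
        ≡⟨ length-∑ Y ⟩
      ∑ Y (λ _ → 1)
        ≤⟨ ∑-mono Y (λ y → ≤-trans (≤-reflexive (sym (⟦⟧-yes (y ≟ᴱ y) refl)))
             (≤-trans (term≤∑ (λ a → ⟦ y ≟ᴱ (proj₁ y , a) ⟧) (∈-allFin (proj₂ y)))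
               (term≤∑ (λ b → ∑ (allFin n) (λ a → ⟦ y ≟ᴱ (b , a) ⟧)) (∈-allFin (proj₁ y))))) ⟩
      ∑ Y (λ y → ∑ (allFin n) (λ b → ∑ (allFin n) (λ a → ⟦ y ≟ᴱ (b , a) ⟧)))
        ≡⟨ ∑-swap Y (allFin n) _ ⟩
      ∑ (allFin n) (λ b → ∑ Y (λ y → ∑ (allFin n) (λ a → ⟦ y ≟ᴱ (b , a) ⟧)))
        ≡⟨ ∑-cong (allFin n) (λ b → ∑-swap Y (allFin n) _) ⟩
      ∑ (allFin n) (λ b → ∑ (allFin n) (λ a → hits (b , a))) ∎
    pointwise : ∀ x → ⟦ present? (D ∖ Y) x ⟧ + hits x ≤ ⟦ present? D x ⟧
    pointwise x = go (x ∈ᴱ? Y)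
      where
      go : (p? : Dec (x ∈ Y)) → ⟦ (D x ∧ not ⌊ p? ⌋) Bool.≟ true ⟧ + hits x ≤ ⟦ present? D x ⟧
      go (yes x∈) rewrite All.lookup Y⊆D x∈ = ∑-≟-unique _≟ᴱ_ Y u
      go (no x∉)  rewrite ∑-≟-∉ _≟ᴱ_ Y x∉ | Bool.∧-identityʳ (D x) = ≤-reflexive (+-identityʳ _)

  _⊑_ : (E → Bool) → (E → Bool) → Set
  H ⊑ D = ∀ x → H x ≡ true → D x ≡ true

  ⊑-∖ : ∀ {H D : E → Bool} Y → H ⊑ D → All (λ x → H x ≡ false) Y → H ⊑ (D ∖ Y)
  ⊑-∖ {H} {D} Y H⊑D av x Hx = go (x ∈ᴱ? Y)
    where
    go : (p? : Dec (x ∈ Y)) → D x ∧ not ⌊ p? ⌋ ≡ true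
    go (yes x∈) = contradiction (trans (sym Hx) (All.lookup av x∈)) λ ()
    go (no _)   = trans (Bool.∧-identityʳ (D x)) (H⊑D x Hx)

  pairs : Graph n → E → Bool
  pairs H (x , y) = adj H x y

-- One container step

1≤2^ : ∀ m → 1 ≤ 2 ^ m
1≤2^ m = ^-monoʳ-≤ 2 {0} {m} z≤n

-- Divided by u * v the right-hand side decreases in u and v, so (s , t) is the worst case.
bilinear-≤ : ∀ {s t u v} β x y → 1 ≤ s → 1 ≤ t → u ≤ s → v ≤ t →
  β * (s * t) ≤ s * x + t * y → β * (u * v) ≤ u * x + v * y
bilinear-≤ {s} {t} {u} {v} β x y 1≤s 1≤t u≤s v≤t h =
  *-cancelˡ-≤ (s * t) {{>-nonZero (*-mono-≤ 1≤s 1≤t)}} (begin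
    s * t * (β * (u * v))  ≡⟨ perm₁ s t β u v ⟩
    u * v * (β * (s * t))  ≤⟨ *-monoʳ-≤ (u * v) h ⟩
    u * v * (s * x + t * y)  ≡⟨ perm₂ s t u v x y ⟩
    s * (u * x) * v + t * (v * y) * u  ≤⟨ +-mono-≤ (*-monoʳ-≤ (s * (u * x)) v≤t) (*-monoʳ-≤ (t * (v * y)) u≤s) ⟩
    s * (u * x) * t + t * (v * y) * s  ≡⟨ perm₃ s t u v x y ⟩
    s * t * (u * x + v * y) ∎)
  where
  open ≤-Reasoning
  perm₁ : ∀ s t β u v → s * t * (β * (u * v)) ≡ u * v * (β * (s * t))
  perm₁ = solve-∀
  perm₂ : ∀ s t u v x y → u * v * (s * x + t * y) ≡ s * (u * x) * v + t * (v * y) * u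
  perm₂ = solve-∀
  perm₃ : ∀ s t u v x y → s * (u * x) * t + t * (v * y) * s ≡ s * t * (u * x + v * y)
  perm₃ = solve-∀

module Exponents {s t β δ lam q : ℕ} (1≤s : 1 ≤ s) (1≤t : 1 ≤ t) (β≤δ : β ≤ δ) (β≤lam : β ≤ lam)
  (balance : q + β * (s + t * suc s) ≡ s * δ + t * lam) where

  private
    split : ∀ u f v e β x y → lam ≡ β + y → δ ≡ β + x →
      β * (u * v) ≤ u * x + v * y →
      lam * e + δ * f + β * (suc u * suc v) ≤ (u + f) * δ + (v + e) * lam + β
    split u f v e β x y refl refl h = begin
      (β + y) * e + (β + x) * f + β * (suc u * suc v)
        ≡⟨ left u f v e β x y ⟩
      β * (u * v) + ((β + y) * e + (β + x) * f + β * (u + v) + β)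
        ≤⟨ +-monoˡ-≤ _ h ⟩
      u * x + v * y + ((β + y) * e + (β + x) * f + β * (u + v) + β)
        ≡⟨ right u f v e β x y ⟩
      (u + f) * (β + x) + (v + e) * (β + y) + β ∎
      where
      open ≤-Reasoning
      left : ∀ u f v e β x y → (β + y) * e + (β + x) * f + β * (suc u * suc v) ≡
        β * (u * v) + ((β + y) * e + (β + x) * f + β * (u + v) + β)
      left = solve-∀
      right : ∀ u f v e β x y → u * x + v * y + ((β + y) * e + (β + x) * f + β * (u + v) + β) ≡
        (u + f) * (β + x) + (v + e) * (β + y) + β
      right = solve-∀

    corner : ∀ β x y → δ ≡ β + x → lam ≡ β + y → q + β * (s + t * suc s) ≡ s * δ + t * lam →
      β * (s * t) ≤ s * x + t * y
    corner β x y refl refl eq = +-cancelʳ-≤ (β * s + β * t) _ _ (begin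
      β * (s * t) + (β * s + β * t)  ≤⟨ m≤n+m _ q ⟩
      q + (β * (s * t) + (β * s + β * t)) ≡⟨ cong (q +_) (left s t β) ⟩
      q + β * (s + t * suc s)  ≡⟨ eq ⟩
      s * (β + x) + t * (β + y)  ≡⟨ right s t β x y ⟩
      s * x + t * y + (β * s + β * t) ∎)
      where
      open ≤-Reasoning
      left : ∀ s t β → β * (s * t) + (β * s + β * t) ≡ β * (s + t * suc s)
      left = solve-∀
      right : ∀ s t β x y → s * (β + x) + t * (β + y) ≡ s * x + t * y + (β * s + β * t)
      right = solve-∀

  -- Only `w = u * v` matters. As `1 ≤ w`, both `u` and `v` are positive; after lowering each by one
  -- the claim becomes `β u v ≤ u (δ - β) + v (lam - β)`, whose corner `u = s`, `v = t` follows from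
  -- `balance`.
  exponent-≤ : ∀ {u f v e w} → u + f ≡ suc s → v + e ≡ suc t → 1 ≤ w → w ≤ u * v →
    lam * e + δ * f + β * w ≤ q + β * suc (s + t * suc s)
  exponent-≤ {zero}  {f} {v}     {e} {w} _    _    1≤w w≤ = ⊥-elim (n≮0 (≤-trans 1≤w w≤))
  exponent-≤ {suc u} {f} {zero}  {e} {w} _    _    1≤w w≤ =
    ⊥-elim (n≮0 (≤-trans 1≤w (≤-trans w≤ (≤-reflexive (*-zeroʳ u)))))
  exponent-≤ {suc u} {f} {suc v} {e} {w} refl refl 1≤w w≤ = begin
    lam * e + δ * f + β * w
      ≤⟨ +-monoʳ-≤ (lam * e + δ * f) (*-monoʳ-≤ β w≤) ⟩
    lam * e + δ * f + β * (suc u * suc v)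
      ≤⟨ split u f v e β (δ ∸ β) (lam ∸ β) (sym (m+[n∸m]≡n β≤lam)) (sym (m+[n∸m]≡n β≤δ))
           (bilinear-≤ β (δ ∸ β) (lam ∸ β) 1≤s 1≤t (m≤m+n u f) (m≤m+n v e)
             (corner β (δ ∸ β) (lam ∸ β) (sym (m+[n∸m]≡n β≤δ)) (sym (m+[n∸m]≡n β≤lam)) balance)) ⟩
    (u + f) * δ + (v + e) * lam + β
      ≡⟨ cong (_+ β) (sym balance) ⟩
    q + β * (s + t * suc s) + β
      ≡⟨ last q β (s + t * suc s) ⟩
    q + β * suc (s + t * suc s) ∎
    where
    open ≤-Reasoning
    last : ∀ q β r → q + β * r + β ≡ q + β * suc r
    last = solve-∀

-- The parts have sizes `suc s` and `suc t`, so `s + t * suc s` is one less than the number of edges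
-- of a copy. The exponent `γ` takes up the slack that makes `balance` an equation.
module Step {n : ℕ} (s t : ℕ) (1≤s : 1 ≤ s) (1≤t : 1 ≤ t)
  (δ lam β γ c₂ c a₀ S : ℕ)
  (D : Fin n × Fin n → Bool)
  (B : List (Fin n)) (B-unique : Unique B)
  (nb : Fin n → List (Fin n)) (nb-unique : ∀ b → Unique (nb b))
  (length-nb : ∀ {b} → b ∈ B → length (nb b) ≡ suc s * 2 ^ δ)
  (nb⊆D : ∀ b {a} → a ∈ nb b → D (b , a) ≡ true)
  (β≤δ : β ≤ δ) (β≤lam : β ≤ lam)
  (balance : c₂ + γ + β * (s + t * suc s) ≡ s * δ + t * lam)
  (c₂-large : 2 * (suc t * suc s) ≤ 2 ^ c₂)
  (dense : 2 * (suc t * 2 ^ lam) * n ^ suc s ≤ length B * (2 ^ δ) ^ suc s)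
  (b≡1+c : 2 ^ β ≡ suc c)
  (1≤n : 1 ≤ n)
  (S-large : 2 * (length B * (suc s * 2 ^ δ)) ≤ S * 2 ^ β)
  (a₀-small : 4 * (growth (s + t * suc s) * 2 ^ c₂ * a₀) ≤ length B * (suc s * 2 ^ δ))
  where

  open Digraphs {n}

  private
    d ℓ b G M r : ℕ
    d = 2 ^ δ
    ℓ = 2 ^ lam
    b = 2 ^ β
    G = 2 ^ γ
    M = length B * (suc s * d)
    r = s + t * suc s
    instance
      tℓ-nonZero : NonZero (suc t * ℓ)
      tℓ-nonZero = >-nonZero (*-mono-≤ {1} {suc t} (s≤s z≤n) (1≤2^ lam))

  open Family {n} (suc s) (suc t) d ℓ B B-unique nb nb-unique length-nb

  spread : Spread b (2 ^ c₂ * G) family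
  spread P Z 1≤P with family-degree P Z 1≤P
  ... | (u , f) , (v , e) , uf , ve , w≤ , deg≤ = begin
    deg family P Z * b ^ weight P
      ≤⟨ *-monoˡ-≤ (b ^ weight P) deg≤ ⟩
    (2 ^ lam) ^ e * (2 ^ δ) ^ f * (2 ^ β) ^ weight P
      ≡⟨ cong₂ _*_ (cong₂ _*_ (^-*-assoc 2 lam e) (^-*-assoc 2 δ f)) (^-*-assoc 2 β (weight P)) ⟩
    2 ^ (lam * e) * 2 ^ (δ * f) * 2 ^ (β * weight P)
      ≡⟨ sym (trans (^-distribˡ-+-* 2 (lam * e + δ * f) (β * weight P))
           (cong (_* 2 ^ (β * weight P)) (^-distribˡ-+-* 2 (lam * e) (δ * f)))) ⟩
    2 ^ (lam * e + δ * f + β * weight P)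
      ≤⟨ ^-monoʳ-≤ 2 (Exponents.exponent-≤ 1≤s 1≤t β≤δ β≤lam balance uf ve 1≤P w≤) ⟩
    2 ^ (c₂ + γ + β * suc r)
      ≡⟨ trans (^-distribˡ-+-* 2 (c₂ + γ) (β * suc r)) (cong₂ _*_ (^-distribˡ-+-* 2 c₂ γ) (sym (^-*-assoc 2 β (suc r)))) ⟩
    2 ^ c₂ * G * b ^ suc r ∎
    where open ≤-Reasoning

  private
    shape₂ : ∀ L t ℓ → 2 * (L * (t * ℓ)) ≡ 2 * t * L * ℓ
    shape₂ = solve-∀
    shape₃ : ∀ h d p q ℓ → h * (d * p) * (ℓ * q) ≡ h * d * (p * q) * ℓ
    shape₃ = solve-∀
    shape₄ : ∀ h s d p t → 2 * t * (h * (s * d) * p) ≡ h * d * (2 * (t * s) * p)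
    shape₄ = solve-∀
    shape₅ : ∀ N q p → 2 * (N * q * p) ≡ 2 * q * N * p
    shape₅ = solve-∀
    shape₆ : ∀ x y → 2 * (x + y) ≡ 2 * x + 2 * y
    shape₆ = solve-∀
    shape₇ : ∀ c g p → c * (p * g) ≡ c * g * p
    shape₇ = solve-∀

  -- By `dense` the rounding loss in `length-family` is at most half of the main term. `balance`
  -- rewrites `d ^ s * ℓ ^ t` as `2 ^ c₂ * (b ^ r * G)`, and `2 ^ c₂` absorbs the factor
  -- `2 * (suc t * suc s)`.
  length-family-≥ : M * (b ^ r * G) ≤ length family
  length-family-≥ = *-cancelˡ-≤ (2 * suc t) (begin
    2 * suc t * (M * (b ^ r * G))
      ≡⟨ shape₄ (length B) (suc s) d (b ^ r * G) (suc t) ⟩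
    length B * d * (2 * (suc t * suc s) * (b ^ r * G))
      ≤⟨ *-monoʳ-≤ (length B * d) (*-monoˡ-≤ (b ^ r * G) c₂-large) ⟩
    length B * d * (2 ^ c₂ * (b ^ r * G))
      ≡⟨ cong (length B * d *_) power ⟩
    length B * d * (d ^ s * ℓ ^ t)
      ≤⟨ *-cancelʳ-≤ _ _ ℓ {{>-nonZero (1≤2^ lam)}} main ⟩
    2 * suc t * length family ∎)
    where
    open ≤-Reasoning
    power : 2 ^ c₂ * (b ^ r * G) ≡ d ^ s * ℓ ^ t
    power = begin-equality
      2 ^ c₂ * (b ^ r * G)  ≡⟨ shape₇ (2 ^ c₂) G (b ^ r) ⟩
      2 ^ c₂ * G * b ^ r  ≡⟨ cong₂ _*_ (sym (^-distribˡ-+-* 2 c₂ γ)) (^-*-assoc 2 β r) ⟩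
      2 ^ (c₂ + γ) * 2 ^ (β * r)  ≡⟨ sym (^-distribˡ-+-* 2 (c₂ + γ) (β * r)) ⟩
      2 ^ (c₂ + γ + β * r)  ≡⟨ cong (2 ^_) (trans balance (cong₂ _+_ (*-comm s δ) (*-comm t lam))) ⟩
      2 ^ (δ * s + lam * t)  ≡⟨ ^-distribˡ-+-* 2 (δ * s) (lam * t) ⟩
      2 ^ (δ * s) * 2 ^ (lam * t)  ≡⟨ cong₂ _*_ (sym (^-*-assoc 2 δ s)) (sym (^-*-assoc 2 lam t)) ⟩
      d ^ s * ℓ ^ t ∎
    main : length B * d * (d ^ s * ℓ ^ t) * ℓ ≤ 2 * suc t * length family * ℓ
    main = +-cancelʳ-≤ X _ _ (begin
      length B * d * (d ^ s * ℓ ^ t) * ℓ + X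
        ≡⟨ cong (_+ X) (sym (shape₃ (length B) d (d ^ s) (ℓ ^ t) ℓ)) ⟩
      X + X
        ≡⟨ cong (X +_) (sym (+-identityʳ X)) ⟩
      2 * X
        ≤⟨ *-monoʳ-≤ 2 length-family ⟩
      2 * (length family * (suc t * ℓ) + n ^ suc s * (suc t * ℓ) * ℓ ^ suc t)
        ≡⟨ shape₆ (length family * (suc t * ℓ)) _ ⟩
      2 * (length family * (suc t * ℓ)) + 2 * (n ^ suc s * (suc t * ℓ) * ℓ ^ suc t)
        ≡⟨ cong₂ _+_ (shape₂ (length family) (suc t) ℓ) (shape₅ (n ^ suc s) (suc t * ℓ) (ℓ ^ suc t)) ⟩
      2 * suc t * length family * ℓ + 2 * (suc t * ℓ) * n ^ suc s * ℓ ^ suc t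
        ≤⟨ +-monoʳ-≤ (2 * suc t * length family * ℓ) (*-monoˡ-≤ (ℓ ^ suc t) dense) ⟩
      2 * suc t * length family * ℓ + X ∎)
      where
      X : ℕ
      X = length B * d ^ suc s * ℓ ^ suc t

  1≤B : 1 ≤ length B
  1≤B = positive (length B) dense
    where
    open ≤-Reasoning
    positive : ∀ h → 2 * (suc t * ℓ) * n ^ suc s ≤ h * d ^ suc s → 1 ≤ h
    positive (suc h) _ = s≤s z≤n
    positive zero    p = ⊥-elim (n≮0 (≤-trans
      (*-mono-≤ (*-mono-≤ {1} {2} (s≤s z≤n) (*-mono-≤ {1} {suc t} (s≤s z≤n) (1≤2^ lam)))
        (≤-trans (≤-reflexive (sym (^-zeroˡ (suc s)))) (^-monoˡ-≤ (suc s) 1≤n))) p))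

  1≤M : 1 ≤ M
  1≤M = *-mono-≤ 1≤B (*-mono-≤ {1} {suc s} (s≤s z≤n) (1≤2^ δ))

  ground⊆D : ∀ {x} → x ∈ ground → D x ≡ true
  ground⊆D x∈ with find (∈-concatMap⁻ (λ b → map (b ,_) (nb b)) {xs = B} x∈)
  ... | b , _ , x∈b with ∈-map⁻ (b ,_) x∈b
  ...   | a , a∈ , refl = nb⊆D b a∈

  Result : Set
  Result = Σ (List (E → Bool)) λ 𝒟 →
    (length 𝒟 * c ^ a₀ ≤ b ^ (a₀ + r * S)) ×
    All (λ D′ → size D′ + a₀ ≤ size D) 𝒟 ×
    (∀ H → KFree (suc s) (suc t) H → pairs H ⊑ D → Any (pairs H ⊑_) 𝒟)

  private
    1≤G : 1 ≤ G
    1≤G = 1≤2^ γ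

    vertex : ∀ {m} → 1 ≤ m → Fin m
    vertex (s≤s _) = zero

  step : Result
  step = finish (Container.covers _≟ᴱ_ (vertex 1≤n , vertex 1≤n) b c M G a₀ S b≡1+c 1≤M 1≤G S-large ground
      (≤-reflexive length-ground) r (2 ^ c₂ * G) (*-mono-≤ (1≤2^ c₂) 1≤G) small family spread length-family-≥ family-entries
      a₀ [] refl [] [])
    where
    small : 4 * (growth r * (2 ^ c₂ * G) * a₀) ≤ M * G
    small = ≤-trans (≤-reflexive (perm (growth r) (2 ^ c₂) G a₀)) (*-monoˡ-≤ G a₀-small)
      where
      perm : ∀ g p q a → 4 * (g * (p * q) * a) ≡ 4 * (g * p * a) * q
      perm = solve-∀
    finish : (Σ (List (List E)) λ 𝒴 →
        (length 𝒴 * c ^ a₀ ≤ b ^ (a₀ + r * S)) ×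
        All (λ Y → length Y ≡ a₀ × Unique Y × All (_∈ ground) Y) 𝒴 ×
        (∀ I → Independent I family → Avoids I [] → Any (Avoids I) 𝒴)) → Result
    finish (𝒴 , len , 𝒴-ok , cov) = map (D ∖_) 𝒴 ,
      subst (λ z → z * c ^ a₀ ≤ b ^ (a₀ + r * S)) (sym (length-map (D ∖_) 𝒴)) len ,
      All.map⁺ (All.map (λ { {Y} (lenY , u , Y⊆) → subst (λ z → size (D ∖ Y) + z ≤ size D) lenY
        (size-∖ D Y u (All.map ground⊆D Y⊆)) }) 𝒴-ok) ,
      λ H free H⊑D → Any.map⁺ (Any.map (λ {Y} → ⊑-∖ {pairs H} {D} Y H⊑D) (cov (pairs H) (independent H free) []))
      where
      independent : ∀ H → KFree (suc s) (suc t) H → Independent (pairs H) family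
      independent H free C C∈ all with family-copy (s≤s z≤n) C C∈ (pairs H) all
      ... | A , bs , A-inj , bs-inj , present = free (lookup A , lookup bs , (λ {i} {j} → A-inj {i} {j}) ,
        (λ {i} {j} → bs-inj {i} {j}) , apart , edge)
        where
        edge : ∀ i j → adj H (lookup A i) (lookup bs j) ≡ true
        edge i j = trans (Defs.sym H _ _) (present i j)
        apart : ∀ i j → lookup A i ≢ lookup bs j
        apart i j eq = contradiction
          (trans (sym (edge i j)) (trans (cong (λ v → adj H v (lookup bs j)) eq) (irref H _))) λ ()

-- The parameters of a step

m<2^m : ∀ m → m < 2 ^ m
m<2^m zero    = s≤s z≤n
m<2^m (suc m) = begin-strict
  suc m  ≤⟨ m<2^m m ⟩
  2 ^ m  <⟨ m<m+n (2 ^ m) (≤-trans (1≤2^ m) (m≤m+n _ 0)) ⟩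
  2 ^ suc m       ∎
  where open ≤-Reasoning

2^-cancel-≤ : ∀ {a b} → 2 ^ a ≤ 2 ^ b → a ≤ b
2^-cancel-≤ {a} {b} h with a ≤? b
... | yes a≤b = a≤b
... | no a≰b  = contradiction (^-monoʳ-< 2 (s≤s (s≤s z≤n)) (≰⇒> a≰b)) (≤⇒≯ h)

^-cancel-≤ : ∀ {x y} m → x ^ suc m ≤ y ^ suc m → x ≤ y
^-cancel-≤ {x} {y} m h with x ≤? y
... | yes x≤y = x≤y
... | no x≰y  = contradiction (^-monoˡ-< (suc m) (≰⇒> x≰y)) (≤⇒≯ h)

^-distribʳ-* : ∀ x y m → (x * y) ^ m ≡ x ^ m * y ^ m
^-distribʳ-* x y zero    = refl
^-distribʳ-* x y (suc m) = trans (cong (x * y *_) (^-distribʳ-* x y m)) (interchange x y (x ^ m) (y ^ m))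
  where
  interchange : ∀ x y p q → x * y * (p * q) ≡ x * p * (y * q)
  interchange = solve-∀

log₂ : ∀ q → 1 ≤ q → Σ ℕ λ m → 2 ^ m ≤ q × q < 2 ^ suc m
log₂ (suc zero)    _ = 0 , ≤-refl , ≤-refl
log₂ (suc (suc q)) _ with log₂ (suc q) (s≤s z≤n)
... | m , lo , hi with suc (suc q) <? 2 ^ suc m
...   | yes lt = m , ≤-trans lo (n≤1+n _) , lt
...   | no ¬lt = suc m , ≮⇒≥ ¬lt , (begin-strict
          suc (suc q)  ≤⟨ hi ⟩
          2 ^ suc m  <⟨ ^-monoʳ-< 2 (s≤s (s≤s z≤n)) (n<1+n (suc m)) ⟩
          2 ^ suc (suc m)         ∎)
  where open ≤-Reasoning

floor-≤ : ∀ m n .{{_ : NonZero n}} → n * (m / n) ≤ m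
floor-≤ m n = ≤-trans (≤-reflexive (*-comm n (m / n))) (m/n*n≤m m n)

floor-> : ∀ m n .{{_ : NonZero n}} → m < n * suc (m / n)
floor-> m n = begin-strict
  m  ≡⟨ m≡m%n+[m/n]*n m n ⟩
  _ + (m / n) * n  <⟨ +-monoˡ-< _ (m%n<n m n) ⟩
  n + (m / n) * n  ≡⟨ *-comm (suc (m / n)) n ⟩
  n * suc (m / n)       ∎
  where open ≤-Reasoning

floor-≥ : ∀ {m n k} .{{_ : NonZero n}} → n * k ≤ m → k ≤ m / n
floor-≥ {m} {n} {k} h = ≤-pred (*-cancelˡ-< n k (suc (m / n)) (≤-<-trans h (floor-> m n)))

-- Multiplied by b to avoid the exponent h ∸ 1 of the mean value estimate b ^ h - c ^ h ≤ h * b ^ (h ∸ 1).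
mean-value : ∀ c h → suc c * suc c ^ h ≤ suc c * c ^ h + h * suc c ^ h
mean-value c zero    = m≤m+n _ 0
mean-value c (suc h) = begin
  b * (b * b ^ h)  ≤⟨ *-monoʳ-≤ b (mean-value c h) ⟩
  b * (b * c ^ h + h * b ^ h)  ≡⟨ expand c h (c ^ h) (b ^ h) ⟩
  b * (c * c ^ h) + (b * c ^ h + h * (b * b ^ h))
    ≤⟨ +-monoʳ-≤ (b * (c * c ^ h)) (+-monoˡ-≤ (h * (b * b ^ h)) (*-monoʳ-≤ b (^-monoˡ-≤ h (n≤1+n c)))) ⟩
  b * (c * c ^ h) + suc h * (b * b ^ h) ∎
  where
  open ≤-Reasoning
  b : ℕ
  b = suc c
  expand : ∀ c h p q → suc c * (suc c * p + h * q) ≡ suc c * (c * p) + (suc c * p + h * (suc c * q))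
  expand = solve-∀

-- This is `(1 + 1 / c) ^ (b / 2) ≤ 2` for `b = suc c`: every `b / 2` excluded elements cost one
-- bit.
pow-halve : ∀ c h → 2 * h ≡ suc c → 1 ≤ h → suc c ^ h ≤ 2 * c ^ h
pow-halve c h eq 1≤h = *-cancelˡ-≤ h {{>-nonZero 1≤h}} (+-cancelʳ-≤ (h * suc c ^ h) _ _ (begin
  h * suc c ^ h + h * suc c ^ h  ≡⟨ double h (suc c ^ h) ⟩
  2 * h * suc c ^ h  ≡⟨ cong (_* suc c ^ h) eq ⟩
  suc c * suc c ^ h  ≤⟨ mean-value c h ⟩
  suc c * c ^ h + h * suc c ^ h  ≡⟨ cong (λ z → z * c ^ h + h * suc c ^ h) (sym eq) ⟩
  2 * h * c ^ h + h * suc c ^ h  ≡⟨ cong (_+ h * suc c ^ h) (swap h (c ^ h)) ⟩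
  h * (2 * c ^ h) + h * suc c ^ h ∎))
  where
  open ≤-Reasoning
  double : ∀ h p → h * p + h * p ≡ 2 * h * p
  double = solve-∀
  swap : ∀ h p → 2 * h * p ≡ h * (2 * p)
  swap = solve-∀

-- The exponent `a` is padded to the multiple `h * Q`, after which `pow-halve` is used `Q` times.
-- The case `c = 0` is ruled out by parity.
count-bound : ∀ {L c h a e Q} → 2 * h ≡ suc c → 1 ≤ h → a ≤ h * Q →
  L * c ^ a ≤ suc c ^ (a + e) → L ≤ 2 ^ Q * suc c ^ e
count-bound {L} {zero} {suc h} {a} {e} {Q} eq 1≤h = contradiction (trans (sym (+-suc (suc h) (h + 0))) eq) λ ()
count-bound {L} {suc c′} {h} {a} {e} {Q} eq 1≤h a≤ bound =
  *-cancelʳ-≤ _ _ (c ^ a) {{m^n≢0 c a}} (*-cancelʳ-≤ _ _ (c ^ z) {{m^n≢0 c z}} (begin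
    L * c ^ a * c ^ z
      ≤⟨ *-mono-≤ bound (^-monoˡ-≤ z (n≤1+n c)) ⟩
    b ^ (a + e) * b ^ z
      ≡⟨ cong (_* b ^ z) (^-distribˡ-+-* b a e) ⟩
    b ^ a * b ^ e * b ^ z
      ≡⟨ perm₁ (b ^ a) (b ^ e) (b ^ z) ⟩
    b ^ a * b ^ z * b ^ e
      ≡⟨ cong (_* b ^ e) (trans (sym (^-distribˡ-+-* b a z)) (trans (cong (b ^_) a+z) (sym (^-*-assoc b h Q)))) ⟩
    (b ^ h) ^ Q * b ^ e
      ≤⟨ *-monoˡ-≤ (b ^ e) (^-monoˡ-≤ Q (pow-halve c h eq 1≤h)) ⟩
    (2 * c ^ h) ^ Q * b ^ e
      ≡⟨ cong (_* b ^ e) (trans (^-distribʳ-* 2 (c ^ h) Q) (cong (2 ^ Q *_)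
           (trans (^-*-assoc c h Q) (trans (cong (c ^_) (sym a+z)) (^-distribˡ-+-* c a z))))) ⟩
    2 ^ Q * (c ^ a * c ^ z) * b ^ e
      ≡⟨ perm₂ (2 ^ Q) (c ^ a) (c ^ z) (b ^ e) ⟩
    2 ^ Q * b ^ e * c ^ a * c ^ z ∎))
  where
  open ≤-Reasoning
  c b z : ℕ
  c = suc c′
  b = suc c
  z = h * Q ∸ a
  a+z : a + z ≡ h * Q
  a+z = m+[n∸m]≡n a≤
  perm₁ : ∀ a e z → a * e * z ≡ a * z * e
  perm₁ = solve-∀
  perm₂ : ∀ q a z e → q * (a * z) * e ≡ q * e * a * z
  perm₂ = solve-∀

-- About `2 a / b` bits go to the exclusions and `2 β r M / b` to the answers "yes", and `M` is at
-- most `2 p a`. The rounding terms are absorbed by `b ≤ M`.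
cost-bound : ∀ {b h Q β r S M a p} → b ≡ 2 * h → h * Q ≤ a + h → S * b ≤ 2 * M + b → b ≤ M → M ≤ 2 * (p * a) →
  1 ≤ β → b * (Q + β * (r * S)) ≤ (2 + (2 + 6 * r) * p) * (β * a)
cost-bound {b} {h} {Q} {β} {r} {S} {M} {a} {p} refl hQ hS b≤M M≤ 1≤β = begin
  b * (Q + β * (r * S))
    ≡⟨ split h Q β r S ⟩
  2 * (h * Q) + β * r * (S * b)
    ≤⟨ +-mono-≤ (*-monoʳ-≤ 2 hQ) (*-monoʳ-≤ (β * r) (≤-trans hS (+-monoʳ-≤ (2 * M) b≤M))) ⟩
  2 * (a + h) + β * r * (2 * M + M)
    ≡⟨ regroup a h β r M ⟩
  2 * a + b + 3 * β * r * M
    ≤⟨ +-mono-≤ (+-monoʳ-≤ (2 * a) (≤-trans b≤M M≤)) (*-monoʳ-≤ (3 * β * r) M≤) ⟩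
  2 * a + 2 * (p * a) + 3 * β * r * (2 * (p * a))
    ≡⟨ collect a p β r ⟩
  (2 + 2 * p) * (1 * a) + 6 * r * p * (β * a)
    ≤⟨ +-monoˡ-≤ _ (*-monoʳ-≤ (2 + 2 * p) (*-monoˡ-≤ a 1≤β)) ⟩
  (2 + 2 * p) * (β * a) + 6 * r * p * (β * a)
    ≡⟨ finish (β * a) p r ⟩
  (2 + (2 + 6 * r) * p) * (β * a) ∎
  where
  open ≤-Reasoning
  split : ∀ h Q β r S → 2 * h * (Q + β * (r * S)) ≡ 2 * (h * Q) + β * r * (S * (2 * h))
  split = solve-∀
  regroup : ∀ a h β r M → 2 * (a + h) + β * r * (2 * M + M) ≡ 2 * a + 2 * h + 3 * β * r * M
  regroup = solve-∀
  collect : ∀ a p β r → 2 * a + 2 * (p * a) + 3 * β * r * (2 * (p * a)) ≡ (2 + 2 * p) * (1 * a) + 6 * r * p * (β * a)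
  collect = solve-∀
  finish : ∀ x p r → (2 + 2 * p) * x + 6 * r * p * x ≡ (2 + (2 + 6 * r) * p) * x
  finish = solve-∀

-- n ^ (2 - 1/s) is represented by a number N with n ^ (2 s - 1) ≤ (2 N) ^ s, where s = 2 + s₂.
module Density (s₂ : ℕ) where

  private
    s s′ : ℕ
    s′ = suc s₂
    s = suc s′

  C₀ : ℕ
  C₀ = 2 ^ s * (8 * 2 ^ s₂)

  power-≤ : ∀ {n N K m} → n ^ (s + s′) ≤ (2 * N) ^ s → K * N ≤ m → K ^ s * (n ^ s′ * n ^ s) ≤ (2 * m) ^ s
  power-≤ {n} {N} {K} {m} hN hm = begin
    K ^ s * (n ^ s′ * n ^ s)  ≡⟨ cong (K ^ s *_) (trans (*-comm (n ^ s′) (n ^ s)) (sym (^-distribˡ-+-* n s s′))) ⟩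
    K ^ s * n ^ (s + s′)  ≤⟨ *-monoʳ-≤ (K ^ s) hN ⟩
    K ^ s * (2 * N) ^ s  ≡⟨ sym (^-distribʳ-* K (2 * N) s) ⟩
    (K * (2 * N)) ^ s  ≡⟨ cong (_^ s) (swap K N) ⟩
    (2 * (K * N)) ^ s  ≤⟨ ^-monoˡ-≤ s (*-monoʳ-≤ 2 hm) ⟩
    (2 * m) ^ s ∎
    where
    open ≤-Reasoning
    swap : ∀ K N → K * (2 * N) ≡ 2 * (K * N)
    swap = solve-∀

  -- Of the `s` factors `m`, two are bounded together by `m * m ≤ 8 * n * (h * (x * x))`, the
  -- remaining `s₂` by `m ≤ 2 * n * x`. The result says that s-tuples have on average at least a
  -- constant times `K ^ s` common centres.
  density : ∀ {n N K m h x d₀} → 1 ≤ n → n ^ (s + s′) ≤ (2 * N) ^ s → K * N ≤ m →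
    m ≤ 2 * n * x → m ≤ 4 * n * d₀ → d₀ * m ≤ 2 * (h * (x * x)) → K ^ s * n ^ s ≤ C₀ * (h * x ^ s)
  density {n} {N} {K} {m} {h} {x} {d₀} 1≤n hN hm m≤x m≤d₀ big =
    *-cancelˡ-≤ (n ^ s′) {{>-nonZero (≤-trans (≤-reflexive (sym (^-zeroˡ s′))) (^-monoˡ-≤ s′ 1≤n))}} (begin
      n ^ s′ * (K ^ s * n ^ s)
        ≡⟨ perm₁ (n ^ s′) (K ^ s) (n ^ s) ⟩
      K ^ s * (n ^ s′ * n ^ s)
        ≤⟨ power-≤ {n} {N} {K} hN hm ⟩
      (2 * m) ^ s
        ≡⟨ ^-distribʳ-* 2 m s ⟩
      2 ^ s * (m * (m * m ^ s₂))
        ≡⟨ cong (2 ^ s *_) (sym (*-assoc m m (m ^ s₂))) ⟩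
      2 ^ s * (m * m * m ^ s₂)
        ≤⟨ *-monoʳ-≤ (2 ^ s) (*-mono-≤ square (^-monoˡ-≤ s₂ m≤x)) ⟩
      2 ^ s * (8 * n * (h * (x * x)) * (2 * n * x) ^ s₂)
        ≡⟨ cong (λ z → 2 ^ s * (8 * n * (h * (x * x)) * z))
             (trans (^-distribʳ-* (2 * n) x s₂) (cong (_* x ^ s₂) (^-distribʳ-* 2 n s₂))) ⟩
      2 ^ s * (8 * n * (h * (x * x)) * (2 ^ s₂ * n ^ s₂ * x ^ s₂))
        ≡⟨ perm₂ (2 ^ s) n h x (2 ^ s₂) (n ^ s₂) (x ^ s₂) ⟩
      n ^ s′ * (C₀ * (h * x ^ s)) ∎)
    where
    open ≤-Reasoning
    perm₁ : ∀ a b c → a * (b * c) ≡ b * (a * c)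
    perm₁ = solve-∀
    perm₂ : ∀ p n h x q u v → p * (8 * n * (h * (x * x)) * (q * u * v)) ≡ n * u * (p * (8 * q) * (h * (x * (x * v))))
    perm₂ = solve-∀
    perm₃ : ∀ n d m → 4 * n * d * m ≡ 4 * n * (d * m)
    perm₃ = solve-∀
    perm₄ : ∀ n y → 4 * n * (2 * y) ≡ 8 * n * y
    perm₄ = solve-∀
    square : m * m ≤ 8 * n * (h * (x * x))
    square = begin
      m * m  ≤⟨ *-monoˡ-≤ m m≤d₀ ⟩
      4 * n * d₀ * m  ≡⟨ perm₃ n d₀ m ⟩
      4 * n * (d₀ * m)  ≤⟨ *-monoʳ-≤ (4 * n) big ⟩
      4 * n * (2 * (h * (x * x)))  ≡⟨ perm₄ n (h * (x * x)) ⟩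
      8 * n * (h * (x * x)) ∎

  half-≤ : ∀ {n N} → 1 ≤ n → n ^ (s + s′) ≤ (2 * N) ^ s → n ≤ 2 * N
  half-≤ {n} {N} 1≤n hN = ^-cancel-≤ s′ (≤-trans (^-monoʳ-≤ n {{>-nonZero 1≤n}} (m≤m+n s s′)) hN)

module Constants (s₂ t₁ : ℕ) where

  open Density s₂ using (C₀)

  -- `r = s t - 1`. `C₁` shortens the blocks to fit the density, `c₂` covers the constant loss in
  -- the size of the family, `2 ^ c₃` is the ratio of trimmed pairs to lost pairs, `c₅` covers the
  -- passage from `m` to the trimmed degree, and `C₄` is the price constant of `cost-bound`. `β`
  -- gives up all of `c`.
  s′ s t′ t r C₁ c₂ c₃ c₅ c C₄ : ℕ
  s′ = suc s₂
  s  = suc s′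
  t′ = suc t₁
  t  = suc t′
  r  = s′ + t′ * suc s′
  C₁ = 2 * t * (C₀ * (2 * s) ^ s)
  c₂ = 2 * (t * s)
  c₃ = 4 * (growth r * 2 ^ c₂)
  c₅ = 8 * s
  c  = C₁ + c₂ + c₅
  C₄ = 2 + (2 + 6 * r) * 2 ^ c₃

  -- n ^ (2 - 1/s) ≈ N, and 2 ^ κ∞ is the largest scale at which all st edges of a copy are found.
  record Setting (n N κ∞ : ℕ) : Set where
    field
      1≤n : 1 ≤ n
      N-large : n ^ (s + s′) ≤ (2 * N) ^ s
      κ∞-small : 2 ^ (κ∞ * r * s) ≤ n ^ s′

module Phase (s₂ t₁ : ℕ) where

  open Density s₂
  open Constants s₂ t₁

  module Choice {n N κ∞} (setting : Setting n N κ∞) {κ μ β}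
    (μ≤κ : μ ≤ κ) (μ≤κ∞ : μ ≤ κ∞) (c≤κ : c ≤ κ) (β-def : β + c ≡ κ + s′ * μ)
    where

    open Setting setting
    open ≤-Reasoning

    -- Up to a constant, `2 ^ (s * κ)` is a lower bound for the average common neighbourhood of an
    -- s-tuple; `C₁` makes the blocks a small fraction of it.
    lam : ℕ
    lam = s * κ ∸ C₁

    C₁≤c : C₁ ≤ c
    C₁≤c = ≤-trans (m≤m+n C₁ c₂) (m≤m+n (C₁ + c₂) c₅)

    c₅≤c : c₅ ≤ c
    c₅≤c = m≤n+m c₅ (C₁ + c₂)

    lam-def : lam + C₁ ≡ s * κ
    lam-def = m∸n+n≡m (≤-trans C₁≤c (≤-trans c≤κ (m≤m+n κ (s′ * κ))))

    β≤lam : β ≤ lam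
    β≤lam = +-cancelʳ-≤ c β lam (begin
      β + c ≡⟨ β-def ⟩
      κ + s′ * μ ≤⟨ +-monoʳ-≤ κ (*-monoʳ-≤ s′ μ≤κ) ⟩
      s * κ ≡⟨ sym lam-def ⟩
      lam + C₁ ≤⟨ +-monoʳ-≤ lam C₁≤c ⟩
      lam + c ∎)

    module _ {δ} (δ-large : κ + κ∞ * r ≤ c₅ + δ) where

      β≤δ : β ≤ δ
      β≤δ = +-cancelʳ-≤ c β δ (begin
        β + c ≡⟨ β-def ⟩
        κ + s′ * μ ≤⟨ +-monoʳ-≤ κ (≤-trans (≤-reflexive (*-comm s′ μ)) (*-mono-≤ μ≤κ∞ (m≤m+n s′ (t′ * suc s′)))) ⟩
        κ + κ∞ * r ≤⟨ δ-large ⟩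
        c₅ + δ ≤⟨ +-monoˡ-≤ δ c₅≤c ⟩
        c + δ ≡⟨ +-comm c δ ⟩
        δ + c ∎)

      -- At `μ = κ∞` and up to constants this is `r (κ + s′ κ∞) = s′ (κ + κ∞ r) + t′ s κ`, an
      -- identity because `r = s′ + t′ s`. It is what fixes the size of `κ∞`.
      balance-≤ : c₂ + β * r ≤ s′ * δ + t′ * lam
      balance-≤ = +-cancelʳ-≤ (s′ * c₅ + t′ * C₁) _ _ (begin
        c₂ + β * r + (s′ * c₅ + t′ * C₁)
          ≤⟨ +-monoʳ-≤ (c₂ + β * r) (+-mono-≤ (*-monoˡ-≤ c₅ s′≤r) (*-monoˡ-≤ C₁ t′≤r)) ⟩
        c₂ + β * r + (r * c₅ + r * C₁)
          ≤⟨ +-monoˡ-≤ _ (+-monoˡ-≤ (β * r) (≤-trans (≤-reflexive (sym (*-identityˡ c₂))) (*-monoˡ-≤ c₂ 1≤r))) ⟩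
        r * c₂ + β * r + (r * c₅ + r * C₁)
          ≡⟨ collect r C₁ c₂ c₅ β ⟩
        r * (β + (C₁ + c₂ + c₅))
          ≡⟨ cong (r *_) β-def ⟩
        r * (κ + s′ * μ)
          ≤⟨ *-monoʳ-≤ r (+-monoʳ-≤ κ (*-monoʳ-≤ s′ μ≤κ∞)) ⟩
        r * (κ + s′ * κ∞)
          ≡⟨ expand s₂ t₁ κ κ∞ ⟩
        s′ * (κ + κ∞ * r) + t′ * (s * κ)
          ≤⟨ +-mono-≤ (*-monoʳ-≤ s′ δ-large) (≤-reflexive (cong (t′ *_) (sym lam-def))) ⟩
        s′ * (c₅ + δ) + t′ * (lam + C₁)
          ≡⟨ regroup s′ t′ c₅ δ lam C₁ ⟩
        s′ * δ + t′ * lam + (s′ * c₅ + t′ * C₁) ∎)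
        where
        s′≤r : s′ ≤ r
        s′≤r = m≤m+n s′ (t′ * suc s′)
        t′≤r : t′ ≤ r
        t′≤r = ≤-trans (≤-reflexive (sym (*-identityʳ t′))) (≤-trans (*-monoʳ-≤ t′ (s≤s z≤n)) (m≤n+m (t′ * suc s′) s′))
        1≤r : 1 ≤ r
        1≤r = s≤s z≤n
        collect : ∀ r C c₂ c₅ β → r * c₂ + β * r + (r * c₅ + r * C) ≡ r * (β + (C + c₂ + c₅))
        collect = solve-∀
        expand : ∀ s₂ t₁ κ κ∞ → (suc s₂ + suc t₁ * suc (suc s₂)) * (κ + suc s₂ * κ∞) ≡
          suc s₂ * (κ + κ∞ * (suc s₂ + suc t₁ * suc (suc s₂))) + suc t₁ * (suc (suc s₂) * κ)
        expand = solve-∀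
        regroup : ∀ s t c δ l C → s * (c + δ) + t * (l + C) ≡ s * δ + t * l + (s * c + t * C)
        regroup = solve-∀

      γ : ℕ
      γ = s′ * δ + t′ * lam ∸ (c₂ + β * r)

      balance : c₂ + γ + β * r ≡ s′ * δ + t′ * lam
      balance = trans (trans (cong (_+ β * r) (+-comm c₂ γ)) (+-assoc γ c₂ (β * r))) (m∸n+n≡m balance-≤)

    dense-enough : ∀ {h x d} → (2 ^ κ) ^ s * n ^ s ≤ C₀ * (h * x ^ s) → x ≤ 2 * s * d →
      2 * (t * 2 ^ lam) * n ^ s ≤ h * d ^ s
    dense-enough {h} {x} {d} dens x≤ = *-cancelˡ-≤ (C₀ * (2 * s) ^ s) {{>-nonZero positive}} (begin
      C₀ * (2 * s) ^ s * (2 * (t * 2 ^ lam) * n ^ s)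
        ≡⟨ perm₁ (C₀ * (2 * s) ^ s) t (2 ^ lam) (n ^ s) ⟩
      2 ^ lam * C₁ * n ^ s
        ≤⟨ *-monoˡ-≤ (n ^ s) (*-monoʳ-≤ (2 ^ lam) (<⇒≤ (m<2^m C₁))) ⟩
      2 ^ lam * 2 ^ C₁ * n ^ s
        ≡⟨ cong (_* n ^ s) (trans (sym (^-distribˡ-+-* 2 lam C₁)) (trans (cong (2 ^_) (trans lam-def (*-comm s κ))) (sym (^-*-assoc 2 κ s)))) ⟩
      (2 ^ κ) ^ s * n ^ s
        ≤⟨ dens ⟩
      C₀ * (h * x ^ s)
        ≤⟨ *-monoʳ-≤ C₀ (*-monoʳ-≤ h (^-monoˡ-≤ s x≤)) ⟩
      C₀ * (h * (2 * s * d) ^ s)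
        ≡⟨ cong (λ z → C₀ * (h * z)) (^-distribʳ-* (2 * s) d s) ⟩
      C₀ * (h * ((2 * s) ^ s * d ^ s))
        ≡⟨ perm₂ C₀ h ((2 * s) ^ s) (d ^ s) ⟩
      C₀ * (2 * s) ^ s * (h * d ^ s) ∎)
      where
      positive : 1 ≤ C₀ * (2 * s) ^ s
      positive = *-mono-≤ (*-mono-≤ (1≤2^ s) (*-mono-≤ {1} {8} (s≤s z≤n) (1≤2^ s₂)))
        (≤-trans (≤-reflexive (sym (^-zeroˡ s))) (^-monoˡ-≤ s {1} {2 * s} (s≤s z≤n)))
      perm₁ : ∀ q t l p → q * (2 * (t * l) * p) ≡ l * (2 * t * q) * p
      perm₁ = solve-∀
      perm₂ : ∀ c h q p → c * (h * (q * p)) ≡ c * q * (h * p)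
      perm₂ = solve-∀

    -- `x` is at least half the average degree `m / n`, which is of order at least
    -- `2 ^ κ * n ^ (s′ / s)`, and `κ∞-small` bounds the last factor below by `2 ^ (κ∞ * r)`.
    -- Everything is raised to the power `s` to stay in ℕ.
    degree-exponent : ∀ {m δ x} → 2 ^ κ * N ≤ m → m ≤ 2 * n * x → x ≤ 2 * s * 2 ^ δ → κ + κ∞ * r ≤ c₅ + δ
    degree-exponent {m} {δ} {x} hm m≤x x≤ = *-cancelʳ-≤ _ _ s (2^-cancel-≤ (begin
      2 ^ ((κ + κ∞ * r) * s)
        ≡⟨ trans (cong (2 ^_) (*-distribʳ-+ s κ (κ∞ * r))) (^-distribˡ-+-* 2 (κ * s) (κ∞ * r * s)) ⟩
      2 ^ (κ * s) * 2 ^ (κ∞ * r * s)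
        ≤⟨ *-mono-≤ (≤-reflexive (sym (^-*-assoc 2 κ s))) κ∞-small ⟩
      (2 ^ κ) ^ s * n ^ s′
        ≤⟨ *-cancelʳ-≤ _ _ (n ^ s) {{m^n≢0 n s {{>-nonZero 1≤n}}}} main ⟩
      (c₅ * 2 ^ δ) ^ s
        ≤⟨ ^-monoˡ-≤ s (*-monoˡ-≤ (2 ^ δ) (<⇒≤ (m<2^m c₅))) ⟩
      (2 ^ c₅ * 2 ^ δ) ^ s
        ≡⟨ trans (cong (_^ s) (sym (^-distribˡ-+-* 2 c₅ δ))) (^-*-assoc 2 (c₅ + δ) s) ⟩
      2 ^ ((c₅ + δ) * s) ∎))
      where
      main : (2 ^ κ) ^ s * n ^ s′ * n ^ s ≤ (c₅ * 2 ^ δ) ^ s * n ^ s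
      main = begin
        (2 ^ κ) ^ s * n ^ s′ * n ^ s
          ≡⟨ *-assoc ((2 ^ κ) ^ s) (n ^ s′) (n ^ s) ⟩
        (2 ^ κ) ^ s * (n ^ s′ * n ^ s)
          ≤⟨ power-≤ {n} {N} {2 ^ κ} N-large hm ⟩
        (2 * m) ^ s
          ≤⟨ ^-monoˡ-≤ s (*-monoʳ-≤ 2 (≤-trans m≤x (*-monoʳ-≤ (2 * n) x≤))) ⟩
        (2 * (2 * n * (2 * s * 2 ^ δ))) ^ s
          ≡⟨ cong (_^ s) (perm n s (2 ^ δ)) ⟩
        (c₅ * 2 ^ δ * n) ^ s
          ≡⟨ ^-distribʳ-* (c₅ * 2 ^ δ) n s ⟩
        (c₅ * 2 ^ δ) ^ s * n ^ s ∎
        where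
        perm : ∀ n s d → 2 * (2 * n * (2 * s * d)) ≡ 8 * s * d * n
        perm = solve-∀

    -- This makes the threshold `d₀` positive and `x / s` at least 1, so that the exponent `δ`
    -- exists.
    large-degree : ∀ {m} → 2 ^ κ * N ≤ m → 4 * s * n ≤ m
    large-degree {m} hm = *-cancelˡ-≤ 2 (begin
      2 * (4 * s * n)  ≡⟨ perm₁ s n ⟩
      c₅ * n  ≤⟨ *-monoˡ-≤ n (≤-trans (<⇒≤ (m<2^m c₅)) (^-monoʳ-≤ 2 (≤-trans c₅≤c c≤κ))) ⟩
      2 ^ κ * n  ≤⟨ *-monoʳ-≤ (2 ^ κ) (half-≤ {n} {N} 1≤n N-large) ⟩
      2 ^ κ * (2 * N)  ≡⟨ perm₂ (2 ^ κ) N ⟩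
      2 * (2 ^ κ * N)  ≤⟨ *-monoʳ-≤ 2 hm ⟩
      2 * m ∎)
      where
      perm₁ : ∀ s n → 2 * (4 * s * n) ≡ 8 * s * n
      perm₁ = solve-∀
      perm₂ : ∀ k N → k * (2 * N) ≡ 2 * (k * N)
      perm₂ = solve-∀

    module Run (D : Fin n × Fin n → Bool) (hm : 2 ^ κ * N ≤ Digraphs.size D) (c₃≤β : c₃ ≤ β) where

      open Digraphs {n}

      -- `X` counts bits: the price `X / a₀` of a lost pair is at most `C₄ * β / 2 ^ β`.
      Outcome : Set
      Outcome = Σ (ℕ × ℕ) λ (a₀ , X) → Σ (List (E → Bool)) λ 𝒟 →
        1 ≤ a₀ × length 𝒟 ≤ 2 ^ X × 2 ^ β * X ≤ C₄ * (β * a₀) ×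
        All (λ D′ → size D′ + a₀ ≤ size D) 𝒟 ×
        (∀ H → KFree s t H → pairs H ⊑ D → Any (pairs H ⊑_) 𝒟)

      private
        m : ℕ
        m = size D

        instance
          n-nonZero : NonZero n
          n-nonZero = >-nonZero 1≤n
          2n-nonZero : NonZero (2 * n)
          2n-nonZero = m*n≢0 2 n
          b-nonZero : NonZero (2 ^ β)
          b-nonZero = m^n≢0 2 β

        degree : V → ℕ
        degree b = length (nbrs D b)

      1≤β : 1 ≤ β
      1≤β = ≤-trans (*-mono-≤ {1} {4} (s≤s z≤n) (*-mono-≤ (1≤growth r) (1≤2^ c₂))) c₃≤β

      module Level (x δ : ℕ) (s2^δ≤x : s * 2 ^ δ ≤ x) (x≤2s2^δ : x ≤ 2 * s * 2 ^ δ)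
        (m≤x : m ≤ 2 * n * x)
        (dens : (2 ^ κ) ^ s * n ^ s ≤ C₀ * (atLeast (allFin n) degree x * x ^ s))
        (1≤h : 1 ≤ atLeast (allFin n) degree x)
        where

        d h M a₀ S hb Q X : ℕ
        d = 2 ^ δ
        B : List V
        B = filter (λ b → x ≤? degree b) (allFin n)
        nb : V → List V
        nb b = take (s * d) (nbrs D b)
        h = length B
        M = h * (s * d)
        instance
          p-nonZero : NonZero (2 ^ c₃)
          p-nonZero = m^n≢0 2 c₃
          hb-nonZero : NonZero (2 ^ pred β)
          hb-nonZero = m^n≢0 2 (pred β)
        -- `a₀` stays small enough for the excluded pairs never to dominate the heads, `S` is the
        -- budget `2 M / b` rounded up, and `hb` is the period `b / 2` of `pow-halve`.
        a₀ = M / 2 ^ c₃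
        S  = suc (2 * M / 2 ^ β)
        hb = 2 ^ pred β
        Q  = suc (a₀ / hb)
        X  = Q + β * (r * S)

        h≡ : h ≡ atLeast (allFin n) degree x
        h≡ = length-filter-∑ (λ b → x ≤? degree b) (allFin n)

        δ-large : κ + κ∞ * r ≤ c₅ + δ
        δ-large = degree-exponent hm m≤x x≤2s2^δ

        b≤M : 2 ^ β ≤ M
        b≤M = begin
          2 ^ β ≤⟨ ^-monoʳ-≤ 2 (β≤δ δ-large) ⟩
          d ≡⟨ sym (trans (*-identityˡ (1 * d)) (*-identityˡ d)) ⟩
          1 * (1 * d) ≤⟨ *-mono-≤ (subst (1 ≤_) (sym h≡) 1≤h) (*-monoˡ-≤ d {1} {s} (s≤s z≤n)) ⟩
          M ∎

        1≤a₀ : 1 ≤ a₀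
        1≤a₀ = floor-≥ {M} {2 ^ c₃} (≤-trans (≤-reflexive (*-identityʳ (2 ^ c₃))) (≤-trans (^-monoʳ-≤ 2 c₃≤β) b≤M))

        M≤ : M ≤ 2 * (2 ^ c₃ * a₀)
        M≤ = begin
          M  ≤⟨ <⇒≤ (floor-> M (2 ^ c₃)) ⟩
          2 ^ c₃ * suc a₀  ≤⟨ *-monoʳ-≤ (2 ^ c₃) (+-monoˡ-≤ a₀ 1≤a₀) ⟩
          2 ^ c₃ * (a₀ + a₀)  ≡⟨ double (2 ^ c₃) a₀ ⟩
          2 * (2 ^ c₃ * a₀) ∎
          where
          double : ∀ p a → p * (a + a) ≡ 2 * (p * a)
          double = solve-∀

        a₀-small : 4 * (growth r * 2 ^ c₂ * a₀) ≤ M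
        a₀-small = begin
          4 * (growth r * 2 ^ c₂ * a₀)  ≡⟨ sym (*-assoc 4 (growth r * 2 ^ c₂) a₀) ⟩
          c₃ * a₀  ≤⟨ *-monoˡ-≤ a₀ (<⇒≤ (m<2^m c₃)) ⟩
          2 ^ c₃ * a₀  ≤⟨ floor-≤ M (2 ^ c₃) ⟩
          M ∎

        S-large : 2 * M ≤ S * 2 ^ β
        S-large = ≤-trans (<⇒≤ (floor-> (2 * M) (2 ^ β))) (≤-reflexive (*-comm (2 ^ β) S))

        S-small : S * 2 ^ β ≤ 2 * M + 2 ^ β
        S-small = begin
          2 ^ β + 2 * M / 2 ^ β * 2 ^ β  ≤⟨ +-monoʳ-≤ (2 ^ β) (m/n*n≤m (2 * M) (2 ^ β)) ⟩
          2 ^ β + 2 * M  ≡⟨ +-comm (2 ^ β) (2 * M) ⟩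
          2 * M + 2 ^ β ∎

        halves : ∀ β → 1 ≤ β → 2 ^ β ≡ 2 * 2 ^ pred β
        halves (suc β) _ = refl

        length-nb : ∀ {b} → b ∈ B → length (nb b) ≡ s * d
        length-nb {b} b∈ = trans (length-take (s * d) (nbrs D b))
          (m≤n⇒m⊓n≡m (≤-trans s2^δ≤x (proj₂ (∈-filter⁻ (λ b → x ≤? degree b) {xs = allFin n} b∈))))

        nb⊆D : ∀ b {a} → a ∈ nb b → D (b , a) ≡ true
        nb⊆D b a∈ = proj₂ (∈-filter⁻ (λ a → present? D (b , a)) {xs = allFin n} (∈-take (s * d) a∈))

        c₂-large : 2 * (suc t′ * suc s′) ≤ 2 ^ c₂
        c₂-large = <⇒≤ (m<2^m c₂)

        predecessor : suc (pred (2 ^ β)) ≡ 2 ^ β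
        predecessor = suc-pred (2 ^ β)

        outcome : Outcome
        outcome = finish (Step.step {n} s′ t′ (s≤s z≤n) (s≤s z≤n) δ lam β (γ δ-large) c₂ (pred (2 ^ β)) a₀ S D B
            (Unique.filter⁺ (λ b → x ≤? degree b) (Unique.allFin⁺ n)) nb
            (λ b → Unique.take⁺ (s * d) (Unique.filter⁺ (λ a → present? D (b , a)) (Unique.allFin⁺ n)))
            length-nb nb⊆D (β≤δ δ-large) β≤lam (balance δ-large) c₂-large
            (dense-enough {h} {x} {d} (subst (λ z → (2 ^ κ) ^ s * n ^ s ≤ C₀ * (z * x ^ s)) (sym h≡) dens) x≤2s2^δ)
            (sym predecessor) 1≤n S-large a₀-small)
          where
          finish : (Σ (List (E → Bool)) λ 𝒟 →
              (length 𝒟 * pred (2 ^ β) ^ a₀ ≤ (2 ^ β) ^ (a₀ + r * S)) ×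
              All (λ D′ → size D′ + a₀ ≤ size D) 𝒟 ×
              (∀ H → KFree s t H → pairs H ⊑ D → Any (pairs H ⊑_) 𝒟)) → Outcome
          finish (𝒟 , len , shrink , cov) = (a₀ , X) , 𝒟 , 1≤a₀ , count ,
            cost-bound {h = hb} {Q = Q} {r = r} {S = S} {M = M} {p = 2 ^ c₃} (halves β 1≤β) hQ S-small b≤M M≤ 1≤β ,
            shrink , cov
            where
            hQ : hb * Q ≤ a₀ + hb
            hQ = begin
              hb * suc (a₀ / hb)  ≡⟨ *-suc hb (a₀ / hb) ⟩
              hb + hb * (a₀ / hb)  ≤⟨ +-monoʳ-≤ hb (floor-≤ a₀ hb) ⟩
              hb + a₀  ≡⟨ +-comm hb a₀ ⟩
              a₀ + hb ∎
            count : length 𝒟 ≤ 2 ^ X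
            count = begin
              length 𝒟
                ≤⟨ count-bound {c = pred (2 ^ β)} {h = hb} {a = a₀} {e = r * S} {Q = Q}
                     (trans (sym (halves β 1≤β)) (sym predecessor)) (1≤2^ (pred β)) (<⇒≤ (floor-> a₀ hb))
                     (subst (λ z → length 𝒟 * pred (2 ^ β) ^ a₀ ≤ z ^ (a₀ + r * S)) (sym predecessor) len) ⟩
              2 ^ Q * suc (pred (2 ^ β)) ^ (r * S)
                ≡⟨ cong (2 ^ Q *_) (trans (cong (_^ (r * S)) predecessor) (^-*-assoc 2 β (r * S))) ⟩
              2 ^ Q * 2 ^ (β * (r * S))
                ≡⟨ sym (^-distribˡ-+-* 2 Q (β * (r * S))) ⟩
              2 ^ X ∎

      private
        d₀ : ℕ
        -- Half the average degree, the largest threshold that `popular-level` admits.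
        d₀ = m / (2 * n)

        4sn≤m : 4 * s * n ≤ m
        4sn≤m = large-degree hm

        1≤d₀ : 1 ≤ d₀
        1≤d₀ = floor-≥ {m} {2 * n} (≤-trans (≤-reflexive (*-identityʳ (2 * n)))
          (≤-trans (*-monoˡ-≤ n (≤-trans (s≤s (s≤s z≤n)) (m≤m*n 4 s))) 4sn≤m))

        1≤m : 1 ≤ m
        1≤m = ≤-trans (*-mono-≤ {1} {4 * s} (s≤s z≤n) 1≤n) 4sn≤m

        d₀≤n : d₀ ≤ n
        d₀≤n = *-cancelˡ-≤ n (begin
          n * d₀  ≤⟨ *-monoˡ-≤ d₀ (m≤n*m n 2) ⟩
          2 * n * d₀  ≤⟨ floor-≤ m (2 * n) ⟩
          m  ≤⟨ size≤ D ⟩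
          n * n ∎)

        m≤d₀ : m ≤ 4 * n * d₀
        m≤d₀ = begin
          m  ≤⟨ <⇒≤ (floor-> m (2 * n)) ⟩
          2 * n * suc d₀  ≤⟨ *-monoʳ-≤ (2 * n) (+-monoˡ-≤ d₀ 1≤d₀) ⟩
          2 * n * (d₀ + d₀)  ≡⟨ double n d₀ ⟩
          4 * n * d₀ ∎
          where
          double : ∀ n d → 2 * n * (d + d) ≡ 4 * n * d
          double = solve-∀

      outcome : Outcome
      outcome = choose (popular-level (allFin n) degree (degree≤n D) (≤-reflexive length-allFin) 1≤d₀ d₀≤n 1≤m (floor-≤ m (2 * n)))
        where
        choose : (Σ ℕ λ x → d₀ < x × d₀ * m ≤ 2 * (atLeast (allFin n) degree x * (x * x))) → Outcome
        choose (x , d₀<x , big) = with-exponent (log₂ (x / s) 1≤x/s)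
          where
          m≤x : m ≤ 2 * n * x
          m≤x = ≤-trans (<⇒≤ (floor-> m (2 * n))) (*-monoʳ-≤ (2 * n) d₀<x)
          2s≤x : 2 * s ≤ x
          2s≤x = *-cancelˡ-≤ (2 * n) (≤-trans (≤-reflexive (perm n s)) (≤-trans 4sn≤m m≤x))
            where
            perm : ∀ n s → 2 * n * (2 * s) ≡ 4 * s * n
            perm = solve-∀
          1≤x/s : 1 ≤ x / s
          1≤x/s = floor-≥ {x} {s} (≤-trans (≤-reflexive (*-identityʳ s)) (≤-trans (m≤m+n s (s + 0)) 2s≤x))
          1≤h : 1 ≤ atLeast (allFin n) degree x
          1≤h = positive (atLeast (allFin n) degree x) (≤-trans (*-mono-≤ 1≤d₀ 1≤m) big)
            where
            positive : ∀ h → 1 ≤ 2 * (h * (x * x)) → 1 ≤ h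
            positive (suc h) _ = s≤s z≤n
          with-exponent : (Σ ℕ λ δ → 2 ^ δ ≤ x / s × x / s < 2 ^ suc δ) → Outcome
          with-exponent (δ , lo , hi) = Level.outcome x δ
            (≤-trans (*-monoʳ-≤ s lo) (floor-≤ x s))
            (≤-trans (<⇒≤ (floor-> x s)) (≤-trans (*-monoʳ-≤ s hi) (≤-reflexive (perm s (2 ^ δ)))))
            m≤x (density {n} {N} {2 ^ κ} {m} {atLeast (allFin n) degree x} {x} {d₀} 1≤n N-large hm m≤x m≤d₀ big) 1≤h
            where
            perm : ∀ s p → s * (2 * p) ≡ 2 * s * p
            perm = solve-∀

-- Iteration over steps and scales

module Refinement {n : ℕ} (s t : ℕ) where

  open Digraphs {n}

  GraphCover : (E → Bool) → ℕ → ((E → Bool) → Set) → Set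
  GraphCover D L P = Σ (List (E → Bool)) λ 𝒟 → length 𝒟 ≤ L × All P 𝒟 ×
    (∀ H → KFree s t H → pairs H ⊑ D → Any (pairs H ⊑_) 𝒟)

  cover-self : ∀ {D L P} → 1 ≤ L → P D → GraphCover D L P
  cover-self {D} 1≤L p = D ∷ [] , 1≤L , p ∷ [] , λ H _ H⊑D → here H⊑D

  refine : ∀ {D L L′ P P′} → GraphCover D L P → (∀ D′ → P D′ → GraphCover D′ L′ P′) → GraphCover D (L * L′) P′
  refine {D} {L} {L′} {P} {P′} (𝒟 , len , ok , cov) next =
    proj₁ (all 𝒟 ok) , ≤-trans (proj₁ (proj₂ (all 𝒟 ok))) (*-monoˡ-≤ L′ len) ,
    proj₁ (proj₂ (proj₂ (all 𝒟 ok))) , λ H free H⊑D → proj₂ (proj₂ (proj₂ (all 𝒟 ok))) H free (cov H free H⊑D)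
    where
    all : ∀ 𝒟 → All P 𝒟 → Σ (List (E → Bool)) λ ℛ → length ℛ ≤ length 𝒟 * L′ × All P′ ℛ ×
      (∀ H → KFree s t H → Any (pairs H ⊑_) 𝒟 → Any (pairs H ⊑_) ℛ)
    all []       []       = [] , z≤n , [] , λ _ _ ()
    all (D′ ∷ 𝒟) (p ∷ ps) with next D′ p | all 𝒟 ps
    ... | 𝒜 , lenA , okA , covA | ℛ , lenR , okR , covR =
      𝒜 ++ ℛ , ≤-trans (≤-reflexive (length-++ 𝒜)) (+-mono-≤ lenA lenR) , All.++⁺ okA okR ,
      λ { H free (here h)  → Any.++⁺ˡ (covA H free h)
        ; H free (there h) → Any.++⁺ʳ 𝒜 (covR H free h) }

∑< : (ℕ → ℕ) → ℕ → ℕ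
∑< f zero    = 0
∑< f (suc i) = f i + ∑< f i

-- Up to g the costs decay geometrically; the remaining ones are all small.
module CostSum (cost : ℕ → ℕ) (A κ₀ s g w : ℕ) (1≤κ₀ : 1 ≤ κ₀)
  (cost-≤ : ∀ i → cost i * w * 2 ^ (suc s * (i ⊓ g)) ≤ A * (κ₀ + i)) where

  -- `p` collects the terms up to `g` and `q` the later ones. The invariant for `p` is `∑ (1 + i) /
  -- 2 ^ i = 4 - (2 J + 4) / 2 ^ J` over `i < J`, cleared of denominators.
  cost-sum : ∀ J I → J ≤ I → Σ (ℕ × ℕ) λ (p , q) →
    ∑< cost J * w ≡ p + q ×
    2 ^ J * p + A * κ₀ * (2 * J + 4) ≤ 4 * (A * κ₀) * 2 ^ J ×
    q * 2 ^ (suc s * g) ≤ J * (A * (κ₀ + I))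
  cost-sum zero    I _   = (0 , 0) , refl , ≤-reflexive (start (A * κ₀)) , z≤n
    where
    start : ∀ B → 1 * 0 + B * (2 * 0 + 4) ≡ 4 * B * 1
    start = solve-∀
  cost-sum (suc J) I J<I with cost-sum J I (≤-trans (n≤1+n J) J<I) | J ≤? g
  ... | (p , q) , eq , hp , hq | yes J≤g = (z + p , q) , sum-eq , hp′ , ≤-trans hq (*-monoˡ-≤ _ (n≤1+n J))
    where
    open ≤-Reasoning
    z B : ℕ
    z = cost J * w
    B = A * κ₀
    sum-eq : (cost J + ∑< cost J) * w ≡ z + p + q
    sum-eq = trans (*-distribʳ-+ (w) (cost J) _) (trans (cong (z +_) eq) (sym (+-assoc z p q)))
    hz : 2 ^ J * z ≤ B * (1 + J)
    hz = begin
      2 ^ J * z  ≡⟨ *-comm (2 ^ J) z ⟩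
      z * 2 ^ J  ≤⟨ *-monoʳ-≤ z (^-monoʳ-≤ 2 (≤-trans (≤-reflexive (sym (m≤n⇒m⊓n≡m J≤g))) (m≤m+n (J ⊓ g) (s * (J ⊓ g))))) ⟩
      z * 2 ^ (suc s * (J ⊓ g))  ≤⟨ cost-≤ J ⟩
      A * (κ₀ + J)  ≤⟨ *-monoʳ-≤ A (+-monoʳ-≤ κ₀ (m≤n*m J κ₀ {{>-nonZero 1≤κ₀}})) ⟩
      A * (κ₀ + κ₀ * J)  ≡⟨ perm A κ₀ J ⟩
      B * (1 + J) ∎
      where
      perm : ∀ A κ J → A * (κ + κ * J) ≡ A * κ * (1 + J)
      perm = solve-∀
    hp′ : 2 ^ suc J * (z + p) + B * (2 * suc J + 4) ≤ 4 * B * 2 ^ suc J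
    hp′ = begin
      2 ^ suc J * (z + p) + B * (2 * suc J + 4)
        ≡⟨ perm₁ (2 ^ J) z p B J ⟩
      2 * (2 ^ J * z) + 2 * (2 ^ J * p) + B * (2 * J + 6)
        ≤⟨ +-monoˡ-≤ (B * (2 * J + 6)) (+-monoˡ-≤ (2 * (2 ^ J * p)) (*-monoʳ-≤ 2 hz)) ⟩
      2 * (B * (1 + J)) + 2 * (2 ^ J * p) + B * (2 * J + 6)
        ≡⟨ perm₂ (2 ^ J * p) B J ⟩
      2 * (2 ^ J * p + B * (2 * J + 4))
        ≤⟨ *-monoʳ-≤ 2 hp ⟩
      2 * (4 * B * 2 ^ J)
        ≡⟨ perm₃ B (2 ^ J) ⟩
      4 * B * 2 ^ suc J ∎
      where
      perm₁ : ∀ x z p B J → 2 * x * (z + p) + B * (2 * suc J + 4) ≡ 2 * (x * z) + 2 * (x * p) + B * (2 * J + 6)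
      perm₁ = solve-∀
      perm₂ : ∀ y B J → 2 * (B * (1 + J)) + 2 * y + B * (2 * J + 6) ≡ 2 * (y + B * (2 * J + 4))
      perm₂ = solve-∀
      perm₃ : ∀ B x → 2 * (4 * B * x) ≡ 4 * B * (2 * x)
      perm₃ = solve-∀
  ... | (p , q) , eq , hp , hq | no J≰g = (p , z + q) , sum-eq , hp′ , hq′
    where
    open ≤-Reasoning
    z B : ℕ
    z = cost J * w
    B = A * κ₀
    sum-eq : (cost J + ∑< cost J) * w ≡ p + (z + q)
    sum-eq = trans (*-distribʳ-+ (w) (cost J) _) (trans (cong (z +_) eq) (perm z p q))
      where
      perm : ∀ z p q → z + (p + q) ≡ p + (z + q)
      perm = solve-∀
    hp′ : 2 ^ suc J * p + B * (2 * suc J + 4) ≤ 4 * B * 2 ^ suc J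
    hp′ = begin
      2 ^ suc J * p + B * (2 * suc J + 4)
        ≤⟨ m≤m+n _ (B * (2 * J + 2)) ⟩
      2 ^ suc J * p + B * (2 * suc J + 4) + B * (2 * J + 2)
        ≡⟨ perm₂ (2 ^ J) p B J ⟩
      2 * (2 ^ J * p + B * (2 * J + 4))
        ≤⟨ *-monoʳ-≤ 2 hp ⟩
      2 * (4 * B * 2 ^ J)
        ≡⟨ perm₃ B (2 ^ J) ⟩
      4 * B * 2 ^ suc J ∎
      where
      perm₂ : ∀ x p B J → 2 * x * p + B * (2 * suc J + 4) + B * (2 * J + 2) ≡ 2 * (x * p + B * (2 * J + 4))
      perm₂ = solve-∀
      perm₃ : ∀ B x → 2 * (4 * B * x) ≡ 4 * B * (2 * x)
      perm₃ = solve-∀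
    hq′ : (z + q) * 2 ^ (suc s * g) ≤ suc J * (A * (κ₀ + I))
    hq′ = begin
      (z + q) * 2 ^ (suc s * g)
        ≡⟨ *-distribʳ-+ (2 ^ (suc s * g)) z q ⟩
      z * 2 ^ (suc s * g) + q * 2 ^ (suc s * g)
        ≤⟨ +-mono-≤ (≤-trans (≤-reflexive (cong (λ x → z * 2 ^ (suc s * x)) (sym (m≥n⇒m⊓n≡n (<⇒≤ (≰⇒> J≰g))))))
             (≤-trans (cost-≤ J) (*-monoʳ-≤ A (+-monoʳ-≤ κ₀ (≤-trans (n≤1+n J) J<I))))) hq ⟩
      suc J * (A * (κ₀ + I)) ∎

  total-≤ : ∀ {I C₆} → I * (κ₀ + I) ≤ C₆ * κ₀ * 2 ^ (suc s * g) → ∑< cost I * w ≤ (4 + C₆) * (A * κ₀)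
  total-≤ {I} {C₆} h with cost-sum I I ≤-refl
  ... | (p , q) , eq , hp , hq = begin
    ∑< cost I * w  ≡⟨ eq ⟩
    p + q  ≤⟨ +-mono-≤ p≤ q≤ ⟩
    4 * (A * κ₀) + C₆ * (A * κ₀)  ≡⟨ sym (*-distribʳ-+ (A * κ₀) 4 C₆) ⟩
    (4 + C₆) * (A * κ₀) ∎
    where
    open ≤-Reasoning
    perm : ∀ x y z → x * (y * z) ≡ y * (x * z)
    perm = solve-∀
    perm₂ : ∀ A C κ x → A * (C * κ * x) ≡ C * (A * κ) * x
    perm₂ = solve-∀
    p≤ : p ≤ 4 * (A * κ₀)
    p≤ = *-cancelʳ-≤ _ _ (2 ^ I) {{m^n≢0 2 I}} (≤-trans (≤-reflexive (*-comm p (2 ^ I))) (≤-trans (m≤m+n _ _) hp))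
    q≤ : q ≤ C₆ * (A * κ₀)
    q≤ = *-cancelʳ-≤ _ _ (2 ^ (suc s * g)) {{m^n≢0 2 (suc s * g)}} (begin
      q * 2 ^ (suc s * g)  ≤⟨ hq ⟩
      I * (A * (κ₀ + I))  ≡⟨ perm I A (κ₀ + I) ⟩
      A * (I * (κ₀ + I))  ≤⟨ *-monoʳ-≤ A h ⟩
      A * (C₆ * κ₀ * 2 ^ (suc s * g))  ≡⟨ perm₂ A C₆ κ₀ (2 ^ (suc s * g)) ⟩
      C₆ * (A * κ₀) * 2 ^ (suc s * g) ∎)

module Scales (s₂ t₁ : ℕ) {n N κ∞ : ℕ} (setting : Constants.Setting s₂ t₁ n N κ∞)
  (k κ₀ g : ℕ) (κ₀-large : Constants.c s₂ t₁ + Constants.c₃ s₂ t₁ ≤ κ₀) (κ∞-def : κ₀ + g ≡ κ∞)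
  (k≥ : 2 ^ κ₀ ≤ k) (k< : k < 2 ^ suc κ₀) where

  open Constants s₂ t₁
  open Digraphs {n} using (E; size; pairs; _⊑_)
  open Refinement {n} s t public

  -- `μ i` is the minimum of `κ₀ + i` and `κ∞`; `cost i` is the number of bits for the passage from
  -- size `Q (suc i)` to size `Q i`.
  μ β Q cost : ℕ → ℕ
  μ i = κ₀ + (i ⊓ g)
  β i = κ₀ + i + s′ * μ i ∸ c
  Q i = 2 ^ i * (k * N)
  cost i = (C₄ * (β i * Q (suc i)) / 2 ^ β i) {{m^n≢0 2 (β i)}}

  private
    c≤κ : ∀ i → c ≤ κ₀ + i
    c≤κ i = ≤-trans (≤-trans (m≤m+n c c₃) κ₀-large) (m≤m+n κ₀ i)

    β-def : ∀ i → β i + c ≡ κ₀ + i + s′ * μ i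
    β-def i = m∸n+n≡m (≤-trans (c≤κ i) (m≤m+n (κ₀ + i) _))

    c₃≤β : ∀ i → c₃ ≤ β i
    c₃≤β i = +-cancelʳ-≤ c c₃ (β i) (begin
      c₃ + c  ≡⟨ +-comm c₃ c ⟩
      c + c₃  ≤⟨ κ₀-large ⟩
      κ₀  ≤⟨ m≤m+n κ₀ i ⟩
      κ₀ + i  ≤⟨ m≤m+n (κ₀ + i) _ ⟩
      κ₀ + i + s′ * μ i  ≡⟨ sym (β-def i) ⟩
      β i + c ∎)
      where open ≤-Reasoning

    scale-≤ : ∀ i → 2 ^ (κ₀ + i) * N ≤ Q i
    scale-≤ i = begin
      2 ^ (κ₀ + i) * N  ≡⟨ cong (_* N) (^-distribˡ-+-* 2 κ₀ i) ⟩
      2 ^ κ₀ * 2 ^ i * N  ≤⟨ *-monoˡ-≤ N (*-monoˡ-≤ (2 ^ i) k≥) ⟩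
      k * 2 ^ i * N  ≡⟨ perm k (2 ^ i) N ⟩
      Q i ∎
      where
      open ≤-Reasoning
      perm : ∀ k p N → k * p * N ≡ p * (k * N)
      perm = solve-∀

  module _ (i : ℕ) where

    private
      instance
        b-nonZero : NonZero (2 ^ β i)
        b-nonZero = m^n≢0 2 (β i)

      exponent : ℕ → ℕ
      exponent m = C₄ * (β i * m) / 2 ^ β i

      -- `exponent` is a potential: the bits of one step are paid by its decrease, so rounding
      -- occurs once per scale and not once per step.
      exponent-+ : ∀ {m a X} → a ≤ m → 2 ^ β i * X ≤ C₄ * (β i * a) → X + exponent (m ∸ a) ≤ exponent m
      exponent-+ {m} {a} {X} a≤m h = floor-≥ (begin
        2 ^ β i * (X + exponent (m ∸ a))
          ≡⟨ *-distribˡ-+ (2 ^ β i) X _ ⟩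
        2 ^ β i * X + 2 ^ β i * exponent (m ∸ a)
          ≤⟨ +-mono-≤ h (floor-≤ _ (2 ^ β i)) ⟩
        C₄ * (β i * a) + C₄ * (β i * (m ∸ a))
          ≡⟨ perm C₄ (β i) a (m ∸ a) ⟩
        C₄ * (β i * (a + (m ∸ a)))
          ≡⟨ cong (λ z → C₄ * (β i * z)) (m+[n∸m]≡n a≤m) ⟩
        C₄ * (β i * m) ∎)
        where
        open ≤-Reasoning
        perm : ∀ C β a z → C * (β * a) + C * (β * z) ≡ C * (β * (a + z))
        perm = solve-∀

    reduce : ∀ fuel m → m ≤ fuel → ∀ D → size D ≤ m → GraphCover D (2 ^ exponent m) (λ D′ → size D′ ≤ Q i)
    reduce fuel m m≤fuel D D≤m with size D ≤? Q i
    reduce fuel m m≤fuel D D≤m | yes small = cover-self (1≤2^ (exponent m)) small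
    reduce zero m m≤fuel D D≤m | no ¬small = ⊥-elim (¬small (≤-trans D≤m (≤-trans m≤fuel z≤n)))
    reduce (suc fuel) m m≤fuel D D≤m | no ¬small = continue (Phase.Choice.Run.outcome s₂ t₁ setting (+-monoʳ-≤ κ₀ (m⊓n≤m i g))
        (≤-trans (+-monoʳ-≤ κ₀ (m⊓n≤n i g)) (≤-reflexive κ∞-def)) (c≤κ i) (β-def i)
        D (≤-trans (scale-≤ i) (<⇒≤ (≰⇒> ¬small))) (c₃≤β i))
      where
      continue : (Σ (ℕ × ℕ) λ (a , X) → Σ (List (E → Bool)) λ 𝒟 →
          1 ≤ a × length 𝒟 ≤ 2 ^ X × 2 ^ β i * X ≤ C₄ * (β i * a) ×
          All (λ D′ → size D′ + a ≤ size D) 𝒟 × (∀ H → KFree s t H → pairs H ⊑ D → Any (pairs H ⊑_) 𝒟)) →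
        GraphCover D (2 ^ exponent m) (λ D′ → size D′ ≤ Q i)
      -- With no container left, nothing has to be bounded; otherwise the first container supplies
      -- `a ≤ m`.
      continue ((a , X) , [] , 1≤a , len , _ , _ , cov) = [] , z≤n , [] , cov
      continue ((a , X) , 𝒟@(D₁ ∷ _) , 1≤a , len , cheap , shrink@(D₁≤ ∷ _) , cov) =
        widen (refine {L = 2 ^ X} {L′ = 2 ^ exponent (m ∸ a)} {P = λ D′ → size D′ + a ≤ size D}
          (𝒟 , len , shrink , cov)
          (λ D′ D′≤ → reduce fuel (m ∸ a) smaller D′ (≤-trans (≤-reflexive (sym (m+n∸n≡m (size D′) a)))
            (∸-monoˡ-≤ a (≤-trans D′≤ D≤m)))))
        where
        a≤m : a ≤ m
        a≤m = ≤-trans (m≤n+m a (size D₁)) (≤-trans D₁≤ D≤m)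
        smaller : m ∸ a ≤ fuel
        smaller = ≤-trans (∸-monoʳ-≤ m 1≤a) (∸-monoˡ-≤ 1 m≤fuel)
        widen : GraphCover D (2 ^ X * 2 ^ exponent (m ∸ a)) (λ D′ → size D′ ≤ Q i) →
          GraphCover D (2 ^ exponent m) (λ D′ → size D′ ≤ Q i)
        widen (ℛ , lenR , rest) = ℛ , ≤-trans lenR (≤-trans
          (≤-reflexive (sym (^-distribˡ-+-* 2 X (exponent (m ∸ a)))))
          (^-monoʳ-≤ 2 (exponent-+ a≤m cheap))) , rest

  descend : ∀ i D → size D ≤ Q i → GraphCover D (2 ^ ∑< cost i) (λ D′ → size D′ ≤ Q 0)
  descend zero    D D≤ = cover-self (1≤2^ 0) D≤
  descend (suc i) D D≤ = widen (refine {L = 2 ^ cost i} {L′ = 2 ^ ∑< cost i} {P = λ D′ → size D′ ≤ Q i}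
    (reduce i (Q (suc i)) (Q (suc i)) ≤-refl D D≤) (descend i))
    where
    widen : GraphCover D (2 ^ cost i * 2 ^ ∑< cost i) (λ D′ → size D′ ≤ Q 0) →
      GraphCover D (2 ^ ∑< cost (suc i)) (λ D′ → size D′ ≤ Q 0)
    widen (ℛ , lenR , rest) = ℛ , ≤-trans lenR
      (≤-reflexive (sym (^-distribˡ-+-* 2 (cost i) (∑< cost i)))) , rest

  A : ℕ
  A = 4 * 2 ^ c * C₄ * s * N

  -- The factor `2 ^ (κ₀ + i)` in `2 ^ β i` cancels the growth of `Q (suc i)`; what remains is the
  -- decay `2 ^ (s′ * μ i)`.
  cost-≤ : ∀ i → cost i * 2 ^ (s′ * κ₀) * 2 ^ (s′ * (i ⊓ g)) ≤ A * (κ₀ + i)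
  cost-≤ i = *-cancelʳ-≤ _ _ (2 ^ (κ₀ + i)) {{m^n≢0 2 (κ₀ + i)}} (begin
    cost i * 2 ^ (s′ * κ₀) * 2 ^ (s′ * (i ⊓ g)) * 2 ^ (κ₀ + i)
      ≡⟨ perm₁ (cost i) (2 ^ (s′ * κ₀)) (2 ^ (s′ * (i ⊓ g))) (2 ^ (κ₀ + i)) ⟩
    cost i * (2 ^ (κ₀ + i) * (2 ^ (s′ * κ₀) * 2 ^ (s′ * (i ⊓ g))))
      ≡⟨ cong (cost i *_) powers ⟩
    cost i * (2 ^ β i * 2 ^ c)
      ≡⟨ sym (*-assoc (cost i) (2 ^ β i) (2 ^ c)) ⟩
    cost i * 2 ^ β i * 2 ^ c
      ≤⟨ *-monoˡ-≤ (2 ^ c) (m/n*n≤m (C₄ * (β i * Q (suc i))) (2 ^ β i) {{m^n≢0 2 (β i)}}) ⟩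
    C₄ * (β i * (2 * 2 ^ i * (k * N))) * 2 ^ c
      ≤⟨ *-monoˡ-≤ (2 ^ c) (*-monoʳ-≤ C₄ (*-mono-≤ β≤ (*-monoʳ-≤ (2 * 2 ^ i) (*-monoˡ-≤ N (<⇒≤ k<))))) ⟩
    C₄ * (s * (κ₀ + i) * (2 * 2 ^ i * (2 * 2 ^ κ₀ * N))) * 2 ^ c
      ≡⟨ perm₂ C₄ s (κ₀ + i) (2 ^ i) (2 ^ κ₀) N (2 ^ c) ⟩
    A * (κ₀ + i) * (2 ^ κ₀ * 2 ^ i)
      ≡⟨ cong (A * (κ₀ + i) *_) (sym (^-distribˡ-+-* 2 κ₀ i)) ⟩
    A * (κ₀ + i) * 2 ^ (κ₀ + i) ∎)
    where
    open ≤-Reasoning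
    perm₁ : ∀ x p q r → x * p * q * r ≡ x * (r * (p * q))
    perm₁ = solve-∀
    perm₂ : ∀ C s κ p q N d → C * (s * κ * (2 * p * (2 * q * N))) * d ≡ 4 * d * C * s * N * κ * (q * p)
    perm₂ = solve-∀
    powers : 2 ^ (κ₀ + i) * (2 ^ (s′ * κ₀) * 2 ^ (s′ * (i ⊓ g))) ≡ 2 ^ β i * 2 ^ c
    powers = begin-equality
      2 ^ (κ₀ + i) * (2 ^ (s′ * κ₀) * 2 ^ (s′ * (i ⊓ g)))
        ≡⟨ cong (2 ^ (κ₀ + i) *_) (trans (sym (^-distribˡ-+-* 2 (s′ * κ₀) _)) (cong (2 ^_) (sym (*-distribˡ-+ s′ κ₀ (i ⊓ g))))) ⟩
      2 ^ (κ₀ + i) * 2 ^ (s′ * μ i)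
        ≡⟨ sym (^-distribˡ-+-* 2 (κ₀ + i) (s′ * μ i)) ⟩
      2 ^ (κ₀ + i + s′ * μ i)
        ≡⟨ cong (2 ^_) (sym (β-def i)) ⟩
      2 ^ (β i + c)
        ≡⟨ ^-distribˡ-+-* 2 (β i) c ⟩
      2 ^ β i * 2 ^ c ∎
    β≤ : β i ≤ s * (κ₀ + i)
    β≤ = begin
      β i  ≤⟨ m∸n≤m (κ₀ + i + s′ * μ i) c ⟩
      κ₀ + i + s′ * μ i  ≤⟨ +-monoʳ-≤ (κ₀ + i) (*-monoʳ-≤ s′ (+-monoʳ-≤ κ₀ (m⊓n≤m i g))) ⟩
      s * (κ₀ + i) ∎

  total-cost-≤ : ∀ {I C₆} → I * (κ₀ + I) ≤ C₆ * κ₀ * 2 ^ (s′ * g) →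
    ∑< cost I * k ^ s′ ≤ 2 ^ s′ * ((4 + C₆) * (A * κ₀))
  total-cost-≤ {I} {C₆} h = begin
    ∑< cost I * k ^ s′
      ≤⟨ *-monoʳ-≤ (∑< cost I) (≤-trans (^-monoˡ-≤ s′ (<⇒≤ k<)) (≤-reflexive (trans (^-distribʳ-* 2 (2 ^ κ₀) s′)
           (cong (2 ^ s′ *_) (trans (^-*-assoc 2 κ₀ s′) (cong (2 ^_) (*-comm κ₀ s′))))))) ⟩
    ∑< cost I * (2 ^ s′ * 2 ^ (s′ * κ₀))
      ≡⟨ perm (∑< cost I) (2 ^ s′) (2 ^ (s′ * κ₀)) ⟩
    2 ^ s′ * (∑< cost I * 2 ^ (s′ * κ₀))
      ≤⟨ *-monoʳ-≤ (2 ^ s′) (CostSum.total-≤ cost A κ₀ s₂ g (2 ^ (s′ * κ₀)) 1≤κ₀ cost-≤ {I} {C₆} h) ⟩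
    2 ^ s′ * ((4 + C₆) * (A * κ₀)) ∎
    where
    open ≤-Reasoning
    perm : ∀ x y z → x * (y * z) ≡ y * (x * z)
    perm = solve-∀
    1≤κ₀ : 1 ≤ κ₀
    1≤κ₀ = ≤-trans (≤-trans (s≤s z≤n) (m≤n+m c₅ (C₁ + c₂))) (≤-trans (m≤m+n c c₃) κ₀-large)

-- Choice of the scales, and passage back to graphs

bracket : ∀ (f : ℕ → ℕ) m B → f 0 ≤ m → m < f B → Σ ℕ λ x → f x ≤ m × m < f (suc x)
bracket f m zero    lo hi = contradiction hi (≤⇒≯ lo)
bracket f m (suc B) lo hi with m <? f B
... | yes m<fB = bracket f m B lo m<fB
... | no m≮fB  = B , ≮⇒≥ m≮fB , hi

^-cancel-< : ∀ {x y} m → x ^ m < y ^ m → x < y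
^-cancel-< {x} {y} m h with x <? y
... | yes x<y = x<y
... | no x≮y  = contradiction h (≤⇒≯ (^-monoˡ-≤ m (≮⇒≥ x≮y)))

2^-cancel-< : ∀ {a b} → 2 ^ a < 2 ^ b → a < b
2^-cancel-< {a} {b} h with a <? b
... | yes a<b = a<b
... | no a≮b  = contradiction h (≤⇒≯ (^-monoʳ-≤ 2 (≮⇒≥ a≮b)))

square≤3*2^ : ∀ g → g * g ≤ 3 * 2 ^ g
square≤3*2^ g = ≤-trans (≤-trans (m≤m+n (g * g) (2 * g)) (m≤m+n _ 3)) (stronger g)
  where
  open ≤-Reasoning
  expand : ∀ g → suc g * suc g + 2 * suc g + 3 + g * g ≡ 2 * (g * g + 2 * g + 3)
  expand = solve-∀
  swap : ∀ p → 2 * (3 * p) ≡ 3 * (2 * p)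
  swap = solve-∀
  stronger : ∀ g → g * g + 2 * g + 3 ≤ 3 * 2 ^ g
  stronger zero    = ≤-refl
  stronger (suc g) = begin
    suc g * suc g + 2 * suc g + 3  ≤⟨ m≤m+n _ (g * g) ⟩
    suc g * suc g + 2 * suc g + 3 + g * g  ≡⟨ expand g ⟩
    2 * (g * g + 2 * g + 3)  ≤⟨ *-monoʳ-≤ 2 (stronger g) ⟩
    2 * (3 * 2 ^ g)  ≡⟨ swap (2 ^ g) ⟩
    3 * 2 ^ suc g ∎

-- Either k is a power of n, or it is smaller than the largest admissible scale by a power of n.
scale-count-≤ : ∀ {P κ g l p q} → 1 ≤ P → 1 ≤ κ → 1 ≤ l → suc (l + l) ≤ suc (κ + g) * P → l ≤ p * q → 2 ^ g ≤ q →
  suc (suc l + suc l) * (κ + suc (suc l + suc l)) ≤ (30 * P * p + 90 * (P * P)) * κ * q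
scale-count-≤ {P} {κ} {g} {l} {p} {q} 1≤P 1≤κ 1≤l hP hl hq = split (g ≤? κ)
  where
  open ≤-Reasoning
  I : ℕ
  I = suc (suc l + suc l)
  I≤ : ∀ {x} → 1 ≤ x → κ ≤ x → g ≤ x → I ≤ 5 * (x * P)
  I≤ {x} 1≤x κ≤x g≤x = begin
    I  ≡⟨ perm₁ l ⟩
    suc (l + l) + 2 * (1 * 1)  ≤⟨ +-mono-≤ hP (*-monoʳ-≤ 2 (*-mono-≤ 1≤x 1≤P)) ⟩
    suc (κ + g) * P + 2 * (x * P)  ≤⟨ +-monoˡ-≤ (2 * (x * P)) (*-monoˡ-≤ P (+-mono-≤ 1≤x (+-mono-≤ κ≤x g≤x))) ⟩
    (x + (x + x)) * P + 2 * (x * P)  ≡⟨ perm₂ x P ⟩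
    5 * (x * P) ∎
    where
    perm₁ : ∀ l → suc (suc l + suc l) ≡ suc (l + l) + 2 * (1 * 1)
    perm₁ = solve-∀
    perm₂ : ∀ x P → (x + (x + x)) * P + 2 * (x * P) ≡ 5 * (x * P)
    perm₂ = solve-∀
  κ+I≤ : ∀ {x} → κ ≤ x → I ≤ 5 * (x * P) → κ + I ≤ 6 * (x * P)
  κ+I≤ {x} κ≤x h = +-mono-≤ (≤-trans κ≤x (≤-trans (≤-reflexive (sym (*-identityʳ x))) (*-monoʳ-≤ x 1≤P))) h
  split : Dec (g ≤ κ) → I * (κ + I) ≤ (30 * P * p + 90 * (P * P)) * κ * q
  -- One factor is of order `l` and paid by `hl`; the other is linear in `κ`.
  split (yes g≤κ) = begin
    I * (κ + I)
      ≤⟨ *-mono-≤ I≤5l (κ+I≤ ≤-refl (I≤ 1≤κ ≤-refl g≤κ)) ⟩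
    5 * l * (6 * (κ * P))
      ≤⟨ *-monoˡ-≤ (6 * (κ * P)) (*-monoʳ-≤ 5 hl) ⟩
    5 * (p * q) * (6 * (κ * P))
      ≡⟨ perm p q κ P ⟩
    30 * P * p * κ * q
      ≤⟨ *-monoˡ-≤ q (*-monoˡ-≤ κ (m≤m+n (30 * P * p) (90 * (P * P)))) ⟩
    (30 * P * p + 90 * (P * P)) * κ * q ∎
    where
    perm : ∀ p q κ P → 5 * (p * q) * (6 * (κ * P)) ≡ 30 * P * p * κ * q
    perm = solve-∀
    collect : ∀ l → suc (suc l + suc l) ≡ 2 * l + 3 * 1
    collect = solve-∀
    merge-5 : ∀ l → 2 * l + 3 * l ≡ 5 * l
    merge-5 = solve-∀
    I≤5l : I ≤ 5 * l
    I≤5l = begin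
      I  ≡⟨ collect l ⟩
      2 * l + 3 * 1  ≤⟨ +-monoʳ-≤ (2 * l) (*-monoʳ-≤ 3 1≤l) ⟩
      2 * l + 3 * l  ≡⟨ merge-5 l ⟩
      5 * l ∎
  -- Both factors are linear in `g`, and `g * g` is at most `3 * 2 ^ g`.
  split (no g≰κ) = begin
    I * (κ + I)
      ≤⟨ *-mono-≤ I≤g (κ+I≤ κ≤g I≤g) ⟩
    5 * (g * P) * (6 * (g * P))
      ≡⟨ perm₁ g P ⟩
    30 * (P * P) * (g * g)
      ≤⟨ *-monoʳ-≤ (30 * (P * P)) (≤-trans (square≤3*2^ g) (*-monoʳ-≤ 3 hq)) ⟩
    30 * (P * P) * (3 * q)
      ≡⟨ perm₂ P q ⟩
    90 * (P * P) * 1 * q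
      ≤⟨ *-monoˡ-≤ q (*-mono-≤ (m≤n+m (90 * (P * P)) (30 * P * p)) 1≤κ) ⟩
    (30 * P * p + 90 * (P * P)) * κ * q ∎
    where
    κ≤g : κ ≤ g
    κ≤g = <⇒≤ (≰⇒> g≰κ)
    I≤g : I ≤ 5 * (g * P)
    I≤g = I≤ (≤-trans 1≤κ κ≤g) κ≤g ≤-refl
    perm₁ : ∀ g P → 5 * (g * P) * (6 * (g * P)) ≡ 30 * (P * P) * (g * g)
    perm₁ = solve-∀
    perm₂ : ∀ P q → 30 * (P * P) * (3 * q) ≡ 90 * (P * P) * 1 * q
    perm₂ = solve-∀

module ToGraph {n : ℕ} where

  open Digraphs {n} public

  -- An edge is kept only if both orders survive. This loses no edge of `H`, whose two orders both
  -- lie in `D`, and lets each edge be charged to one pair of `D`.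
  symmetrize : (E → Bool) → Graph n
  symmetrize D = record
    { adj   = λ i j → (D (i , j) ∧ D (j , i)) ∧ not ⌊ i Fin.≟ j ⌋
    ; sym   = λ i j → cong₂ _∧_ (Bool.∧-comm (D (i , j)) (D (j , i))) (cong not (swap i j))
    ; irref = λ i → trans (cong (λ z → (D (i , i) ∧ D (i , i)) ∧ not z) (diagonal i)) (Bool.∧-zeroʳ _)
    }
    where
    swap : ∀ (i j : Fin n) → ⌊ i Fin.≟ j ⌋ ≡ ⌊ j Fin.≟ i ⌋
    swap i j with i Fin.≟ j | j Fin.≟ i
    ... | yes _ | yes _ = refl
    ... | no _  | no _  = refl
    ... | yes p | no ¬q = contradiction (sym p) ¬q
    ... | no ¬p | yes q = contradiction (sym q) ¬p
    diagonal : ∀ (i : Fin n) → ⌊ i Fin.≟ i ⌋ ≡ true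
    diagonal i with i Fin.≟ i
    ... | yes _ = refl
    ... | no ¬p = contradiction refl ¬p

  ⊑⇒⊆G : ∀ H D → pairs H ⊑ D → H ⊆G symmetrize D
  ⊑⇒⊆G H D H⊑D i j ij with i Fin.≟ j
  ... | yes refl = contradiction (trans (sym ij) (irref H i)) λ ()
  ... | no _ rewrite H⊑D (i , j) ij | H⊑D (j , i) (trans (Defs.sym H j i) ij) = refl

  e≤size : ∀ D → e (symmetrize D) ≤ size D
  e≤size D = begin
    e (symmetrize D)
      ≡⟨ trans (sum-map (allFin n) _) (∑-cong (allFin n) (λ i → sum-map (allFin n) _)) ⟩
    ∑ (allFin n) (λ i → ∑ (allFin n) (λ j →
      if ⌊ toℕ i <? toℕ j ⌋ ∧ adj (symmetrize D) i j then 1 else 0))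
      ≤⟨ ∑-mono (allFin n) (λ i → ∑-mono (allFin n) (λ j →
           pointwise ⌊ toℕ i <? toℕ j ⌋ (D (i , j)) (D (j , i)) (not ⌊ i Fin.≟ j ⌋))) ⟩
    ∑ (allFin n) (λ i → ∑ (allFin n) (λ j → ⟦ present? D (i , j) ⟧))
      ≡⟨ sym (size-∑ D) ⟩
    size D ∎
    where
    open ≤-Reasoning
    sum-map : ∀ {A : Set} (xs : List A) (f : A → ℕ) → sum (map f xs) ≡ ∑ xs f
    sum-map []       f = refl
    sum-map (x ∷ xs) f = cong (f x +_) (sum-map xs f)
    pointwise : ∀ w x y z → (if w ∧ ((x ∧ y) ∧ z) then 1 else 0) ≤ ⟦ x Bool.≟ true ⟧
    pointwise false x     y     z     = z≤n
    pointwise true  false y     z     = z≤n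
    pointwise true  true  false z     = z≤n
    pointwise true  true  true  false = z≤n
    pointwise true  true  true  true  = ≤-refl

-- Constants of the theorem and the final estimates

module Assembly (s₂ t₁ : ℕ) where

  open Constants s₂ t₁

  -- `P = s (s t - 1)` is the exponent of the range condition, and `C₆` is the constant of
  -- `scale-count-≤` at `p = 2 ^ s′`. In `n₀` the 8 forces `1 ≤ l` and the power of two forces
  -- `c + c₃ ≤ κ`.
  P C₆ C n₀ : ℕ
  P  = r * s
  C₆ = 30 * P * 2 ^ s′ + 90 * (P * P)
  C  = 2 ^ s′ * ((4 + C₆) * (4 * 2 ^ c * C₄ * s))
  n₀ = 8 + 2 ^ (c + c₃)

  private
    edge-exponent : 2 * s ∸ 1 ≡ s + s′
    edge-exponent = trans (cong (s′ +_) (+-identityʳ s)) (+-comm s′ s)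

    range-exponent : s * (s * t ∸ 1) ≡ P
    range-exponent = trans (*-comm s (s * t ∸ 1)) (cong (λ z → (z ∸ 1) * s) (*-comm s t))

  Conclusion : ℕ → ℕ → Set
  Conclusion n k = Σ (List (Graph n)) λ 𝒢 →
    (∀ (N : ℕ) → AtLeastPow s n N → (length 𝒢) ^ (k ^ (s ∸ 1)) ≤ k ^ (C * N)) ×
    All (λ G → EdgeBound s n k (e G)) 𝒢 ×
    (∀ (H : Graph n) → KFree s t H → Any (λ G → H ⊆G G) 𝒢)

  -- All parameters are floors: `κ` of log₂ k, `κ∞` of (s-1)/(s(st-1)) log₂ n, `N` of n^(2-1/s),
  -- while log₂ n lies in [2l+1 , 2l+3).
  module _ {n k l κ κ∞ N : ℕ} (n₀≤n : n₀ ≤ n) (n₀≤k : n₀ ≤ k) (range : KRange s t n k)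
    (l-lo : 2 ^ suc (l + l) ≤ n) (l-hi : n < 2 ^ suc (suc l + suc l))
    (κ-lo : 2 ^ κ ≤ k) (κ-hi : k < 2 ^ suc κ)
    (κ∞-lo : 2 ^ (κ∞ * r * s) ≤ n ^ s′) (κ∞-hi : n ^ s′ < 2 ^ (suc κ∞ * r * s))
    (N-lo : N ^ s ≤ n ^ (s + s′)) (N-hi : n ^ (s + s′) < suc N ^ s)
    where

    open ≤-Reasoning

    private
      1≤n : 1 ≤ n
      1≤n = ≤-trans (s≤s z≤n) n₀≤n

      instance
        n-nonZero : NonZero n
        n-nonZero = >-nonZero 1≤n

      1≤N : 1 ≤ N
      1≤N = positive N N-hi
        where
        positive : ∀ N → n ^ (s + s′) < suc N ^ s → 1 ≤ N
        positive (suc N) _ = s≤s z≤n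
        positive zero    h = contradiction (≤-trans h (≤-reflexive (^-zeroˡ s))) (≤⇒≯ (m^n>0 n (s + s′)))

      1≤l : 1 ≤ l
      1≤l = positive l l-hi
        where
        positive : ∀ l → n < 2 ^ suc (suc l + suc l) → 1 ≤ l
        positive (suc l) _ = s≤s z≤n
        positive zero    h = contradiction h (≤⇒≯ (≤-trans (m≤m+n 8 (2 ^ (c + c₃))) n₀≤n))

      κ-large : c + c₃ ≤ κ
      κ-large = ≤-pred (2^-cancel-< (≤-<-trans (≤-trans (m≤n+m (2 ^ (c + c₃)) 8) n₀≤k) κ-hi))

      1≤κ : 1 ≤ κ
      1≤κ = ≤-trans (≤-trans (≤-trans (s≤s z≤n) (m≤n+m c₅ (C₁ + c₂))) (m≤m+n c c₃)) κ-large

      -- The hypothesis on `k` in terms of scales. It is used twice: `1 ≤ l` turns it into `κ ≤ κ∞`,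
      -- and cancelling `2 ^ (κ * s′)` turns it into a bound for `l`, hence for log n, by a power of
      -- `2 ^ g`.
      below-κ∞ : 2 ^ (κ * s′) * l < 2 ^ (suc κ∞ * s′)
      below-κ∞ = ^-cancel-< P (begin-strict
        (2 ^ (κ * s′) * l) ^ P
          ≤⟨ ^-monoˡ-≤ P (*-monoˡ-≤ l (≤-trans (≤-reflexive (sym (^-*-assoc 2 κ s′))) (^-monoˡ-≤ s′ κ-lo))) ⟩
        (k ^ s′ * l) ^ P
          ≤⟨ subst (λ z → (k ^ s′ * l) ^ z ≤ n ^ (s′ * s′)) range-exponent (range-ℕ {s} {t} {n} {k} l l-lo range) ⟩
        n ^ (s′ * s′)
          ≡⟨ sym (^-*-assoc n s′ s′) ⟩
        (n ^ s′) ^ s′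
          <⟨ ^-monoˡ-< s′ κ∞-hi ⟩
        (2 ^ (suc κ∞ * r * s)) ^ s′
          ≡⟨ ^-*-assoc 2 (suc κ∞ * r * s) s′ ⟩
        2 ^ (suc κ∞ * r * s * s′)
          ≡⟨ cong (2 ^_) (perm (suc κ∞) r s s′) ⟩
        2 ^ (suc κ∞ * s′ * P)
          ≡⟨ sym (^-*-assoc 2 (suc κ∞ * s′) P) ⟩
        (2 ^ (suc κ∞ * s′)) ^ P ∎)
        where
        perm : ∀ x r s s′ → x * r * s * s′ ≡ x * s′ * (r * s)
        perm = solve-∀

      κ≤κ∞ : κ ≤ κ∞
      κ≤κ∞ = ≤-pred (*-cancelʳ-< s′ κ (suc κ∞) (2^-cancel-< (≤-<-trans
        (≤-trans (≤-reflexive (sym (*-identityʳ (2 ^ (κ * s′))))) (*-monoʳ-≤ (2 ^ (κ * s′)) 1≤l)) below-κ∞)))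

      g : ℕ
      g = κ∞ ∸ κ

      κ+g : κ + g ≡ κ∞
      κ+g = m+[n∸m]≡n κ≤κ∞

      l≤ : l ≤ 2 ^ s′ * 2 ^ (s′ * g)
      l≤ = <⇒≤ (*-cancelˡ-< (2 ^ (κ * s′)) l _ (≤-trans below-κ∞ (≤-reflexive (begin-equality
        2 ^ (suc κ∞ * s′)  ≡⟨ cong (λ z → 2 ^ (suc z * s′)) (sym κ+g) ⟩
        2 ^ (suc (κ + g) * s′)  ≡⟨ cong (2 ^_) (perm κ g s′) ⟩
        2 ^ (κ * s′ + (s′ + s′ * g))  ≡⟨ ^-distribˡ-+-* 2 (κ * s′) _ ⟩
        2 ^ (κ * s′) * 2 ^ (s′ + s′ * g)  ≡⟨ cong (2 ^ (κ * s′) *_) (^-distribˡ-+-* 2 s′ (s′ * g)) ⟩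
        2 ^ (κ * s′) * (2 ^ s′ * 2 ^ (s′ * g)) ∎))))
        where
        perm : ∀ κ g s → suc (κ + g) * s ≡ κ * s + (s + s * g)
        perm = solve-∀

      l≤κ∞ : suc (l + l) ≤ suc (κ + g) * P
      l≤κ∞ = begin
        suc (l + l)  ≤⟨ <⇒≤ (2^-cancel-< (≤-<-trans (≤-trans l-lo (≤-trans (≤-reflexive (sym (^-identityʳ n)))
                                     (^-monoʳ-≤ n (s≤s {0} {s₂} z≤n)))) κ∞-hi)) ⟩
        suc κ∞ * r * s  ≡⟨ *-assoc (suc κ∞) r s ⟩
        suc κ∞ * P  ≡⟨ cong (λ z → suc z * P) (sym κ+g) ⟩
        suc (κ + g) * P ∎

      I : ℕ
      I = suc (suc l + suc l)

      scales : I * (κ + I) ≤ C₆ * κ * 2 ^ (s′ * g)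
      scales = scale-count-≤ {P} {κ} {g} {l} {2 ^ s′} {2 ^ (s′ * g)} (s≤s z≤n) 1≤κ 1≤l l≤κ∞ l≤
        (^-monoʳ-≤ 2 (m≤m+n g (s₂ * g)))

      setting : Setting n N κ∞
      setting = record
        { 1≤n = 1≤n
        ; N-large = ≤-trans (<⇒≤ N-hi) (^-monoˡ-≤ s (≤-trans (+-monoˡ-≤ N 1≤N) (≤-reflexive (cong (N +_) (sym (+-identityʳ N))))))
        ; κ∞-small = κ∞-lo
        }

    open ToGraph {n}

    private
      module Sc = Scales s₂ t₁ {n} {N} {κ∞} setting k κ g κ-large κ+g κ-lo κ-hi

      -- Since `n < 2 ^ I`, doubling `k * N` as often as `I` times reaches the full relation.
      full≤ : size (λ _ → true) ≤ Sc.Q I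
      full≤ = begin
        size (λ _ → true)  ≤⟨ size≤ (λ _ → true) ⟩
        n * n  ≤⟨ *-mono-≤ (<⇒≤ l-hi) (Density.half-≤ s₂ {n} {N} 1≤n (Setting.N-large setting)) ⟩
        2 ^ I * (2 * N)  ≤⟨ *-monoʳ-≤ (2 ^ I) (*-monoˡ-≤ N (≤-trans (s≤s (s≤s z≤n)) n₀≤k)) ⟩
        2 ^ I * (k * N) ∎

      -- The factor `κ` of the total cost becomes the logarithm of the base through `2 ^ κ ≤ k`. Any
      -- admissible `M` dominates `N` because `N` is the floor of n^(2-1/s).
      few : ∀ {L} M → L ≤ 2 ^ ∑< Sc.cost I → AtLeastPow s n M → L ^ (k ^ s′) ≤ k ^ (C * M)
      few {L} M L≤ M-large = begin
        L ^ (k ^ s′)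
          ≤⟨ ^-monoˡ-≤ (k ^ s′) L≤ ⟩
        (2 ^ ∑< Sc.cost I) ^ (k ^ s′)
          ≡⟨ ^-*-assoc 2 (∑< Sc.cost I) (k ^ s′) ⟩
        2 ^ (∑< Sc.cost I * k ^ s′)
          ≤⟨ ^-monoʳ-≤ 2 (Sc.total-cost-≤ {I} {C₆} scales) ⟩
        2 ^ (2 ^ s′ * ((4 + C₆) * (4 * 2 ^ c * C₄ * s * N * κ)))
          ≤⟨ ^-monoʳ-≤ 2 (*-monoʳ-≤ (2 ^ s′) (*-monoʳ-≤ (4 + C₆) (*-monoˡ-≤ κ (*-monoʳ-≤ (4 * 2 ^ c * C₄ * s) N≤M)))) ⟩
        2 ^ (2 ^ s′ * ((4 + C₆) * (4 * 2 ^ c * C₄ * s * M * κ)))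
          ≡⟨ cong (2 ^_) (perm (2 ^ s′) (4 + C₆) (4 * 2 ^ c * C₄ * s) M κ) ⟩
        2 ^ (κ * (C * M))
          ≡⟨ sym (^-*-assoc 2 κ (C * M)) ⟩
        (2 ^ κ) ^ (C * M)
          ≤⟨ ^-monoˡ-≤ (C * M) κ-lo ⟩
        k ^ (C * M) ∎
        where
        perm : ∀ x y z m κ → x * (y * (z * m * κ)) ≡ κ * (x * (y * z) * m)
        perm = solve-∀
        N≤M : N ≤ M
        N≤M = ^-cancel-≤ s′ (≤-trans N-lo (subst (λ z → n ^ z ≤ M ^ s) edge-exponent M-large))

      sparse : ∀ D → size D ≤ Sc.Q 0 → EdgeBound s n k (e (symmetrize D))
      sparse D D≤ = begin
        e (symmetrize D) ^ s  ≤⟨ ^-monoˡ-≤ s (≤-trans (e≤size D) (≤-trans D≤ (≤-reflexive (*-identityˡ (k * N))))) ⟩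
        (k * N) ^ s  ≡⟨ ^-distribʳ-* k N s ⟩
        k ^ s * N ^ s  ≤⟨ *-monoʳ-≤ (k ^ s) N-lo ⟩
        k ^ s * n ^ (s + s′)  ≡⟨ cong (λ z → k ^ s * n ^ z) (sym edge-exponent) ⟩
        k ^ s * n ^ (2 * s ∸ 1) ∎

    conclusion : Conclusion n k
    conclusion = finish (Sc.descend I (λ _ → true) full≤)
      where
      finish : Sc.GraphCover (λ _ → true) (2 ^ ∑< Sc.cost I) (λ D → size D ≤ Sc.Q 0) → Conclusion n k
      finish (𝒟 , len , small , cov) = map symmetrize 𝒟 ,
        (λ M M-large → few M (≤-trans (≤-reflexive (length-map symmetrize 𝒟)) len) M-large) ,
        All.map⁺ (All.map (λ {D} → sparse D) small) ,
        λ H free → Any.map⁺ (Any.map (λ {D} → ⊑⇒⊆G H D) (cov H free (λ _ _ → refl)))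

theorem7p6 : ∀ (s t : ℕ) → 2 ≤ s → s ≤ t →
    Σ ℕ λ C → Σ ℕ λ n₀ → ∀ (n k : ℕ) → n₀ ≤ n → n₀ ≤ k → KRange s t n k →
    Σ (List (Graph n)) λ 𝒢 →
    (∀ (N : ℕ) → AtLeastPow s n N → (length 𝒢) ^ (k ^ (s ∸ 1)) ≤ k ^ (C * N)) ×
    All (λ G → EdgeBound s n k (e G)) 𝒢 ×
    (∀ (H : Graph n) → KFree s t H → Any (λ G → H ⊆G G) 𝒢)
theorem7p6 (suc (suc s₂)) (suc (suc t₁)) (s≤s (s≤s z≤n)) (s≤s (s≤s _)) = C , n₀ , main
  where
  open Constants s₂ t₁
  open Assembly s₂ t₁
  main : ∀ n k → n₀ ≤ n → n₀ ≤ k → KRange s t n k → Conclusion n k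
  main n k n₀≤n n₀≤k range
    with bracket (λ l → 2 ^ suc (l + l)) n n (≤-trans (s≤s (s≤s z≤n)) n₀≤n)
           (<-≤-trans (m<2^m n) (^-monoʳ-≤ 2 (≤-trans (m≤m+n n n) (n≤1+n (n + n)))))
       | log₂ k (≤-trans (s≤s z≤n) n₀≤k)
       | bracket (λ x → 2 ^ (x * r * s)) (n ^ s′) (n ^ s′) (m^n>0 n {{>-nonZero (≤-trans (s≤s z≤n) n₀≤n)}} s′)
           (<-≤-trans (m<2^m (n ^ s′)) (^-monoʳ-≤ 2 (≤-trans (m≤m*n (n ^ s′) (r * s)) (≤-reflexive (sym (*-assoc (n ^ s′) r s))))))
       | bracket (λ x → x ^ s) (n ^ (s + s′)) (suc (n ^ (s + s′))) z≤n
           (≤-trans (≤-reflexive (sym (*-identityʳ (suc (n ^ (s + s′))))))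
             (^-monoʳ-≤ (suc (n ^ (s + s′))) {1} {s} (s≤s z≤n)))
  ... | l , l-lo , l-hi | κ , κ-lo , κ-hi | κ∞ , κ∞-lo , κ∞-hi | N , N-lo , N-hi =
    conclusion {n} {k} {l} {κ} {κ∞} {N} n₀≤n n₀≤k range l-lo l-hi κ-lo κ-hi κ∞-lo κ∞-hi N-lo N-hi
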